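{- Fix an integer $d\geq 2$ and a partition $\mu=(\mu_1,\dots,\mu_l)$ of $d$ (so $l=l(\mu)$). Then there exist rational numbers $\vec{C}(\mu;k,i)\in\mathbb{Q}$, for $1\leq k\leq d-1$ and $1\leq i\leq \lfloor (d-1)/k\rfloor$, independent of $g$, such that for every genus $g\in\mathbb{Z}_{\geq 0}$, \[ \mu_1\cdots\mu_l\cdot\vec{H}_{g;\mu} =\sum_{k=1}^{d-1}\ \sum_{1\leq i\leq \lfloor (d-1)/k\rfloor} \Big(\vec{C}(\mu;k,i)\cdot (2g-2+d+l)^{i-1} \cdot k^{2g-2+d+l}\Big). \]
   Context: A partition $\mu=(\mu_1,\dots,\mu_l)$ of $d$ is a weakly decreasing sequence of positive integers with sum $d$; $l=l(\mu)$ is its length. Let $m_j(\mu)=\#\{i:\mu_i=j\}$ and $|\mathrm{Aut}(\mu)|=\prod_{j\geq1} m_j(\mu)!$. For a partition $\mu$ of $d$, $C_\mu\subset S_d$ denotes the conjugacy class of permutations with cycle lengths $\mu_1,\dots,\mu_l$; $C_{(2,1^{d-2})}$ is the class of transpositions. For $g\geq 0$ set $b=2g-2+d+l(\mu)$. The connected monotone Hurwitz number is \[ \vec{H}_{g;\mu}=\frac{|\mathrm{Aut}(\mu)|}{d!}\cdot\#\{(\sigma_1,\dots,\sigma_{b+1}) : \sigma_1\in C_\mu,\ \sigma_i\in C_{(2,1^{d-2})}\ (2\leq i\leq b+1),\ \sigma_1\sigma_2\cdots\sigma_{b+1}=\mathrm{id},\ \langle\sigma_1,\dots,\sigma_{b+1}\rangle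 \text{ acts transitively on }\{1,\dots,d\},\ B_2\leq B_3\leq\cdots\leq B_{b+1}\}, \] where for $2\leq i\leq b+1$ one writes the transposition $\sigma_i=(A_i,B_i)$ with $A_i<B_i$. -}

module Defs where

open import Data.Nat as ℕ using (ℕ; zero; suc; _+_; _*_; _∸_; _^_; _≤_; _<_; _!; _≤ᵇ_)
open import Data.Nat.Properties using (_!≢0)
open import Data.Nat.DivMod using (_/_)
open import Data.Integer using (+_)
open import Data.Rational as ℚ using (ℚ; 0ℚ)
open import Data.Fin as Fin using (Fin; toℕ)
open import Data.Fin.Properties using () renaming (_≟_ to _≟F_)
open import Data.Bool using (Bool; true; false; if_then_else_)
open import Data.List as L using (List; []; _∷_; length; map; filterᵇ; upTo; allFin)
open import Data.Nat.ListAction using (sum; product)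
open import Data.Bool.ListAction using (all)
open import Data.List.Relation.Unary.All as LAll using ()
open import Data.List.Relation.Unary.Linked using (Linked)
open import Data.List.Relation.Unary.Unique.Propositional using (Unique)
open import Data.List.Membership.Propositional using (_∈_)
open import Data.List.Relation.Binary.Permutation.Propositional using (_↭_)
open import Data.Vec as V using (Vec; lookup; toList)
open import Data.Vec.Relation.Unary.All as VAll using ()
open import Data.Product using (Σ; _×_; _,_; proj₁; proj₂; ∃-syntax)
open import Function using (_∘_; _⇔_; Injective)
open import Relation.Binary.PropositionalEquality using (_≡_)
open import Relation.Nullary using (does)

record IsPartition (d : ℕ) (μ : List ℕ) : Set where
  field
    positive   : LAll.All (λ m → 1 ≤ m) μ
    decreasing : Linked (λ a b → b ≤ a) μ
    sums       : sum μ ≡ d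

mult : ℕ → List ℕ → ℕ
mult j μ = length (filterᵇ (λ m → does (j ℕ.≟ m)) μ)

-- |Aut(μ)| = ∏_{j ≥ 1} m_j(μ)!   (parts of a partition of d are ≤ d,
-- hence it suffices to take j = 1 … d)
autSize : ℕ → List ℕ → ℕ
autSize d μ = product (map (λ j → mult (suc j) μ !) (upTo d))

Card : {A : Set} → (A → Set) → ℕ → Set
Card {A} P n = Σ (List A) λ xs → Unique xs × (∀ a → (a ∈ xs) ⇔ P a) × length xs ≡ n

-- Permutations of {1,…,d} (here Fin d); a map Fin d → Fin d is stored
-- as the vector of its values.

iter : ∀ {d} → (Fin d → Fin d) → ℕ → Fin d → Fin d
iter f zero    x = x
iter f (suc k) x = f (iter f k x)

-- least k ∈ {start, …, start+fuel-1} with f^k x = x (0 if none)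
findLen : ∀ {d} → (Fin d → Fin d) → Fin d → ℕ → ℕ → ℕ
findLen f x k zero       = 0
findLen f x k (suc fuel) = if does (iter f k x ≟F x) then k else findLen f x (suc k) fuel

cycleLength : ∀ {d} → (Fin d → Fin d) → Fin d → ℕ
cycleLength {d} f x = findLen f x 1 d

isCycleRep : ∀ {d} → (Fin d → Fin d) → Fin d → Bool
isCycleRep f x = all (λ j → toℕ x ≤ᵇ toℕ (iter f j x)) (upTo (cycleLength f x))

cycleLengths : ∀ {d} → (Fin d → Fin d) → List ℕ
cycleLengths {d} f = map (cycleLength f) (filterᵇ (isCycleRep f) (allFin d))

InClass : ∀ {d} → (Fin d → Fin d) → List ℕ → Set
InClass f μ = Injective _≡_ _≡_ f × (cycleLengths f ↭ μ)

swap : ∀ {d} → Fin d × Fin d → Fin d → Fin d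
swap (a , b) x = if does (x ≟F a) then b else (if does (x ≟F b) then a else x)

prodT : ∀ {d b} → Vec (Fin d × Fin d) b → Fin d → Fin d
prodT V.[]       x = x
prodT (t V.∷ ts) x = swap t (prodT ts x)

gen : ∀ {d b} → Vec (Fin d) d → Vec (Fin d × Fin d) b → Fin (suc b) → Fin d → Fin d
gen σ ts Fin.zero    = lookup σ
gen σ ts (Fin.suc i) = swap (lookup ts i)

act : ∀ {d b} → Vec (Fin d) d → Vec (Fin d × Fin d) b → List (Fin (suc b)) → Fin d → Fin d
act σ ts []      x = x
act σ ts (i ∷ w) x = act σ ts w (gen σ ts i x)

-- the group generated by σ_1,…,σ_{b+1} acts transitively on Fin d
-- (in a finite group every element is a positive word in the generators)
Transitive : ∀ {d b} → Vec (Fin d) d → Vec (Fin d × Fin d) b → Set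
Transitive {d} {b} σ ts = ∀ (x y : Fin d) → ∃[ w ] act σ ts w x ≡ y

bNum : ℕ → List ℕ → ℕ → ℕ
bNum d μ g = 2 * g + d + length μ ∸ 2

-- tuples (σ_1, σ_2, …, σ_{b+1}); a transposition σ_i = (A_i,B_i) with A_i < B_i
-- is recorded as the pair (A_i , B_i)
MonotoneTuple : (d : ℕ) → List ℕ → (g : ℕ) → Set
MonotoneTuple d μ g = Vec (Fin d) d × Vec (Fin d × Fin d) (bNum d μ g)

IsMonotoneTuple : ∀ d μ g → MonotoneTuple d μ g → Set
IsMonotoneTuple d μ g (σ , ts) =
    InClass (lookup σ) μ
  × VAll.All (λ t → proj₁ t Fin.< proj₂ t) ts
  × (∀ x → lookup σ (prodT ts x) ≡ x)
  × Transitive σ ts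
  × Linked (λ s t → toℕ (proj₂ s) ≤ toℕ (proj₂ t)) (toList ts)

hurwitzFromCount : ℕ → List ℕ → ℕ → ℚ
hurwitzFromCount d μ N = ((+ autSize d μ) ℚ./ (d !)) {{d !≢0}} ℚ.* ((+ N) ℚ./ 1)

MonotoneHurwitz : ℕ → List ℕ → ℕ → ℚ → Set
MonotoneHurwitz d μ g H = ∃[ N ] (Card (IsMonotoneTuple d μ g) N × H ≡ hurwitzFromCount d μ N)

sumFrom : ℕ → ℕ → (ℕ → ℚ) → ℚ
sumFrom a zero    f = 0ℚ
sumFrom a (suc n) f = f a ℚ.+ sumFrom (suc a) n f

sumTo : ℕ → (ℕ → ℚ) → ℚ
sumTo n f = sumFrom 1 n f

-- ⌊ m / k ⌋ for k ≥ 1 (value at k = 0 irrelevant)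
floorDiv : ℕ → ℕ → ℕ
floorDiv m zero    = 0
floorDiv m (suc k) = m / suc k

fromℕ : ℕ → ℚ
fromℕ n = (+ n) ℚ./ 1

{-# OPTIONS --safe #-}
module Submission where

-- Since σ₁ is determined by the transpositions, one counts monotone sequences of b transpositions that connect
-- {1,…,d}, weighted by a function f of their product. Dropping connectedness but requiring the transpositions to
-- preserve a colouring, the sum is the value at the identity of h_b(J₁,…,J_d) f, where h_b is the complete
-- homogeneous symmetric polynomial and the J_k are the Jucys–Murphy elements of the colour classes; the connected
-- sum is recovered by triangular inversion over the possible partitions into components. The J_k are commuting
-- symmetric operators, and f is a sum of joint eigenvectors with integral eigenvalues. By the rules of Okounkov and
-- Vershik the eigenvalues on a class of n points behave like the contents of a standard tableau: every integer
-- from 0 to a nonzero value c occurs at least as often as c, whence |c| · multiplicity(c) ≤ n − 1. So h_b of the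
-- eigenvalues is, for b ≥ 1, a combination of b^(i−1) c^b with c ≠ 0 and i |c| ≤ d − 1, and as the parity of b
-- does not depend on g, the terms of c and −c merge.

open import Defs
open import Data.Nat using (ℕ; _≤_; _∸_; _^_; _*_; _+_)
open import Data.List using (List; length)
open import Data.Nat.ListAction using (product)
open import Data.Rational using (ℚ) renaming (_*_ to _*ℚ_)
open import Data.Product using (_×_; Σ-syntax)
open import Relation.Binary.PropositionalEquality using (_≡_)

open import Data.Bool using (if_then_else_)
open import Data.Empty using (⊥; ⊥-elim)
open import Data.Fin as Fin using (Fin; toℕ)
import Data.Fin.Properties as Finₚ
open import Data.Integer as ℤ using (ℤ; -[1+_]; 0ℤ; 1ℤ) renaming (+_ to pos)
import Data.Integer.Properties as ℤₚ
open import Data.List using ([]; _∷_; _++_; map; filter; allFin; cartesianProduct; reverse)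
import Data.List.Properties as Listₚ
open import Data.List.Membership.Propositional using (_∈_; _∉_)
import Data.List.Membership.DecPropositional as DecMembership
import Data.List.Membership.Propositional.Properties as ∈ₚ
open import Data.List.Membership.Propositional.Properties.WithK using (unique∧set⇒bag)
open import Data.List.Relation.Binary.BagAndSetEquality using (∼bag⇒↭)
open import Data.List.Relation.Binary.Permutation.Propositional as ↭ using (_↭_)
import Data.List.Relation.Binary.Permutation.Propositional.Properties as ↭ₚ
open import Data.List.Relation.Unary.All as All using (All; []; _∷_)
import Data.List.Relation.Unary.All.Properties as Allₚ
open import Data.List.Relation.Unary.AllPairs as AllPairs using (AllPairs; []; _∷_)
import Data.List.Relation.Unary.AllPairs.Properties as AllPairsₚ
open import Data.List.Relation.Unary.Any using (here; there)
import Data.List.Relation.Unary.Linked.Properties as Linkedₚ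
open import Data.List.Relation.Unary.Unique.Propositional using (Unique)
import Data.List.Relation.Unary.Unique.Propositional.Properties as Uniqueₚ
open import Data.Nat as ℕ using (zero; suc; z≤n; s≤s; _<_)
import Data.Nat.DivMod as DivMod
import Data.Nat.Properties as ℕₚ
open import Data.Product using (_,_; proj₁; proj₂; ∃-syntax)
open import Data.Rational as ℚ using (0ℚ; 1ℚ) renaming (_+_ to _+ℚ_; _-_ to _-ℚ_)
import Data.Rational.Properties as ℚₚ
import Data.Rational.Unnormalised as ℚᵘ
import Data.Rational.Unnormalised.Properties as ℚᵘₚ
open import Data.Sum using (_⊎_; inj₁; inj₂)
open import Data.Unit using (⊤; tt)
open import Data.Vec as Vec using (Vec; []; _∷_; lookup; tabulate)
import Data.Vec.Properties as Vecₚ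
import Data.Vec.Relation.Unary.All as VecAll
import Data.Vec.Relation.Unary.All.Properties as VecAllₚ
open import Function using (_∘_; id; mk⇔; Injective)
open import Level using (0ℓ)
open import Relation.Binary.PropositionalEquality using (_≢_; _≗_; refl; sym; trans; cong; cong₂; subst; module ≡-Reasoning)
import Relation.Binary
open import Relation.Nullary using (Dec; yes; no; ¬_; does; _×-dec_; _→-dec_; ¬?)
open import Relation.Nullary.Decidable using (dec⇒maybe; map′)
open import Relation.Unary using (Decidable)
open import Tactic.RingSolver using (solve-∀)
open import Tactic.RingSolver.Core.AlmostCommutativeRing using (AlmostCommutativeRing; fromCommutativeRing)

-- Over the rationals, symmetry alone does not provide eigenvalues, and certainly not integral ones.
-- Integrality is passed up each chain by the relation J s = s D + 1 between neighbouring
-- Jucys-Murphy elements D and J: integral roots for D yield a polynomial with integral roots that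
-- kills J, and symmetry then excludes Jordan blocks. The same relation gives the rules on contents.
-- A colouring is imposed on the whole set instead of treating its classes separately: this keeps a
-- single h_b in d operators and only removes summands from them. A class of n points contributes
-- the bound n - 1, and these bounds add up to at most d - 1. Connectedness can be read off the
-- transpositions, since σ₁ is the inverse of their product and cannot join two components. The
-- eigenvalue 0 would contribute 0^b, which is invisible for b ≥ 1; d ≥ 2 and l ≥ 1 force b ≥ 1.

ℚ-ring : AlmostCommutativeRing 0ℓ 0ℓ
ℚ-ring = fromCommutativeRing ℚₚ.+-*-commutativeRing (λ p → dec⇒maybe (0ℚ ℚₚ.≟ p))

-- The integers inside the rationals

abstract
  ι : ℤ → ℚ
  ι c = c ℚ./ 1

  ι≃ : ∀ c → ℚ.toℚᵘ (ι c) ℚᵘ.≃ ℚᵘ.mkℚᵘ c 0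
  ι≃ c = ℚₚ.toℚᵘ-fromℚᵘ (ℚᵘ.mkℚᵘ c 0)

  ι-+ : ∀ a b → ι (a ℤ.+ b) ≡ ι a +ℚ ι b
  ι-+ a b = ℚₚ.toℚᵘ-injective (begin
    ℚ.toℚᵘ (ι (a ℤ.+ b))                  ≈⟨ ι≃ (a ℤ.+ b) ⟩
    ℚᵘ.mkℚᵘ (a ℤ.+ b) 0                   ≈⟨ ℚᵘ.*≡* (cong (ℤ._* 1ℤ) (sym (cong₂ ℤ._+_ (ℤₚ.*-identityʳ a) (ℤₚ.*-identityʳ b)))) ⟩
    ℚᵘ.mkℚᵘ a 0 ℚᵘ.+ ℚᵘ.mkℚᵘ b 0          ≈⟨ ℚᵘₚ.+-cong (ι≃ a) (ι≃ b) ⟨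
    ℚ.toℚᵘ (ι a) ℚᵘ.+ ℚ.toℚᵘ (ι b)        ≈⟨ ℚₚ.toℚᵘ-homo-+ (ι a) (ι b) ⟨
    ℚ.toℚᵘ (ι a +ℚ ι b)                   ∎)
    where open ℚᵘₚ.≃-Reasoning

  ι-* : ∀ a b → ι (a ℤ.* b) ≡ ι a *ℚ ι b
  ι-* a b = ℚₚ.toℚᵘ-injective (begin
    ℚ.toℚᵘ (ι (a ℤ.* b))                  ≈⟨ ι≃ (a ℤ.* b) ⟩
    ℚᵘ.mkℚᵘ a 0 ℚᵘ.* ℚᵘ.mkℚᵘ b 0          ≈⟨ ℚᵘₚ.*-cong (ι≃ a) (ι≃ b) ⟨
    ℚ.toℚᵘ (ι a) ℚᵘ.* ℚ.toℚᵘ (ι b)        ≈⟨ ℚₚ.toℚᵘ-homo-* (ι a) (ι b) ⟨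
    ℚ.toℚᵘ (ι a *ℚ ι b)                   ∎)
    where open ℚᵘₚ.≃-Reasoning

  ι-injective : ∀ {a b} → ι a ≡ ι b → a ≡ b
  ι-injective {a} {b} e with ℚᵘₚ.≃-trans (ℚᵘₚ.≃-sym (ι≃ a)) (ℚᵘₚ.≃-trans (ℚₚ.toℚᵘ-cong e) (ι≃ b))
  ... | ℚᵘ.*≡* p = ℤₚ.*-cancelʳ-≡ a b 1ℤ p

  ι-fromℕ : ∀ n → ι (pos n) ≡ fromℕ n
  ι-fromℕ n = refl

x-y≡0⇒x≡y : ∀ x y → x -ℚ y ≡ 0ℚ → x ≡ y
x-y≡0⇒x≡y x y e = trans (lem x y) (trans (cong (_+ℚ y) e) (ℚₚ.+-identityˡ y))
  where lem : ∀ x y → x ≡ (x -ℚ y) +ℚ y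
        lem = solve-∀ ℚ-ring

x-x≡0 : ∀ x → x -ℚ x ≡ 0ℚ
x-x≡0 = ℚₚ.+-inverseʳ

*-inverse : ∀ c → c ≢ 0ℚ → ∃[ r ] c *ℚ r ≡ 1ℚ
*-inverse c c≢0 = (ℚ.1/ c) {{ℚ.≢-nonZero c≢0}} , ℚₚ.*-inverseʳ c {{ℚ.≢-nonZero c≢0}}

*-cancel-0 : ∀ c x → c ≢ 0ℚ → c *ℚ x ≡ 0ℚ → x ≡ 0ℚ
*-cancel-0 c x c≢0 e with r , cr ← *-inverse c c≢0 =
  trans (sym (ℚₚ.*-identityˡ x)) (trans (cong (_*ℚ x) (sym cr))
    (trans (lem c r x) (trans (cong (r *ℚ_) e) (ℚₚ.*-zeroʳ r))))
  where lem : ∀ c r x → c *ℚ r *ℚ x ≡ r *ℚ (c *ℚ x)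
        lem = solve-∀ ℚ-ring

square-nonneg : ∀ x → 0ℚ ℚ.≤ x *ℚ x
square-nonneg x with ℚₚ.≤-total 0ℚ x
... | inj₁ p = ℚₚ.nonNegative⁻¹ (x *ℚ x) {{ℚₚ.nonNeg*nonNeg⇒nonNeg x {{ℚ.nonNegative p}} x {{ℚ.nonNegative p}}}}
... | inj₂ p = ℚₚ.nonNegative⁻¹ (x *ℚ x) {{ℚₚ.nonPos*nonPos⇒nonPos x {{ℚ.nonPositive p}} x {{ℚ.nonPositive p}}}}

square-zero : ∀ x → x *ℚ x ≡ 0ℚ → x ≡ 0ℚ
square-zero x e with x ℚₚ.≟ 0ℚ
... | yes p = p
... | no p = *-cancel-0 x x p e

-- Finite sums over lists

Σℚ : {A : Set} → List A → (A → ℚ) → ℚ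
Σℚ []       h = 0ℚ
Σℚ (x ∷ xs) h = h x +ℚ Σℚ xs h

module _ {A : Set} where

  Σ-cong-∈ : ∀ (xs : List A) {h k : A → ℚ} → (∀ x → x ∈ xs → h x ≡ k x) → Σℚ xs h ≡ Σℚ xs k
  Σ-cong-∈ []       e = refl
  Σ-cong-∈ (x ∷ xs) e = cong₂ _+ℚ_ (e x (here refl)) (Σ-cong-∈ xs (λ y p → e y (there p)))

  Σ-cong : ∀ (xs : List A) {h k : A → ℚ} → h ≗ k → Σℚ xs h ≡ Σℚ xs k
  Σ-cong xs e = Σ-cong-∈ xs (λ x _ → e x)

  Σ-lin : ∀ (xs : List A) α β (h k : A → ℚ) →
          Σℚ xs (λ x → α *ℚ h x +ℚ β *ℚ k x) ≡ α *ℚ Σℚ xs h +ℚ β *ℚ Σℚ xs k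
  Σ-lin []       α β h k = lem α β
    where lem : ∀ α β → 0ℚ ≡ α *ℚ 0ℚ +ℚ β *ℚ 0ℚ
          lem = solve-∀ ℚ-ring
  Σ-lin (x ∷ xs) α β h k = trans (cong (α *ℚ h x +ℚ β *ℚ k x +ℚ_) (Σ-lin xs α β h k))
                                 (lem α β (h x) (k x) (Σℚ xs h) (Σℚ xs k))
    where lem : ∀ α β a b c d → (α *ℚ a +ℚ β *ℚ b) +ℚ (α *ℚ c +ℚ β *ℚ d) ≡ α *ℚ (a +ℚ c) +ℚ β *ℚ (b +ℚ d)
          lem = solve-∀ ℚ-ring

  Σ-+ : ∀ (xs : List A) (h k : A → ℚ) → Σℚ xs (λ x → h x +ℚ k x) ≡ Σℚ xs h +ℚ Σℚ xs k
  Σ-+ xs h k = trans (Σ-cong xs (λ x → lem (h x) (k x)))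
                     (trans (Σ-lin xs 1ℚ 1ℚ h k) (sym (lem (Σℚ xs h) (Σℚ xs k))))
    where lem : ∀ a b → a +ℚ b ≡ 1ℚ *ℚ a +ℚ 1ℚ *ℚ b
          lem = solve-∀ ℚ-ring

  Σ-* : ∀ (xs : List A) α (h : A → ℚ) → Σℚ xs (λ x → α *ℚ h x) ≡ α *ℚ Σℚ xs h
  Σ-* xs α h = trans (Σ-cong xs (λ x → lem α (h x)))
                     (trans (Σ-lin xs α 0ℚ h h) (sym (lem α (Σℚ xs h))))
    where lem : ∀ a b → a *ℚ b ≡ a *ℚ b +ℚ 0ℚ *ℚ b
          lem = solve-∀ ℚ-ring

  Σ-zero : ∀ (xs : List A) {h : A → ℚ} → (∀ x → x ∈ xs → h x ≡ 0ℚ) → Σℚ xs h ≡ 0ℚ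
  Σ-zero []       e = refl
  Σ-zero (x ∷ xs) e = cong₂ _+ℚ_ (e x (here refl)) (Σ-zero xs (λ y p → e y (there p)))

  Σ-++ : ∀ (xs ys : List A) h → Σℚ (xs ++ ys) h ≡ Σℚ xs h +ℚ Σℚ ys h
  Σ-++ []       ys h = sym (ℚₚ.+-identityˡ _)
  Σ-++ (x ∷ xs) ys h = trans (cong (h x +ℚ_) (Σ-++ xs ys h)) (sym (ℚₚ.+-assoc (h x) (Σℚ xs h) (Σℚ ys h)))

  Σ-↭ : ∀ {xs ys : List A} h → xs ↭ ys → Σℚ xs h ≡ Σℚ ys h
  Σ-↭ h ↭.refl         = refl
  Σ-↭ h (↭.prep x p)   = cong (h x +ℚ_) (Σ-↭ h p)
  Σ-↭ h (↭.swap x y p) = trans (cong (λ z → h x +ℚ (h y +ℚ z)) (Σ-↭ h p)) (lem (h x) (h y) _)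
    where lem : ∀ a b c → a +ℚ (b +ℚ c) ≡ b +ℚ (a +ℚ c)
          lem = solve-∀ ℚ-ring
  Σ-↭ h (↭.trans p q)  = trans (Σ-↭ h p) (Σ-↭ h q)

  Σ-map : ∀ {B : Set} (φ : B → A) (xs : List B) h → Σℚ (map φ xs) h ≡ Σℚ xs (h ∘ φ)
  Σ-map φ []       h = refl
  Σ-map φ (x ∷ xs) h = cong (h (φ x) +ℚ_) (Σ-map φ xs h)

  Σ-reindex : ∀ {xs : List A} (φ : A → A) → Unique xs → (∀ {x y} → φ x ≡ φ y → x ≡ y) →
              (∀ {x} → x ∈ xs → φ x ∈ xs) → (∀ {x} → x ∈ xs → ∃[ y ] (y ∈ xs × x ≡ φ y)) →
              ∀ h → Σℚ xs (h ∘ φ) ≡ Σℚ xs h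
  Σ-reindex {xs} φ u inj into onto h = trans (sym (Σ-map φ xs h)) (Σ-↭ h
    (∼bag⇒↭ (unique∧set⇒bag (Uniqueₚ.map⁺ inj u) u (mk⇔ fwd bwd))))
    where fwd : ∀ {x} → x ∈ map φ xs → x ∈ xs
          fwd p with y , q , refl ← ∈ₚ.∈-map⁻ φ p = into q
          bwd : ∀ {x} → x ∈ xs → x ∈ map φ xs
          bwd p with y , q , refl ← onto p = ∈ₚ.∈-map⁺ φ q

Σ-comm : ∀ {A B : Set} (xs : List A) (ys : List B) (h : A → B → ℚ) →
         Σℚ xs (λ x → Σℚ ys (h x)) ≡ Σℚ ys (λ y → Σℚ xs (λ x → h x y))
Σ-comm []       ys h = sym (Σ-zero ys (λ _ _ → refl))
Σ-comm (x ∷ xs) ys h = trans (cong (Σℚ ys (h x) +ℚ_) (Σ-comm xs ys h)) (sym (Σ-+ ys (h x) (λ y → Σℚ xs (λ x → h x y))))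

-- Operators on functions X → ℚ

record Operator (X : Set) : Set where
  field
    _∙_  : (X → ℚ) → X → ℚ
    resp : ∀ {f g} → f ≗ g → _∙_ f ≗ _∙_ g
    lin  : ∀ α β f g x → _∙_ (λ y → α *ℚ f y +ℚ β *ℚ g y) x ≡ α *ℚ _∙_ f x +ℚ β *ℚ _∙_ g x

  on-zero : ∀ {f} → (∀ x → f x ≡ 0ℚ) → ∀ x → _∙_ f x ≡ 0ℚ
  on-zero {f} e x = trans (resp (λ y → trans (e y) (lem (f y))) x)
                          (trans (lin 0ℚ 0ℚ f f x) (sym (lem (_∙_ f x))))
    where lem : ∀ a → 0ℚ ≡ 0ℚ *ℚ a +ℚ 0ℚ *ℚ a
          lem = solve-∀ ℚ-ring

  on-scale : ∀ α f x → _∙_ (λ y → α *ℚ f y) x ≡ α *ℚ _∙_ f x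
  on-scale α f x = trans (resp (λ y → lem α (f y)) x) (trans (lin α 0ℚ f f x) (sym (lem α (_∙_ f x))))
    where lem : ∀ α a → α *ℚ a ≡ α *ℚ a +ℚ 0ℚ *ℚ a
          lem = solve-∀ ℚ-ring

  on-+ : ∀ f g x → _∙_ (λ y → f y +ℚ g y) x ≡ _∙_ f x +ℚ _∙_ g x
  on-+ f g x = trans (resp (λ y → lem (f y) (g y)) x) (trans (lin 1ℚ 1ℚ f g x) (sym (lem (_∙_ f x) (_∙_ g x))))
    where lem : ∀ a b → a +ℚ b ≡ 1ℚ *ℚ a +ℚ 1ℚ *ℚ b
          lem = solve-∀ ℚ-ring

  on-sub : ∀ f g x → _∙_ (λ y → f y -ℚ g y) x ≡ _∙_ f x -ℚ _∙_ g x
  on-sub f g x = trans (resp (λ y → lem (f y) (g y)) x)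
                       (trans (lin 1ℚ (ℚ.- 1ℚ) f g x) (sym (lem (_∙_ f x) (_∙_ g x))))
    where lem : ∀ a b → a -ℚ b ≡ 1ℚ *ℚ a +ℚ (ℚ.- 1ℚ) *ℚ b
          lem = solve-∀ ℚ-ring

open Operator using (_∙_; resp; lin; on-zero; on-scale; on-+; on-sub)

module _ {X : Set} where

  Vanishes : (X → ℚ) → Set
  Vanishes f = ∀ x → f x ≡ 0ℚ

  Eigen : Operator X → ℚ → (X → ℚ) → Set
  Eigen T c f = ∀ x → (T ∙ f) x ≡ c *ℚ f x

  shift : Operator X → ℚ → (X → ℚ) → X → ℚ
  shift T r f x = (T ∙ f) x -ℚ r *ℚ f x

  shifts : Operator X → List ℤ → (X → ℚ) → X → ℚ
  shifts T []       f = f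
  shifts T (r ∷ rs) f = shifts T rs (shift T (ι r) f)

  Commute : Operator X → Operator X → Set
  Commute S T = ∀ f x → (S ∙ (T ∙ f)) x ≡ (T ∙ (S ∙ f)) x

  shift-resp : ∀ T r {f g} → f ≗ g → shift T r f ≗ shift T r g
  shift-resp T r e x = cong₂ (λ a b → a -ℚ r *ℚ b) (resp T e x) (e x)

  shifts-resp : ∀ T rs {f g} → f ≗ g → shifts T rs f ≗ shifts T rs g
  shifts-resp T []       e = e
  shifts-resp T (r ∷ rs) e = shifts-resp T rs (shift-resp T (ι r) e)

  shift-lin : ∀ T r α β f g x → shift T r (λ y → α *ℚ f y +ℚ β *ℚ g y) x ≡ α *ℚ shift T r f x +ℚ β *ℚ shift T r g x
  shift-lin T r α β f g x = trans (cong (_-ℚ r *ℚ (α *ℚ f x +ℚ β *ℚ g x)) (lin T α β f g x))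
                                  (lem α β r (f x) (g x) ((T ∙ f) x) ((T ∙ g) x))
    where lem : ∀ α β r a b c d → (α *ℚ c +ℚ β *ℚ d) -ℚ r *ℚ (α *ℚ a +ℚ β *ℚ b) ≡ α *ℚ (c -ℚ r *ℚ a) +ℚ β *ℚ (d -ℚ r *ℚ b)
          lem = solve-∀ ℚ-ring

  shiftOp : Operator X → ℚ → Operator X
  shiftOp T r = record { _∙_ = shift T r ; resp = shift-resp T r ; lin = shift-lin T r }

  record Subspace (E : (X → ℚ) → Set) : Set where
    field
      E-resp : ∀ {f g} → f ≗ g → E f → E g
      E-lin  : ∀ α β {f g} → E f → E g → E (λ x → α *ℚ f x +ℚ β *ℚ g x)

    E-sub : ∀ {f g} → E f → E g → E (λ x → f x -ℚ g x)
    E-sub {f} {g} p q = E-resp (λ x → lem (f x) (g x)) (E-lin 1ℚ (ℚ.- 1ℚ) p q)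
      where lem : ∀ a b → 1ℚ *ℚ a +ℚ (ℚ.- 1ℚ) *ℚ b ≡ a -ℚ b
            lem = solve-∀ ℚ-ring

    E-scale : ∀ α {f} → E f → E (λ x → α *ℚ f x)
    E-scale α {f} p = E-resp (λ x → lem α (f x)) (E-lin α 0ℚ p p)
      where lem : ∀ α a → α *ℚ a +ℚ 0ℚ *ℚ a ≡ α *ℚ a
            lem = solve-∀ ℚ-ring

    E-shift : ∀ T → (∀ {f} → E f → E (T ∙ f)) → ∀ r {f} → E f → E (shift T r f)
    E-shift T inv r p = E-sub (inv p) (E-scale r p)

  open Subspace

  Eigen-subspace : ∀ T c → Subspace (Eigen T c)
  Eigen-subspace T c = record
    { E-resp = λ {f} {g} e p x → trans (sym (resp T e x)) (trans (p x) (cong (c *ℚ_) (e x)))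
    ; E-lin  = λ α β {f} {g} p q x → trans (lin T α β f g x)
                 (trans (cong₂ (λ a b → α *ℚ a +ℚ β *ℚ b) (p x) (q x)) (lem α β c (f x) (g x)))
    }
    where lem : ∀ α β c a b → α *ℚ (c *ℚ a) +ℚ β *ℚ (c *ℚ b) ≡ c *ℚ (α *ℚ a +ℚ β *ℚ b)
          lem = solve-∀ ℚ-ring

  Eigen-commute : ∀ {S T} c → Commute T S → ∀ {f} → Eigen T c f → Eigen T c (S ∙ f)
  Eigen-commute {S} {T} c com {f} p x = trans (com f x) (trans (resp S p x) (on-scale S c f x))

  -- f is a sum of eigenvectors of T with integral eigenvalues, all of them in E.
  data Decomposes (E : (X → ℚ) → Set) (T : Operator X) (f : X → ℚ) : Set where
    none : Vanishes f → Decomposes E T f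
    more : ∀ (c : ℤ) (v : X → ℚ) → E v → Eigen T (ι c) v → Decomposes E T (λ x → f x -ℚ v x) → Decomposes E T f

  Decomposes-resp : ∀ {E T f g} → f ≗ g → Decomposes E T f → Decomposes E T g
  Decomposes-resp e (none z) = none (λ x → trans (sym (e x)) (z x))
  Decomposes-resp e (more c v Ev Tv D) = more c v Ev Tv (Decomposes-resp (λ x → cong (_-ℚ v x) (e x)) D)

  Decomposes-+ : ∀ {E T f g} → Decomposes E T f → Decomposes E T g → Decomposes E T (λ x → f x +ℚ g x)
  Decomposes-+ {g = g} (none z) D = Decomposes-resp (λ x → sym (trans (cong (_+ℚ g x) (z x)) (ℚₚ.+-identityˡ (g x)))) D
  Decomposes-+ {f = f} {g} (more c v Ev Tv D) D' =
    more c v Ev Tv (Decomposes-resp (λ x → lem (f x) (v x) (g x)) (Decomposes-+ D D'))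
    where lem : ∀ a b c → (a -ℚ b) +ℚ c ≡ (a +ℚ c) -ℚ b
          lem = solve-∀ ℚ-ring

  shift-comm : ∀ T r c f → shift T c (shift T r f) ≗ shift T r (shift T c f)
  shift-comm T r c f y =
    trans (cong (_-ℚ c *ℚ shift T r f y) (Tshift r))
      (trans (ring r c (f y) ((T ∙ f) y) ((T ∙ (T ∙ f)) y)) (sym (cong (_-ℚ r *ℚ shift T c f y) (Tshift c))))
    where
      Tshift : ∀ r → (T ∙ shift T r f) y ≡ (T ∙ (T ∙ f)) y -ℚ r *ℚ (T ∙ f) y
      Tshift r = trans (on-sub T (T ∙ f) (λ y → r *ℚ f y) y) (cong (((T ∙ (T ∙ f)) y) -ℚ_) (on-scale T r f y))
      ring : ∀ r c a b d → (d -ℚ r *ℚ b) -ℚ c *ℚ (b -ℚ r *ℚ a) ≡ (d -ℚ c *ℚ b) -ℚ r *ℚ (b -ℚ c *ℚ a)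
      ring = solve-∀ ℚ-ring

  shift-shifts : ∀ T rs c f → shift T c (shifts T rs f) ≗ shifts T rs (shift T c f)
  shift-shifts T []       c f x = refl
  shift-shifts T (r ∷ rs) c f x = trans (shift-shifts T rs c (shift T (ι r) f) x) (shifts-resp T rs (shift-comm T (ι r) c f) x)

  shift-sub-eigen : ∀ T c f v → Eigen T c v → shift T c f ≗ shift T c (λ y → f y -ℚ v y)
  shift-sub-eigen T c f v Tv x =
    sym (trans (cong (_-ℚ c *ℚ (f x -ℚ v x)) (trans (on-sub T f v x) (cong (((T ∙ f) x) -ℚ_) (Tv x))))
               (ring c (f x) (v x) ((T ∙ f) x)))
    where ring : ∀ c a b d → (d -ℚ c *ℚ b) -ℚ c *ℚ (a -ℚ b) ≡ d -ℚ c *ℚ a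
          ring = solve-∀ ℚ-ring

  -- Each component is annihilated by its own factor `T - c`, and such factors commute. The list of
  -- roots is what later arguments extract from a decomposition.
  kill : ∀ {E T f} → Decomposes E T f → ∃[ rs ] Vanishes (shifts T rs f)
  kill (none z) = [] , z
  kill {E} {T} {f} (more c v Ev Tv D) = c ∷ proj₁ (kill D) , λ x →
    trans (shifts-resp T (proj₁ (kill D)) (shift-sub-eigen T (ι c) f v Tv) x)
      (trans (sym (shift-shifts T (proj₁ (kill D)) (ι c) (λ y → f y -ℚ v y) x))
        (on-zero (shiftOp T (ι c)) (proj₂ (kill D)) x))

-- The inner product for which the points of X are orthonormal

module InnerProduct {X : Set} (points : List X) (complete : ∀ x → x ∈ points) where

  ⟪_,_⟫ : (X → ℚ) → (X → ℚ) → ℚ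
  ⟪ f , g ⟫ = Σℚ points (λ x → f x *ℚ g x)

  Symmetric : Operator X → Set
  Symmetric T = ∀ f g → ⟪ T ∙ f , g ⟫ ≡ ⟪ f , T ∙ g ⟫

  ⟪⟫-cong : ∀ {f f' g g'} → f ≗ f' → g ≗ g' → ⟪ f , g ⟫ ≡ ⟪ f' , g' ⟫
  ⟪⟫-cong p q = Σ-cong points (λ x → cong₂ _*ℚ_ (p x) (q x))

  ⟪⟫-linˡ : ∀ α β f g h → ⟪ (λ x → α *ℚ f x +ℚ β *ℚ g x) , h ⟫ ≡ α *ℚ ⟪ f , h ⟫ +ℚ β *ℚ ⟪ g , h ⟫
  ⟪⟫-linˡ α β f g h = trans (Σ-cong points (λ x → ring α β (f x) (g x) (h x)))
                            (Σ-lin points α β (λ x → f x *ℚ h x) (λ x → g x *ℚ h x))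
    where ring : ∀ α β a b c → (α *ℚ a +ℚ β *ℚ b) *ℚ c ≡ α *ℚ (a *ℚ c) +ℚ β *ℚ (b *ℚ c)
          ring = solve-∀ ℚ-ring

  ⟪⟫-comm : ∀ f g → ⟪ f , g ⟫ ≡ ⟪ g , f ⟫
  ⟪⟫-comm f g = Σ-cong points (λ x → ℚₚ.*-comm (f x) (g x))

  ⟪⟫-scaleˡ : ∀ α f g → ⟪ (λ x → α *ℚ f x) , g ⟫ ≡ α *ℚ ⟪ f , g ⟫
  ⟪⟫-scaleˡ α f g = trans (Σ-cong points (λ x → ℚₚ.*-assoc α (f x) (g x))) (Σ-* points α _)

  ⟪⟫-scaleʳ : ∀ α f g → ⟪ f , (λ x → α *ℚ g x) ⟫ ≡ α *ℚ ⟪ f , g ⟫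
  ⟪⟫-scaleʳ α f g = trans (⟪⟫-comm f _) (trans (⟪⟫-scaleˡ α g f) (cong (α *ℚ_) (⟪⟫-comm g f)))

  definite : ∀ f → ⟪ f , f ⟫ ≡ 0ℚ → Vanishes f
  definite f e x = square-zero (f x) (go points e (complete x))
    where
      Σ-nonneg : ∀ xs → 0ℚ ℚ.≤ Σℚ xs (λ x → f x *ℚ f x)
      Σ-nonneg []       = ℚₚ.≤-refl
      Σ-nonneg (y ∷ xs) = ℚₚ.+-mono-≤ (square-nonneg (f y)) (Σ-nonneg xs)
      zeroˡ : ∀ {a b} → 0ℚ ℚ.≤ a → 0ℚ ℚ.≤ b → a +ℚ b ≡ 0ℚ → a ≡ 0ℚ
      zeroˡ {a} {b} p q e = ℚₚ.≤-antisym (subst (a ℚ.≤_) e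
        (subst (ℚ._≤ a +ℚ b) (ℚₚ.+-identityʳ a) (ℚₚ.+-mono-≤ (ℚₚ.≤-refl {a}) q))) p
      go : ∀ xs → Σℚ xs (λ x → f x *ℚ f x) ≡ 0ℚ → x ∈ xs → f x *ℚ f x ≡ 0ℚ
      go (y ∷ xs) e (here refl) = zeroˡ (square-nonneg (f y)) (Σ-nonneg xs) e
      go (y ∷ xs) e (there p) = go xs (zeroˡ (Σ-nonneg xs) (square-nonneg (f y)) (trans (ℚₚ.+-comm (Σℚ xs (λ x → f x *ℚ f x)) (f y *ℚ f y)) e)) p

  -- ⟨u,u⟩ = ⟨(T−r)f,u⟩ = ⟨f,(T−r)u⟩ = 0
  symmetric-kernel : ∀ T → Symmetric T → ∀ r f u → (∀ x → shift T r f x ≡ u x) → Eigen T r u → Vanishes u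
  symmetric-kernel T sy r f u fu Tu = definite u (begin
    ⟪ u , u ⟫                                    ≡⟨ ⟪⟫-cong (λ x → trans (sym (fu x)) (ring r (f x) ((T ∙ f) x))) (λ _ → refl) ⟩
    ⟪ (λ x → 1ℚ *ℚ (T ∙ f) x +ℚ (ℚ.- r) *ℚ f x) , u ⟫   ≡⟨ ⟪⟫-linˡ 1ℚ (ℚ.- r) (T ∙ f) f u ⟩
    1ℚ *ℚ ⟪ T ∙ f , u ⟫ +ℚ (ℚ.- r) *ℚ ⟪ f , u ⟫         ≡⟨ cong (λ z → 1ℚ *ℚ z +ℚ (ℚ.- r) *ℚ ⟪ f , u ⟫) (trans (sy f u) (trans (⟪⟫-cong {f} (λ _ → refl) Tu) (⟪⟫-scaleʳ r f u))) ⟩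
    1ℚ *ℚ (r *ℚ ⟪ f , u ⟫) +ℚ (ℚ.- r) *ℚ ⟪ f , u ⟫      ≡⟨ ring' r ⟪ f , u ⟫ ⟩
    0ℚ                                            ∎)
    where
      open ≡-Reasoning
      ring : ∀ r a b → b -ℚ r *ℚ a ≡ 1ℚ *ℚ b +ℚ (ℚ.- r) *ℚ a
      ring = solve-∀ ℚ-ring
      ring' : ∀ r a → 1ℚ *ℚ (r *ℚ a) +ℚ (ℚ.- r) *ℚ a ≡ 0ℚ
      ring' = solve-∀ ℚ-ring

  module _ {E : (X → ℚ) → Set} (sub : Subspace E) (T : Operator X) (sy : Symmetric T)
           (inv : ∀ {f} → E f → E (T ∙ f)) where
    open Subspace sub

    shift-scaled : ∀ r c s v → Eigen T c v → ∀ f x →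
      shift T r (λ y → f y -ℚ s *ℚ v y) x ≡ shift T r f x -ℚ (s *ℚ (c -ℚ r)) *ℚ v x
    shift-scaled r c s v Tv f x = trans
      (cong (_-ℚ r *ℚ (f x -ℚ s *ℚ v x)) (trans (on-sub T f (λ y → s *ℚ v y) x)
        (cong (((T ∙ f) x) -ℚ_) (trans (on-scale T s v x) (cong (s *ℚ_) (Tv x))))))
      (ring r c s (v x) (f x) ((T ∙ f) x))
      where ring : ∀ r c s v a b → (b -ℚ s *ℚ (c *ℚ v)) -ℚ r *ℚ (a -ℚ s *ℚ v) ≡ (b -ℚ r *ℚ a) -ℚ (s *ℚ (c -ℚ r)) *ℚ v
            ring = solve-∀ ℚ-ring

    -- Eigencomponents of (T−r)f with eigenvalue c ≠ r are divided by c−r; the r-eigencomponent u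
    -- is in the image of T−r and in its kernel, hence zero.
    Decomposes-step : ∀ (r : ℤ) {g} → Decomposes E T g → ∀ f → E f → ∀ u → Eigen T (ι r) u →
      (∀ x → shift T (ι r) f x ≡ g x +ℚ u x) → Decomposes E T f
    Decomposes-step r {g} (none z) f Ef u Tu e =
      more r f Ef (λ x → x-y≡0⇒x≡y _ _ (trans (fu x) (u0 x))) (none (λ x → x-x≡0 (f x)))
      where
        fu : ∀ x → shift T (ι r) f x ≡ u x
        fu x = trans (e x) (trans (cong (_+ℚ u x) (z x)) (ℚₚ.+-identityˡ (u x)))
        u0 : Vanishes u
        u0 = symmetric-kernel T sy (ι r) f u fu Tu
    Decomposes-step r {g} (more c v Ev Tv D) f Ef u Tu e with c ℤₚ.≟ r
    ... | yes refl = Decomposes-step r D f Ef (λ x → 1ℚ *ℚ u x +ℚ 1ℚ *ℚ v x)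
          (Subspace.E-lin (Eigen-subspace T (ι r)) 1ℚ 1ℚ Tu Tv) (λ x → trans (e x) (ring (g x) (u x) (v x)))
      where ring : ∀ a b c → a +ℚ b ≡ (a -ℚ c) +ℚ (1ℚ *ℚ b +ℚ 1ℚ *ℚ c)
            ring = solve-∀ ℚ-ring
    ... | no c≢r = divide (*-inverse (ι c -ℚ ι r) (λ z → c≢r (ι-injective (x-y≡0⇒x≡y _ _ z))))
      where
        ring : ∀ g u v → (g +ℚ u) -ℚ 1ℚ *ℚ v ≡ (g -ℚ v) +ℚ u
        ring = solve-∀ ℚ-ring
        divide : ∃[ s ] (ι c -ℚ ι r) *ℚ s ≡ 1ℚ → Decomposes E T f
        divide (s , cs) = more c (λ x → s *ℚ v x) (E-scale s Ev) (Subspace.E-scale (Eigen-subspace T (ι c)) s Tv)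
          (Decomposes-step r D (λ x → f x -ℚ s *ℚ v x) (E-sub Ef (E-scale s Ev)) u Tu
            (λ x → trans (shift-scaled (ι r) (ι c) s v Tv f x)
               (trans (cong₂ (λ a b → a -ℚ b *ℚ v x) (e x) (trans (ℚₚ.*-comm s _) cs)) (ring (g x) (u x) (v x)))))

    -- Each factor is undone by one application of `Decomposes-step`. A repeated root does no harm:
    -- by symmetry, the image and the kernel of `T - r` meet only in zero.
    Decomposes-shifts : ∀ rs f → E f → Decomposes E T (shifts T rs f) → Decomposes E T f
    Decomposes-shifts []       f Ef D = D
    Decomposes-shifts (r ∷ rs) f Ef D =
      Decomposes-step r (Decomposes-shifts rs (shift T (ι r) f) (E-shift T inv (ι r) Ef) D) f Ef (λ _ → 0ℚ)
        (λ x → trans (on-zero T (λ _ → refl) x) (sym (ℚₚ.*-zeroʳ (ι r)))) (λ x → sym (ℚₚ.+-identityʳ _))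

    -- The given decomposition, whose components may lie outside `E`, contributes only its roots;
    -- the components are rebuilt inside the invariant subspace. Thus a splitting of the whole space
    -- restricts to common eigenspaces.
    Decomposes-killed : ∀ {E'} f → E f → Decomposes E' T f → Decomposes E T f
    Decomposes-killed f Ef D with rs , z ← kill D = Decomposes-shifts rs f Ef (none z)

-- The degenerate affine Hecke relation

Everything : {X : Set} → (X → ℚ) → Set
Everything _ = ⊤

Everything-subspace : {X : Set} → Subspace {X} Everything
Everything-subspace = record { E-resp = λ _ _ → tt ; E-lin = λ _ _ _ _ → tt }

-- `D` and `J` stand for two consecutive Jucys-Murphy elements of a chain and `s` for the
-- transposition of their points; everything below follows from J s = s D + 1, symmetry and s² = 1.
module HeckeRelation {X : Set} (points : List X) (complete : ∀ x → x ∈ points)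
  (D J s : Operator X) (symD : InnerProduct.Symmetric points complete D)
  (symJ : InnerProduct.Symmetric points complete J) (symS : InnerProduct.Symmetric points complete s)
  (involutive : ∀ f x → (s ∙ (s ∙ f)) x ≡ f x)
  (relation : ∀ f x → (J ∙ (s ∙ f)) x ≡ (s ∙ (D ∙ f)) x +ℚ f x) where

  open InnerProduct points complete

  relation′ : ∀ f x → (D ∙ (s ∙ f)) x ≡ (s ∙ (J ∙ f)) x -ℚ f x
  relation′ f x = begin
    (D ∙ (s ∙ f)) x                                              ≡⟨ involutive _ x ⟨
    (s ∙ (s ∙ (D ∙ (s ∙ f)))) x                                  ≡⟨ resp s (λ y → ring ((s ∙ (D ∙ (s ∙ f))) y) ((s ∙ f) y)) x ⟩
    (s ∙ (λ y → ((s ∙ (D ∙ (s ∙ f))) y +ℚ (s ∙ f) y) -ℚ (s ∙ f) y)) x ≡⟨ resp s (λ y → cong (_-ℚ (s ∙ f) y) (trans (sym (relation (s ∙ f) y)) (resp J (involutive f) y))) x ⟩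
    (s ∙ (λ y → (J ∙ f) y -ℚ (s ∙ f) y)) x                       ≡⟨ on-sub s (J ∙ f) (s ∙ f) x ⟩
    (s ∙ (J ∙ f)) x -ℚ (s ∙ (s ∙ f)) x                           ≡⟨ cong ((s ∙ (J ∙ f)) x -ℚ_) (involutive f x) ⟩
    (s ∙ (J ∙ f)) x -ℚ f x                                       ∎
    where open ≡-Reasoning
          ring : ∀ a b → a ≡ (a +ℚ b) -ℚ b
          ring = solve-∀ ℚ-ring

  J-on-s : ∀ {a v} → Eigen D a v → ∀ x → (J ∙ (s ∙ v)) x ≡ a *ℚ (s ∙ v) x +ℚ v x
  J-on-s {a} {v} Dv x = trans (relation v x) (cong (_+ℚ v x) (trans (resp s Dv x) (on-scale s a v x)))

  D-on-s : ∀ {b v} → Eigen J b v → ∀ x → (D ∙ (s ∙ v)) x ≡ b *ℚ (s ∙ v) x -ℚ v x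
  D-on-s {b} {v} Jv x = trans (relation′ v x) (cong (_-ℚ v x) (trans (resp s Jv x) (on-scale s b v x)))

  -- The relation gives (J - a)sv = v, so v lies both in the image and in the kernel of J - a.
  equal-vanishes : ∀ {a v} → Eigen D a v → Eigen J a v → Vanishes v
  equal-vanishes {a} {v} Dv Jv = symmetric-kernel J symJ a (s ∙ v) v
    (λ x → trans (cong (_-ℚ a *ℚ (s ∙ v) x) (J-on-s {a} Dv x)) (ring a ((s ∙ v) x) (v x))) Jv
    where ring : ∀ a b c → (a *ℚ b +ℚ c) -ℚ a *ℚ b ≡ c
          ring = solve-∀ ℚ-ring

  -- The intertwiner of Young's seminormal form, up to scale: the combination of sv and v that swaps
  -- the eigenvalues a of D and b of J.
  exchange : ℚ → ℚ → (X → ℚ) → X → ℚ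
  exchange a b v x = (b -ℚ a) *ℚ (s ∙ v) x -ℚ v x

  module _ {a b v} (Dv : Eigen D a v) (Jv : Eigen J b v) where

    private w = exchange a b v

    on-exchange : ∀ T x → (T ∙ w) x ≡ (b -ℚ a) *ℚ (T ∙ (s ∙ v)) x -ℚ (T ∙ v) x
    on-exchange T x = trans (on-sub T (λ y → (b -ℚ a) *ℚ (s ∙ v) y) v x) (cong (_-ℚ (T ∙ v) x) (on-scale T (b -ℚ a) (s ∙ v) x))

    exchange-D : Eigen D b w
    exchange-D x = trans (on-exchange D x)
      (trans (cong₂ (λ p q → (b -ℚ a) *ℚ p -ℚ q) (D-on-s {b} Jv x) (Dv x)) (ring a b ((s ∙ v) x) (v x)))
      where ring : ∀ a b p q → (b -ℚ a) *ℚ (b *ℚ p -ℚ q) -ℚ a *ℚ q ≡ b *ℚ ((b -ℚ a) *ℚ p -ℚ q)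
            ring = solve-∀ ℚ-ring

    exchange-J : Eigen J a w
    exchange-J x = trans (on-exchange J x)
      (trans (cong₂ (λ p q → (b -ℚ a) *ℚ p -ℚ q) (J-on-s {a} Dv x) (Jv x)) (ring a b ((s ∙ v) x) (v x)))
      where ring : ∀ a b p q → (b -ℚ a) *ℚ (a *ℚ p +ℚ q) -ℚ b *ℚ q ≡ a *ℚ ((b -ℚ a) *ℚ p -ℚ q)
            ring = solve-∀ ℚ-ring

    s-on-exchange : ∀ x → (s ∙ w) x ≡ (b -ℚ a) *ℚ v x -ℚ (s ∙ v) x
    s-on-exchange x = trans (on-exchange s x) (cong (λ p → (b -ℚ a) *ℚ p -ℚ (s ∙ v) x) (involutive v x))

    -- With c = b - a, the combination c·sw + w equals (c² - 1)v.
    exchange-nonzero : (b -ℚ a) *ℚ (b -ℚ a) -ℚ 1ℚ ≢ 0ℚ → Vanishes w → Vanishes v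
    exchange-nonzero ne z x = *-cancel-0 _ (v x) ne (trans (ring (b -ℚ a) ((s ∙ v) x) (v x))
      (trans (cong₂ (λ p q → (b -ℚ a) *ℚ p +ℚ q) (trans (sym (s-on-exchange x)) (on-zero s z x)) (z x)) (ring' (b -ℚ a))))
      where ring : ∀ c p q → (c *ℚ c -ℚ 1ℚ) *ℚ q ≡ c *ℚ (c *ℚ q -ℚ p) +ℚ (c *ℚ p -ℚ q)
            ring = solve-∀ ℚ-ring
            ring' : ∀ c → c *ℚ 0ℚ +ℚ 0ℚ ≡ 0ℚ
            ring' = solve-∀ ℚ-ring

    -- The vector w is orthogonal to v, since D has the distinct eigenvalues b and a on them. As sw
    -- = -εw, it is also orthogonal to sv, hence to itself, being a combination of sv and v. So w =
    -- 0, that is ε·sv = v.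
    adjacent : (b -ℚ a) *ℚ (b -ℚ a) ≡ 1ℚ → Eigen s (b -ℚ a) v
    adjacent ε² x = x-y≡0⇒x≡y _ _ (begin
      (s ∙ v) x -ℚ ε *ℚ v x                 ≡⟨ cong (_-ℚ ε *ℚ v x) (trans (sym (ℚₚ.*-identityˡ ((s ∙ v) x))) (cong (_*ℚ (s ∙ v) x) (sym ε²))) ⟩
      ε *ℚ ε *ℚ (s ∙ v) x -ℚ ε *ℚ v x       ≡⟨ ring ε ((s ∙ v) x) (v x) ⟩
      ε *ℚ w x                              ≡⟨ cong (ε *ℚ_) (definite w ww x) ⟩
      ε *ℚ 0ℚ                               ≡⟨ ℚₚ.*-zeroʳ ε ⟩
      0ℚ                                    ∎)
      where
        open ≡-Reasoning
        ε = b -ℚ a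
        ring : ∀ e p q → e *ℚ e *ℚ p -ℚ e *ℚ q ≡ e *ℚ (e *ℚ p -ℚ q)
        ring = solve-∀ ℚ-ring
        ε≢0 : ε ≢ 0ℚ
        ε≢0 e = ℚₚ.1≢0 (trans (sym ε²) (trans (cong (_*ℚ ε) e) (ℚₚ.*-zeroˡ ε)))
        wv : ⟪ w , v ⟫ ≡ 0ℚ
        wv = *-cancel-0 ε _ ε≢0 (trans (ring' a b ⟪ w , v ⟫) (trans (cong₂ _-ℚ_
          (trans (sym (⟪⟫-scaleˡ b w v)) (⟪⟫-cong (λ x → sym (exchange-D x)) (λ _ → refl)))
          (trans (sym (⟪⟫-scaleʳ a w v)) (trans (⟪⟫-cong {w} (λ _ → refl) (λ x → sym (Dv x))) (sym (symD w v)))))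
          (x-x≡0 ⟪ D ∙ w , v ⟫)))
          where ring' : ∀ a b z → (b -ℚ a) *ℚ z ≡ b *ℚ z -ℚ a *ℚ z
                ring' = solve-∀ ℚ-ring
        sw : ∀ x → (s ∙ w) x ≡ (ℚ.- ε) *ℚ w x
        sw x = trans (s-on-exchange x) (trans (cong (λ z → ε *ℚ v x -ℚ z) (trans (sym (ℚₚ.*-identityˡ ((s ∙ v) x))) (cong (_*ℚ (s ∙ v) x) (sym ε²))))
                 (ring' ε ((s ∙ v) x) (v x)))
          where ring' : ∀ e p q → e *ℚ q -ℚ e *ℚ e *ℚ p ≡ (ℚ.- e) *ℚ (e *ℚ p -ℚ q)
                ring' = solve-∀ ℚ-ring
        wsv : ⟪ w , s ∙ v ⟫ ≡ 0ℚ
        wsv = trans (sym (symS w v)) (trans (⟪⟫-cong sw (λ _ → refl)) (trans (⟪⟫-scaleˡ (ℚ.- ε) w v)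
                (trans (cong ((ℚ.- ε) *ℚ_) wv) (ℚₚ.*-zeroʳ (ℚ.- ε)))))
        ww : ⟪ w , w ⟫ ≡ 0ℚ
        ww = trans (⟪⟫-cong {w} (λ _ → refl) (λ x → ring' ε ((s ∙ v) x) (v x)))
          (trans (⟪⟫-comm w _) (trans (⟪⟫-linˡ ε (ℚ.- 1ℚ) (s ∙ v) v w)
            (trans (cong₂ (λ p q → ε *ℚ p +ℚ (ℚ.- 1ℚ) *ℚ q) (trans (⟪⟫-comm (s ∙ v) w) wsv) (trans (⟪⟫-comm v w) wv)) (ring″ ε))))
          where ring' : ∀ e p q → e *ℚ p -ℚ q ≡ e *ℚ p +ℚ (ℚ.- 1ℚ) *ℚ q
                ring' = solve-∀ ℚ-ring
                ring″ : ∀ e → e *ℚ 0ℚ +ℚ (ℚ.- 1ℚ) *ℚ 0ℚ ≡ 0ℚ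
                ring″ = solve-∀ ℚ-ring

  module _ (D-J : Commute D J) where

    -- For a D-eigenvector v with eigenvalue a, the vector (D−a)s(∏(J−r))v = ∏(D−r)(D−a)sv vanishes
    -- for suitable r's. Then u = ∏(J−r)v satisfies Ju = au + su, whence (J−a−1)(J−a+1)u = 0.
    module _ (a : ℤ) where

      private α = ι a

      shift-through : ∀ r v → Eigen D α v → shift D α (s ∙ shift J r v) ≗ shift D r (shift D α (s ∙ v))
      shift-through r v Dv x = begin
        shift D α (s ∙ shift J r v) x                    ≡⟨ shift-resp D α through x ⟩
        shift D α (λ y → 1ℚ *ℚ shift D r (s ∙ v) y +ℚ 1ℚ *ℚ v y) x ≡⟨ shift-lin D α 1ℚ 1ℚ (shift D r (s ∙ v)) v x ⟩
        1ℚ *ℚ shift D α (shift D r (s ∙ v)) x +ℚ 1ℚ *ℚ shift D α v x ≡⟨ cong₂ (λ p q → 1ℚ *ℚ p +ℚ 1ℚ *ℚ (q -ℚ α *ℚ v x)) (shift-comm D r α (s ∙ v) x) (Dv x) ⟩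
        1ℚ *ℚ shift D r (shift D α (s ∙ v)) x +ℚ 1ℚ *ℚ (α *ℚ v x -ℚ α *ℚ v x) ≡⟨ ring _ (α *ℚ v x) ⟩
        shift D r (shift D α (s ∙ v)) x                  ∎
        where
          open ≡-Reasoning
          ring : ∀ p q → 1ℚ *ℚ p +ℚ 1ℚ *ℚ (q -ℚ q) ≡ p
          ring = solve-∀ ℚ-ring
          ring' : ∀ r p q t → p -ℚ r *ℚ t ≡ 1ℚ *ℚ ((p -ℚ q) -ℚ r *ℚ t) +ℚ 1ℚ *ℚ q
          ring' = solve-∀ ℚ-ring
          through : (s ∙ shift J r v) ≗ (λ y → 1ℚ *ℚ shift D r (s ∙ v) y +ℚ 1ℚ *ℚ v y)
          through y = trans (on-sub s (J ∙ v) (λ z → r *ℚ v z) y) (trans (cong ((s ∙ (J ∙ v)) y -ℚ_) (on-scale s r v y))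
            (trans (ring' r ((s ∙ (J ∙ v)) y) (v y) ((s ∙ v) y))
              (cong (λ z → 1ℚ *ℚ (z -ℚ r *ℚ (s ∙ v) y) +ℚ 1ℚ *ℚ v y) (sym (relation′ v y)))))

      shift-eigen : ∀ r v → Eigen D α v → Eigen D α (shift J r v)
      shift-eigen r v = Subspace.E-shift (Eigen-subspace D α) J (Eigen-commute {S = J} {T = D} α D-J) r

      shifts-eigen : ∀ rs v → Eigen D α v → Eigen D α (shifts J rs v)
      shifts-eigen []       v Dv = Dv
      shifts-eigen (r ∷ rs) v Dv = shifts-eigen rs (shift J (ι r) v) (shift-eigen (ι r) v Dv)

      shifts-through : ∀ rs v → Eigen D α v → shift D α (s ∙ shifts J rs v) ≗ shifts D rs (shift D α (s ∙ v))
      shifts-through []       v Dv x = refl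
      shifts-through (r ∷ rs) v Dv x = trans (shifts-through rs (shift J (ι r) v) (shift-eigen (ι r) v Dv) x)
                                             (shifts-resp D rs (shift-through (ι r) v Dv) x)

      quadratic : ∀ u → Eigen D α u → Vanishes (shift D α (s ∙ u)) → Vanishes (shifts J (a ℤ.- 1ℤ ∷ a ℤ.+ 1ℤ ∷ []) u)
      quadratic u Du z x = begin
        shift J (ι (a ℤ.+ 1ℤ)) (shift J (ι (a ℤ.- 1ℤ)) u) x        ≡⟨ shift-resp J (ι (a ℤ.+ 1ℤ)) inner x ⟩
        shift J (ι (a ℤ.+ 1ℤ)) (λ y → (s ∙ u) y +ℚ u y) x           ≡⟨ cong₂ (λ p q → p -ℚ q *ℚ ((s ∙ u) x +ℚ u x)) outer ι+1 ⟩
        (α *ℚ (s ∙ u) x +ℚ u x +ℚ (α *ℚ u x +ℚ (s ∙ u) x)) -ℚ (α +ℚ ι 1ℤ) *ℚ ((s ∙ u) x +ℚ u x) ≡⟨ cong (λ e → (α *ℚ (s ∙ u) x +ℚ u x +ℚ (α *ℚ u x +ℚ (s ∙ u) x)) -ℚ (α +ℚ e) *ℚ ((s ∙ u) x +ℚ u x)) (ι-fromℕ 1) ⟩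
        (α *ℚ (s ∙ u) x +ℚ u x +ℚ (α *ℚ u x +ℚ (s ∙ u) x)) -ℚ (α +ℚ 1ℚ) *ℚ ((s ∙ u) x +ℚ u x) ≡⟨ ring α ((s ∙ u) x) (u x) ⟩
        0ℚ                                                          ∎
        where
          open ≡-Reasoning
          ring : ∀ a p q → (a *ℚ p +ℚ q +ℚ (a *ℚ q +ℚ p)) -ℚ (a +ℚ 1ℚ) *ℚ (p +ℚ q) ≡ 0ℚ
          ring = solve-∀ ℚ-ring
          ι+1 : ι (a ℤ.+ 1ℤ) ≡ α +ℚ ι 1ℤ
          ι+1 = ι-+ a 1ℤ
          α-1 : α ≡ ι (a ℤ.- 1ℤ) +ℚ 1ℚ
          α-1 = trans (cong ι (sym (trans (ℤₚ.+-assoc a (ℤ.- 1ℤ) 1ℤ) (ℤₚ.+-identityʳ a))))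
                      (trans (ι-+ (a ℤ.- 1ℤ) 1ℤ) (cong (ι (a ℤ.- 1ℤ) +ℚ_) (ι-fromℕ 1)))
          Ju : ∀ y → (J ∙ u) y ≡ α *ℚ u y +ℚ (s ∙ u) y
          Ju y = begin
            (J ∙ u) y                         ≡⟨ involutive (J ∙ u) y ⟨
            (s ∙ (s ∙ (J ∙ u))) y             ≡⟨ resp s (λ y → trans (ring' ((s ∙ (J ∙ u)) y) (u y)) (cong (_+ℚ u y) (trans (sym (relation′ u y)) (x-y≡0⇒x≡y ((D ∙ (s ∙ u)) y) (α *ℚ (s ∙ u) y) (z y))))) y ⟩
            (s ∙ (λ y → α *ℚ (s ∙ u) y +ℚ u y)) y ≡⟨ on-+ s (λ y → α *ℚ (s ∙ u) y) u y ⟩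
            (s ∙ (λ y → α *ℚ (s ∙ u) y)) y +ℚ (s ∙ u) y ≡⟨ cong (_+ℚ (s ∙ u) y) (trans (on-scale s α (s ∙ u) y) (cong (α *ℚ_) (involutive u y))) ⟩
            α *ℚ u y +ℚ (s ∙ u) y             ∎
            where ring' : ∀ p q → p ≡ (p -ℚ q) +ℚ q
                  ring' = solve-∀ ℚ-ring
          -- J acts on u as a + s, so this is su + u, on which J acts as a + 1.
          inner : shift J (ι (a ℤ.- 1ℤ)) u ≗ (λ y → (s ∙ u) y +ℚ u y)
          inner y = trans (cong (_-ℚ ι (a ℤ.- 1ℤ) *ℚ u y) (trans (Ju y) (cong (λ e → e *ℚ u y +ℚ (s ∙ u) y) α-1)))
                          (ring' (ι (a ℤ.- 1ℤ)) ((s ∙ u) y) (u y))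
            where ring' : ∀ e p q → ((e +ℚ 1ℚ) *ℚ q +ℚ p) -ℚ e *ℚ q ≡ p +ℚ q
                  ring' = solve-∀ ℚ-ring
          outer : (J ∙ (λ y → (s ∙ u) y +ℚ u y)) x ≡ α *ℚ (s ∙ u) x +ℚ u x +ℚ (α *ℚ u x +ℚ (s ∙ u) x)
          outer = trans (on-+ J (s ∙ u) u x) (cong₂ _+ℚ_ (J-on-s {α} Du x) (Ju x))

    module _ (D-decomposes : ∀ f → Decomposes Everything D f) where

      -- Integrality passes from D to J here: v is killed by the factors J - r, where r runs over a
      -- ± 1 and the roots that D provides for (D - a)sv.
      eigenvector-decomposes : ∀ a v → Eigen D (ι a) v → Decomposes Everything J v
      eigenvector-decomposes a v Dv =
        Decomposes-shifts Everything-subspace J symJ _ rs v tt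
          (Decomposes-shifts Everything-subspace J symJ _ (a ℤ.- 1ℤ ∷ a ℤ.+ 1ℤ ∷ []) (shifts J rs v) tt
            (none (quadratic a (shifts J rs v) (shifts-eigen a rs v Dv)
              (λ x → trans (shifts-through a rs v Dv x) (proj₂ killed x)))))
        where
          killed = kill (D-decomposes (shift D (ι a) (s ∙ v)))
          rs = proj₁ killed

      J-decomposes : ∀ f → Decomposes Everything J f
      J-decomposes f = go f (D-decomposes f)
        where
          ring : ∀ p q → q +ℚ (p -ℚ q) ≡ p
          ring = solve-∀ ℚ-ring
          go : ∀ f → Decomposes Everything D f → Decomposes Everything J f
          go f (none z) = none z
          go f (more c v _ Dv rest) = Decomposes-resp (λ x → ring (f x) (v x))
            (Decomposes-+ (eigenvector-decomposes c v Dv) (go (λ x → f x -ℚ v x) rest))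

-- Transpositions and Jucys–Murphy elements acting on functions of a word

module _ {d : ℕ} where

  swap-left : ∀ (a b : Fin d) → swap (a , b) a ≡ b
  swap-left a b with a Finₚ.≟ a
  ... | yes _ = refl
  ... | no ne = ⊥-elim (ne refl)

  swap-right : ∀ (a b : Fin d) → swap (a , b) b ≡ a
  swap-right a b with b Finₚ.≟ a
  ... | yes e = e
  ... | no _ with b Finₚ.≟ b
  ...   | yes _ = refl
  ...   | no ne = ⊥-elim (ne refl)

  swap-other : ∀ {a b x : Fin d} → x ≢ a → x ≢ b → swap (a , b) x ≡ x
  swap-other {a} {b} {x} p q with x Finₚ.≟ a
  ... | yes e = ⊥-elim (p e)
  ... | no _ with x Finₚ.≟ b
  ...   | yes e = ⊥-elim (q e)
  ...   | no _ = refl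

  swap-cases : ∀ (P : Fin d → Fin d → Set) {a b} → P a b → P b a → (∀ {x} → x ≢ a → x ≢ b → P x x) →
               ∀ x → P x (swap (a , b) x)
  swap-cases P {a} {b} p q r x with x Finₚ.≟ a
  ... | yes refl = p
  ... | no n with x Finₚ.≟ b
  ...   | yes refl = q
  ...   | no m = r n m

  swap-involutive : ∀ t (x : Fin d) → swap t (swap t x) ≡ x
  swap-involutive (a , b) = swap-cases (λ x y → swap (a , b) y ≡ x) (swap-right a b) (swap-left a b) swap-other

  swap-injective : ∀ t {x y : Fin d} → swap t x ≡ swap t y → x ≡ y
  swap-injective t {x} {y} e = trans (sym (swap-involutive t x)) (trans (cong (swap t) e) (swap-involutive t y))

  swap-conj : ∀ {φ : Fin d → Fin d} → (∀ {x y} → φ x ≡ φ y → x ≡ y) → ∀ a b x →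
              φ (swap (a , b) x) ≡ swap (φ a , φ b) (φ x)
  swap-conj {φ} inj a b = swap-cases (λ x y → φ y ≡ swap (φ a , φ b) (φ x))
    (sym (swap-left (φ a) (φ b))) (sym (swap-right (φ a) (φ b)))
    (λ n m → sym (swap-other (n ∘ inj) (m ∘ inj)))

vectors : {A : Set} → List A → ∀ n → List (Vec A n)
vectors xs zero    = [] ∷ []
vectors xs (suc n) = Data.List.cartesianProductWith _∷_ xs (vectors xs n)

vectors-complete : {A : Set} {xs : List A} → (∀ x → x ∈ xs) → ∀ {n} (v : Vec A n) → v ∈ vectors xs n
vectors-complete c []      = here refl
vectors-complete c (x ∷ v) = ∈ₚ.∈-cartesianProductWith⁺ _∷_ (c x) (vectors-complete c v)

vectors-unique : {A : Set} {xs : List A} → Unique xs → ∀ n → Unique (vectors xs n)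
vectors-unique u zero    = [] ∷ []
vectors-unique u (suc n) = Uniqueₚ.cartesianProductWith⁺ _∷_ Vecₚ.∷-injective u (vectors-unique u n)

module JucysMurphy (d : ℕ) where

  -- Arbitrary maps are allowed, not only permutations: composing with a transposition is an
  -- involution on these too, and `vectors` lists them without any proof of bijectivity.
  Word : Set
  Word = Vec (Fin d) d

  words : List Word
  words = vectors (allFin d) d

  words-complete : ∀ w → w ∈ words
  words-complete = vectors-complete ∈ₚ.∈-allFin

  words-unique : Unique words
  words-unique = vectors-unique (Uniqueₚ.allFin⁺ d) d

  open InnerProduct words words-complete public

  swapW : Fin d × Fin d → Word → Word
  swapW t = Vec.map (swap t)

  swapW-involutive : ∀ t w → swapW t (swapW t w) ≡ w
  swapW-involutive t w = trans (sym (Vecₚ.map-∘ (swap t) (swap t) w))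
                               (trans (Vecₚ.map-cong (swap-involutive t) w) (Vecₚ.map-id w))

  swapW-conj : ∀ t a b w → swapW t (swapW (a , b) w) ≡ swapW (swap t a , swap t b) (swapW t w)
  swapW-conj t a b w = trans (sym (Vecₚ.map-∘ (swap t) (swap (a , b)) w))
    (trans (Vecₚ.map-cong (swap-conj (swap-injective t) a b) w) (Vecₚ.map-∘ (swap (swap t a , swap t b)) (swap t) w))

  τ : Fin d × Fin d → Operator Word
  τ t = record { _∙_ = λ f w → f (swapW t w) ; resp = λ e w → e (swapW t w) ; lin = λ α β f g w → refl }

  τ-involutive : ∀ t f w → (τ t ∙ (τ t ∙ f)) w ≡ f w
  τ-involutive t f w = cong f (swapW-involutive t w)

  τ-symmetric : ∀ t → Symmetric (τ t)
  τ-symmetric t f g = trans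
    (Σ-cong words (λ w → cong (λ v → f (swapW t w) *ℚ g v) (sym (swapW-involutive t w))))
    (Σ-reindex (swapW t) words-unique
      (λ {x} {y} e → trans (sym (swapW-involutive t x)) (trans (cong (swapW t) e) (swapW-involutive t y)))
      (λ _ → words-complete _) (λ {x} _ → swapW t x , words-complete _ , sym (swapW-involutive t x))
      (λ w → f w *ℚ g (swapW t w)))

  -- The Jucys-Murphy element Σ (a z) of the point z when S consists of the points that precede z in
  -- a chain.
  JM : Fin d → List (Fin d) → Operator Word
  JM z S = record
    { _∙_  = λ f w → Σℚ S (λ a → f (swapW (a , z) w))
    ; resp = λ e w → Σ-cong S (λ a → e (swapW (a , z) w))
    ; lin  = λ α β f g w → Σ-lin S α β (λ a → f (swapW (a , z) w)) (λ a → g (swapW (a , z) w))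
    }

  JM-symmetric : ∀ z S → Symmetric (JM z S)
  JM-symmetric z S f g = begin
    Σℚ words (λ w → Σℚ S (λ a → f (swapW (a , z) w)) *ℚ g w)      ≡⟨ Σ-cong words (λ w → trans (ℚₚ.*-comm _ (g w)) (sym (Σ-* S (g w) _))) ⟩
    Σℚ words (λ w → Σℚ S (λ a → g w *ℚ f (swapW (a , z) w)))      ≡⟨ Σ-comm words S _ ⟩
    Σℚ S (λ a → Σℚ words (λ w → g w *ℚ f (swapW (a , z) w)))      ≡⟨ Σ-cong S (λ a → trans (sym (τ-symmetric (a , z) g f)) (⟪⟫-comm (τ (a , z) ∙ g) f)) ⟩
    Σℚ S (λ a → Σℚ words (λ w → f w *ℚ g (swapW (a , z) w)))      ≡⟨ Σ-comm words S _ ⟨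
    Σℚ words (λ w → Σℚ S (λ a → f w *ℚ g (swapW (a , z) w)))      ≡⟨ Σ-cong words (λ w → Σ-* S (f w) _) ⟩
    Σℚ words (λ w → f w *ℚ Σℚ S (λ a → g (swapW (a , z) w)))      ∎
    where open ≡-Reasoning

  Preserves : Fin d × Fin d → Fin d → List (Fin d) → Set
  Preserves t z S = swap t z ≡ z × (∀ {c} → c ∈ S → swap t c ∈ S)

  -- Conjugation by t fixes z and maps S to itself, so it only permutes the summands (c z).
  JM-τ-commute : ∀ {t z S} → Unique S → Preserves t z S → Commute (JM z S) (τ t)
  JM-τ-commute {t} {z} {S} u (fix , into) f w = begin
    Σℚ S (λ c → f (swapW t (swapW (c , z) w)))             ≡⟨ Σ-cong S (λ c → cong f (trans (swapW-conj t c z w) (cong (λ y → swapW (swap t c , y) (swapW t w)) fix))) ⟩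
    Σℚ S (λ c → f (swapW (swap t c , z) (swapW t w)))      ≡⟨ Σ-reindex (swap t) u (swap-injective t) into (λ {x} p → swap t x , into p , sym (swap-involutive t x)) (λ c → f (swapW (c , z) (swapW t w))) ⟩
    Σℚ S (λ c → f (swapW (c , z) (swapW t w)))             ∎
    where open ≡-Reasoning

  JM-commute : ∀ {z S b S'} → Unique S → (∀ a → a ∈ S' → Preserves (a , b) z S) → Commute (JM z S) (JM b S')
  JM-commute {z} {S} {b} {S'} u pres f w = trans (Σ-comm S S' _)
    (Σ-cong-∈ S' (λ a p → JM-τ-commute u (pres a p) f w))

  preserves-inside : ∀ {a b z S} → a ∈ S → b ∈ S → z ∉ S → Preserves (a , b) z S
  preserves-inside {a} {b} {z} {S} p q n =
    swap-other (λ { refl → n p }) (λ { refl → n q }) ,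
    λ {c} → swap-cases (λ c c' → c ∈ S → c' ∈ S) (λ _ → q) (λ _ → p) (λ _ _ r → r) c

  preserves-outside : ∀ {a b z S} → a ∉ z ∷ S → b ∉ z ∷ S → Preserves (a , b) z S
  preserves-outside {S = S} n m =
    swap-other (λ { refl → n (here refl) }) (λ { refl → m (here refl) }) ,
    λ {c} p → subst (_∈ S) (sym (swap-other (λ { refl → n (there p) }) (λ { refl → m (there p) }))) p

  module Step {x y : Fin d} {L : List (Fin d)} (u : Unique (x ∷ y ∷ L)) where

    x∉L : x ∉ L
    x∉L p = Uniqueₚ.Unique[x∷xs]⇒x∉xs u (there p)

    y∉L : y ∉ L
    y∉L = Uniqueₚ.Unique[x∷xs]⇒x∉xs (AllPairs.tail u)

    -- Conjugating (a x) by (y x) gives (a y) for a in L, which accounts for the first term; the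
    -- remaining summand (y x) cancels against τ and leaves f.
    relation : ∀ f w → (JM x (y ∷ L) ∙ (τ (y , x) ∙ f)) w ≡ (τ (y , x) ∙ (JM y L ∙ f)) w +ℚ f w
    relation f w = trans (ℚₚ.+-comm (f (swapW (y , x) (swapW (y , x) w))) _)
      (cong₂ _+ℚ_ (Σ-cong-∈ L (λ a p → cong f (trans (swapW-conj (y , x) a x w)
                     (cong₂ (λ b c → swapW (b , c) (swapW (y , x) w)) (swap-other (λ { refl → y∉L p }) (λ { refl → x∉L p })) (swap-right y x)))))
                  (τ-involutive (y , x) f w))

    commute : Commute (JM y L) (JM x (y ∷ L))
    commute f w = sym (JM-commute (AllPairs.tail u)
      (λ a p → preserves-inside (there p) (here refl) (Uniqueₚ.Unique[x∷xs]⇒x∉xs u)) f w)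

    open HeckeRelation words words-complete (JM y L) (JM x (y ∷ L)) (τ (y , x)) (JM-symmetric y L)
      (JM-symmetric x (y ∷ L)) (τ-symmetric (y , x)) (τ-involutive (y , x)) relation public

  JM-decomposes : ∀ x L → Unique (x ∷ L) → ∀ f → Decomposes Everything (JM x L) f
  -- The empty sum is the zero operator, so every f has eigenvalue 0; this starts the integrality
  -- argument.
  JM-decomposes x []      u f = more 0ℤ f tt (λ w → sym (trans (cong (_*ℚ f w) (ι-fromℕ 0)) (ℚₚ.*-zeroˡ (f w)))) (none (λ w → x-x≡0 (f w)))
  JM-decomposes x (y ∷ L) u f = Step.J-decomposes u (Step.commute u) (JM-decomposes y L (AllPairs.tail u)) f

  -- f is a joint eigenvector of the Jucys–Murphy elements of the chain L, with the largest point
  -- and its eigenvalue listed first.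
  Joint : List (Fin d) → List ℤ → (Word → ℚ) → Set
  Joint []      []       f = ⊤
  Joint []      (c ∷ cs) f = ⊥
  Joint (x ∷ L) []       f = ⊥
  Joint (x ∷ L) (c ∷ cs) f = Eigen (JM x L) (ι c) f × Joint L cs f

-- The Okounkov-Vershik rules for contents

Adjacent : ℤ → ℤ → Set
Adjacent a b = b ≡ a ℤ.+ 1ℤ ⊎ b ≡ a ℤ.- 1ℤ

Adjacent-sym : ∀ {a b} → Adjacent a b → Adjacent b a
Adjacent-sym {a} (inj₁ refl) = inj₂ (sym (trans (ℤₚ.+-assoc a 1ℤ (ℤ.- 1ℤ)) (ℤₚ.+-identityʳ a)))
Adjacent-sym {a} (inj₂ refl) = inj₁ (sym (trans (ℤₚ.+-assoc a (ℤ.- 1ℤ) 1ℤ) (ℤₚ.+-identityʳ a)))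

-- Lists that are not the list of contents of a standard tableau, by the rules of Okounkov and Vershik.
data Bad : List ℤ → Set where
  first    : ∀ {c} → c ≢ 0ℤ → Bad (c ∷ [])
  equal    : ∀ {a cs} → Bad (a ∷ a ∷ cs)
  braid    : ∀ {a b cs} → Adjacent a b → Bad (a ∷ b ∷ a ∷ cs)
  exchange : ∀ ps {a b cs} → ¬ Adjacent a b → Bad (ps ++ b ∷ a ∷ cs) → Bad (ps ++ a ∷ b ∷ cs)
  later    : ∀ {c cs} → Bad cs → Bad (c ∷ cs)

ι-sub : ∀ a b → ι (a ℤ.- b) ≡ ι a -ℚ ι b
ι-sub a b = trans (ring (ι (a ℤ.- b)) (ι b)) (cong (_-ℚ ι b)
  (trans (sym (ι-+ (a ℤ.- b) b)) (cong ι (trans (ℤₚ.+-assoc a (ℤ.- b) b) (trans (cong (λ z → a ℤ.+ z) (ℤₚ.+-inverseˡ b)) (ℤₚ.+-identityʳ a))))))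
  where ring : ∀ p q → p ≡ (p +ℚ q) -ℚ q
        ring = solve-∀ ℚ-ring

adjacent-square : ∀ {a b} → Adjacent a b → (ι b -ℚ ι a) *ℚ (ι b -ℚ ι a) ≡ 1ℚ
adjacent-square {a} (inj₁ refl) = trans (cong (λ z → (z -ℚ ι a) *ℚ (z -ℚ ι a)) (trans (ι-+ a 1ℤ) (cong (ι a +ℚ_) (ι-fromℕ 1)))) (ring (ι a))
  where ring : ∀ a → ((a +ℚ 1ℚ) -ℚ a) *ℚ ((a +ℚ 1ℚ) -ℚ a) ≡ 1ℚ
        ring = solve-∀ ℚ-ring
adjacent-square {a} (inj₂ refl) = trans (cong (λ z → (z -ℚ ι a) *ℚ (z -ℚ ι a)) (trans (ι-sub a 1ℤ) (cong (ι a -ℚ_) (ι-fromℕ 1)))) (ring (ι a))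
  where ring : ∀ a → ((a -ℚ 1ℚ) -ℚ a) *ℚ ((a -ℚ 1ℚ) -ℚ a) ≡ 1ℚ
        ring = solve-∀ ℚ-ring

square-adjacent : ∀ {a b} → (ι b -ℚ ι a) *ℚ (ι b -ℚ ι a) -ℚ 1ℚ ≡ 0ℚ → Adjacent a b
square-adjacent {a} {b} e with b ℤₚ.≟ a ℤ.+ 1ℤ
... | yes p = inj₁ p
... | no p = inj₂ (ι-injective (trans (x-y≡0⇒x≡y _ _ (*-cancel-0 (ι b -ℚ (ι a +ℚ 1ℚ)) (ι b -ℚ (ι a -ℚ 1ℚ)) ne (trans (ring (ι a) (ι b)) e)))
                (sym (trans (ι-sub a 1ℤ) (cong (ι a -ℚ_) (ι-fromℕ 1))))))
  where ring : ∀ a b → (b -ℚ (a +ℚ 1ℚ)) *ℚ (b -ℚ (a -ℚ 1ℚ)) ≡ (b -ℚ a) *ℚ (b -ℚ a) -ℚ 1ℚ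
        ring = solve-∀ ℚ-ring
        ne : ι b -ℚ (ι a +ℚ 1ℚ) ≢ 0ℚ
        ne z = p (ι-injective (trans (x-y≡0⇒x≡y _ _ z) (sym (trans (ι-+ a 1ℤ) (cong (ι a +ℚ_) (ι-fromℕ 1))))))

module OkounkovVershik (d : ℕ) where
  open JucysMurphy d

  Eigen-exchange : ∀ T {x y : Fin d} a b r v → Commute T (τ (y , x)) → Eigen T r v →
                   Eigen T r (λ w → (b -ℚ a) *ℚ (τ (y , x) ∙ v) w -ℚ v w)
  Eigen-exchange T {x} {y} a b r v com Tv = Subspace.E-sub (Eigen-subspace T r)
    (Subspace.E-scale (Eigen-subspace T r) (b -ℚ a) (Eigen-commute {S = τ (y , x)} {T = T} r com Tv)) Tv

  exchange-below : ∀ {x y} L cs a b v → Unique L → x ∉ L → y ∉ L → Joint L cs v →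
                   Joint L cs (λ w → (b -ℚ a) *ℚ (τ (y , x) ∙ v) w -ℚ v w)
  exchange-below []      []       a b v u p q J = tt
  exchange-below (z ∷ L) (c ∷ cs) a b v u p q (Jz , J) =
    Eigen-exchange (JM z L) a b (ι c) v (JM-τ-commute (AllPairs.tail u) (preserves-outside q p)) Jz ,
    exchange-below L cs a b v (AllPairs.tail u) (p ∘ there) (q ∘ there) J


  -- A point above x and y sees them only through the set of points below it, which the
  -- transposition of x and y preserves. So the eigenvalues above stay and only those treated by the
  -- continuation change.
  exchange-above : ∀ {x y} P L ps a b {cs cs'} v → Unique (P ++ x ∷ y ∷ L) → length P ≡ length ps →
    (Joint (x ∷ y ∷ L) cs v → Joint (x ∷ y ∷ L) cs' (λ w → (b -ℚ a) *ℚ (τ (y , x) ∙ v) w -ℚ v w)) →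
    Joint (P ++ x ∷ y ∷ L) (ps ++ cs) v →
    Joint (P ++ x ∷ y ∷ L) (ps ++ cs') (λ w → (b -ℚ a) *ℚ (τ (y , x) ∙ v) w -ℚ v w)
  exchange-above []      L []       a b v u e k J = k J
  exchange-above (z ∷ P) L (c ∷ ps) a b v u e k (Jz , J) =
    Eigen-exchange (JM z (P ++ _ ∷ _ ∷ L)) a b (ι c) v (JM-τ-commute (AllPairs.tail u)
      (preserves-inside (∈ₚ.∈-++⁺ʳ P (there (here refl))) (∈ₚ.∈-++⁺ʳ P (here refl)) (Uniqueₚ.Unique[x∷xs]⇒x∉xs u))) Jz ,
    exchange-above P L ps a b v (AllPairs.tail u) (ℕₚ.suc-injective e) k J

  Joint-split : ∀ ps L {a b cs v} → Joint L (ps ++ a ∷ b ∷ cs) v →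
    ∃[ P ] ∃[ x ] ∃[ y ] ∃[ L' ] (L ≡ P ++ x ∷ y ∷ L' × length P ≡ length ps × Joint (x ∷ y ∷ L') (a ∷ b ∷ cs) v)
  Joint-split []       (x ∷ y ∷ L) J = [] , x , y , L , refl , refl , J
  Joint-split []       (x ∷ [])    (_ , ())
  Joint-split (p ∷ ps) (z ∷ L) (_ , J) with P , x , y , L' , refl , e , J' ← Joint-split ps L J =
    z ∷ P , x , y , L' , refl , cong suc e , J'

  AllPairs-++ʳ : ∀ {A : Set} {R : A → A → Set} P {L : List A} → AllPairs R (P ++ L) → AllPairs R L
  AllPairs-++ʳ []      u       = u
  AllPairs-++ʳ (_ ∷ P) (_ ∷ u) = AllPairs-++ʳ P u

  -- For the contents a, b, a with b = a ± 1 the Coxeter generators s₁ and s₂ act by the opposite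
  -- signs ε and −ε, which contradicts the braid relation.
  braid-vanishes : ∀ {x y z L a b v} → Unique (x ∷ y ∷ z ∷ L) → Adjacent a b →
    Eigen (JM x (y ∷ z ∷ L)) (ι a) v → Eigen (JM y (z ∷ L)) (ι b) v → Eigen (JM z L) (ι a) v → Vanishes v
  braid-vanishes {x} {y} {z} {L} {a} {b} {v} u ad Jx Jy Jz w =
    *-cancel-0 (1ℚ +ℚ 1ℚ) (v w) (λ ()) (*-cancel-0 (ε *ℚ ε *ℚ ε) ((1ℚ +ℚ 1ℚ) *ℚ v w) ε³≢0
      (trans (ring (ι a) (ι b) (v w)) (trans (cong₂ _-ℚ_ (sym s₂s₁s₂) (sym s₁s₂s₁)) (trans (cong (_-ℚ (s₁ ∙ (s₂ ∙ (s₁ ∙ v))) w) braid-relation) (x-x≡0 ((s₁ ∙ (s₂ ∙ (s₁ ∙ v))) w))))))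
    where
      ε = ι b -ℚ ι a
      ε² : ε *ℚ ε ≡ 1ℚ
      ε² = adjacent-square ad
      ε′ = ι a -ℚ ι b
      ε′² : ε′ *ℚ ε′ ≡ 1ℚ
      ε′² = trans (ring' (ι a) (ι b)) ε²
        where ring' : ∀ a b → (a -ℚ b) *ℚ (a -ℚ b) ≡ (b -ℚ a) *ℚ (b -ℚ a)
              ring' = solve-∀ ℚ-ring
      s₁ = τ (z , y)
      s₂ = τ (y , x)
      s₁v : Eigen s₁ ε v
      s₁v = Step.adjacent (AllPairs.tail u) {ι a} {ι b} {v} Jz Jy ε²
      s₂v : Eigen s₂ ε′ v
      s₂v = Step.adjacent u {ι b} {ι a} {v} Jy Jx ε′²
      triple : ∀ S T p q → Eigen S p v → Eigen T q v → (S ∙ (T ∙ (S ∙ v))) w ≡ p *ℚ (q *ℚ (p *ℚ v w))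
      triple S T p q Sv Tv = trans (resp S (λ w → trans (resp T Sv w) (trans (on-scale T p v w) (cong (p *ℚ_) (Tv w)))) w)
        (trans (on-scale S p (λ w → q *ℚ v w) w) (trans (cong (p *ℚ_) (trans (on-scale S q v w) (cong (q *ℚ_) (Sv w)))) refl))
      s₁s₂s₁ : (s₁ ∙ (s₂ ∙ (s₁ ∙ v))) w ≡ ε *ℚ (ε′ *ℚ (ε *ℚ v w))
      s₁s₂s₁ = triple s₁ s₂ ε ε′ s₁v s₂v
      s₂s₁s₂ : (s₂ ∙ (s₁ ∙ (s₂ ∙ v))) w ≡ ε′ *ℚ (ε *ℚ (ε′ *ℚ v w))
      s₂s₁s₂ = triple s₂ s₁ ε′ ε s₂v s₁v
      ring : ∀ a b v → (b -ℚ a) *ℚ (b -ℚ a) *ℚ (b -ℚ a) *ℚ ((1ℚ +ℚ 1ℚ) *ℚ v)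
           ≡ (a -ℚ b) *ℚ ((b -ℚ a) *ℚ ((a -ℚ b) *ℚ v)) -ℚ (b -ℚ a) *ℚ ((a -ℚ b) *ℚ ((b -ℚ a) *ℚ v))
      ring = solve-∀ ℚ-ring
      ε³≢0 : ε *ℚ ε *ℚ ε ≢ 0ℚ
      ε³≢0 e = ℚₚ.1≢0 (trans (sym ε²) (trans (cong (_*ℚ ε) (trans (sym (ℚₚ.*-identityˡ ε)) (trans (cong (_*ℚ ε) (sym ε²)) e))) (ℚₚ.*-zeroˡ ε)))
      z≢x : z ≢ x
      z≢x refl = Uniqueₚ.Unique[x∷xs]⇒x∉xs u (there (here refl))
      z≢y : z ≢ y
      z≢y refl = Uniqueₚ.Unique[x∷xs]⇒x∉xs (AllPairs.tail u) (here refl)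
      x≢y : x ≢ y
      x≢y refl = Uniqueₚ.Unique[x∷xs]⇒x∉xs u (here refl)
      braid-word : ∀ w → swapW (y , x) (swapW (z , y) (swapW (y , x) w)) ≡ swapW (z , y) (swapW (y , x) (swapW (z , y) w))
      braid-word w = trans
        (trans (swapW-conj (y , x) z y _) (trans (cong₂ (λ p q → swapW (p , q) (swapW (y , x) (swapW (y , x) w))) (swap-other z≢y z≢x) (swap-left y x))
           (cong (swapW (z , x)) (swapW-involutive (y , x) w))))
        (sym (trans (swapW-conj (z , y) y x _) (trans (cong₂ (λ p q → swapW (p , q) (swapW (z , y) (swapW (z , y) w))) (swap-right z y) (swap-other (z≢x ∘ sym) x≢y))
           (cong (swapW (z , x)) (swapW-involutive (z , y) w)))))
      braid-relation : (s₂ ∙ (s₁ ∙ (s₂ ∙ v))) w ≡ (s₁ ∙ (s₂ ∙ (s₁ ∙ v))) w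
      braid-relation = cong v (braid-word w)

  -- In the `exchange` case the intertwiner turns v into a joint eigenvector for the exchanged
  -- contents, which is zero by induction; as the two contents are not adjacent, v itself is zero by
  -- `exchange-nonzero`.
  bad-vanishes : ∀ {cs} → Bad cs → ∀ L v → Unique L → Joint L cs v → Vanishes v
  bad-vanishes (first {c} c≢0) (x ∷ []) v u (Jx , _) w =
    *-cancel-0 (ι c) (v w) (λ e → c≢0 (ι-injective (trans e (sym (ι-fromℕ 0))))) (sym (Jx w))
  bad-vanishes (first c≢0) (x ∷ y ∷ L) v u (_ , ())
  bad-vanishes (equal {a}) (x ∷ y ∷ L) v u (Jx , Jy , _) = Step.equal-vanishes u {ι a} {v} Jy Jx
  bad-vanishes (braid ad) (x ∷ y ∷ z ∷ L) v u (Jx , Jy , Jz , _) = braid-vanishes u ad Jx Jy Jz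
  bad-vanishes (exchange ps {a} {b} {cs} na B) L v u J = conclude (Joint-split ps L J)
    where
      conclude : ∃[ P ] ∃[ x ] ∃[ y ] ∃[ L' ] (L ≡ P ++ x ∷ y ∷ L' × length P ≡ length ps × Joint (x ∷ y ∷ L') (a ∷ b ∷ cs) v) → Vanishes v
      conclude (P , x , y , L' , refl , e , Jx , Jy , _) =
        Step.exchange-nonzero u' {ι b} {ι a} {v} Jy Jx (λ z → na (Adjacent-sym (square-adjacent {b} {a} z)))
          (bad-vanishes B L _ u (exchange-above P L' ps (ι b) (ι a) {a ∷ b ∷ cs} {b ∷ a ∷ cs} v u e exchanged J))
        where
          u' : Unique (x ∷ y ∷ L')
          u' = AllPairs-++ʳ P u
          exchanged : Joint (x ∷ y ∷ L') (a ∷ b ∷ cs) v → Joint (x ∷ y ∷ L') (b ∷ a ∷ cs) (λ w → (ι a -ℚ ι b) *ℚ (τ (y , x) ∙ v) w -ℚ v w)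
          exchanged (_ , _ , J') = Step.exchange-J u' {ι b} {ι a} {v} Jy Jx , Step.exchange-D u' {ι b} {ι a} {v} Jy Jx ,
            exchange-below L' cs (ι b) (ι a) v (AllPairs.tail (AllPairs.tail u')) (Step.x∉L u') (Step.y∉L u') J'
  bad-vanishes (later B) (x ∷ L) v u (_ , J) = bad-vanishes B L v (AllPairs.tail u) J

-- Multiplicities in lists of contents

count : ℤ → List ℤ → ℕ
count a []       = 0
count a (x ∷ xs) with x ℤₚ.≟ a
... | yes _ = suc (count a xs)
... | no _  = count a xs

count-yes : ∀ {a x} xs → x ≡ a → count a (x ∷ xs) ≡ suc (count a xs)
count-yes {a} {x} xs e with x ℤₚ.≟ a
... | yes _ = refl
... | no n  = ⊥-elim (n e)

count-no : ∀ {a x} xs → x ≢ a → count a (x ∷ xs) ≡ count a xs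
count-no {a} {x} xs n with x ℤₚ.≟ a
... | yes e = ⊥-elim (n e)
... | no _  = refl

count-mono : ∀ a x xs → count a xs ≤ count a (x ∷ xs)
count-mono a x xs with x ℤₚ.≟ a
... | yes _ = ℕₚ.n≤1+n _
... | no _  = ℕₚ.≤-refl

first-occurrence : ∀ (x : ℤ) w → x ∉ w ⊎ ∃[ u ] ∃[ u' ] (w ≡ u ++ x ∷ u' × x ∉ u)
first-occurrence x [] = inj₁ λ ()
first-occurrence x (y ∷ w) with x ℤₚ.≟ y
... | yes refl = inj₂ ([] , w , refl , λ ())
... | no n with first-occurrence x w
...   | inj₁ p = inj₁ λ { (here e) → n e ; (there q) → p q }
...   | inj₂ (u , u' , refl , p) = inj₂ (y ∷ u , u' , refl , λ { (here e) → n e ; (there q) → p q })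

last-occurrence : ∀ (x : ℤ) w → x ∉ w ⊎ ∃[ u ] ∃[ u' ] (w ≡ u ++ x ∷ u' × x ∉ u')
last-occurrence x [] = inj₁ λ ()
last-occurrence x (y ∷ w) with last-occurrence x w
... | inj₂ (u , u' , refl , p) = inj₂ (y ∷ u , u' , refl , p)
... | inj₁ p with x ℤₚ.≟ y
...   | yes refl = inj₂ ([] , w , refl , p)
...   | no n = inj₁ λ { (here e) → n e ; (there q) → p q }

later* : ∀ xs {ys} → Bad ys → Bad (xs ++ ys)
later* []       B = B
later* (x ∷ xs) B = later (later* xs B)

slide : ∀ ps w {a cs} → (∀ {x} → x ∈ w → ¬ Adjacent x a) → Bad (ps ++ a ∷ w ++ cs) → Bad (ps ++ w ++ a ∷ cs)
slide ps []      n B = B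
slide ps (x ∷ w) {a} {cs} n B = subst Bad (Listₚ.++-assoc ps (x ∷ []) (w ++ a ∷ cs))
  (slide (ps ++ x ∷ []) w (n ∘ there) (subst Bad (sym (Listₚ.++-assoc ps (x ∷ []) (a ∷ w ++ cs)))
    (exchange ps (n (here refl)) B)))

-- The sign e lets one argument serve both directions away from 0: the values compared are 0, e, 2e,
-- and so on.
module _ {e : ℤ} (unit : e ≡ 1ℤ ⊎ e ≡ ℤ.- 1ℤ) where

  ±-cancel : ∀ a → a ℤ.+ e ℤ.- e ≡ a
  ±-cancel a = trans (ℤₚ.+-assoc a e (ℤ.- e)) (trans (cong (λ z → a ℤ.+ z) (ℤₚ.+-inverseʳ e)) (ℤₚ.+-identityʳ a))

  adjacent-+ : ∀ a → Adjacent a (a ℤ.+ e)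
  adjacent-+ a = go unit
    where go : ∀ {e} → e ≡ 1ℤ ⊎ e ≡ ℤ.- 1ℤ → Adjacent a (a ℤ.+ e)
          go (inj₁ refl) = inj₁ refl
          go (inj₂ refl) = inj₂ refl

  not-adjacent : ∀ {a x} → x ≢ a ℤ.+ e → x ≢ a ℤ.- e → ¬ Adjacent a x
  not-adjacent {a} {x} = go unit
    where go : ∀ {e} → e ≡ 1ℤ ⊎ e ≡ ℤ.- 1ℤ → x ≢ a ℤ.+ e → x ≢ a ℤ.- e → ¬ Adjacent a x
          go (inj₁ refl) p q (inj₁ r) = p r
          go (inj₁ refl) p q (inj₂ r) = q r
          go (inj₂ refl) p q (inj₁ r) = q r
          go (inj₂ refl) p q (inj₂ r) = p r

  -- Two consecutive occurrences of a enclose a − e. Otherwise one moves them towards each other: they meet,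
  -- or meet around a single a + e, or enclose two consecutive a + e with no (a + e) − e = a in between.
  between : ∀ n a w {cs} → length w ≤ n → a ∉ w → a ℤ.- e ∉ w → Bad (a ∷ w ++ a ∷ cs)
  between n a [] l p q = equal
  between (suc n) a (x ∷ w) {cs} (s≤s l) p q with x ℤₚ.≟ a ℤ.+ e
  ... | no ne = exchange [] (not-adjacent {a} {x} ne (λ { refl → q (here refl) })) (later (between n a w l (p ∘ there) (q ∘ there)))
  ... | yes refl with first-occurrence (a ℤ.+ e) w
  ...   | inj₁ r = slide (a ∷ a ℤ.+ e ∷ []) w
            (λ {x} m → not-adjacent {a} {x} (λ { refl → r m }) (λ { refl → q (there m) }) ∘ Adjacent-sym {x} {a}) (braid (adjacent-+ a))
  ...   | inj₂ (u , u' , refl , r) = later (subst (λ l → Bad (a ℤ.+ e ∷ l)) (sym (Listₚ.++-assoc u (a ℤ.+ e ∷ u') (a ∷ cs)))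
            (between n (a ℤ.+ e) u (ℕₚ.≤-trans (subst (length u ≤_) (sym (Listₚ.length-++ u)) (ℕₚ.m≤m+n _ _)) l) r
              (λ m → p (there (∈ₚ.∈-++⁺ˡ (subst (_∈ u) (±-cancel a) m))))))

  multiple : ℕ → ℤ
  multiple zero    = 0ℤ
  multiple (suc n) = multiple n ℤ.+ e

  multiple-* : ∀ n → multiple n ≡ pos n ℤ.* e
  multiple-* zero    = refl
  multiple-* (suc n) = trans (cong (ℤ._+ e) (multiple-* n)) (trans (ℤₚ.+-comm (pos n ℤ.* e) e)
    (sym (ℤₚ.suc-* (pos n) e)))

  multiple-injective : ∀ {m n} → multiple m ≡ multiple n → m ≡ n
  multiple-injective {m} {n} q = ℤₚ.+-injective (cancel unit (trans (sym (multiple-* m)) (trans q (multiple-* n))))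
    where cancel : ∀ {e} → e ≡ 1ℤ ⊎ e ≡ ℤ.- 1ℤ → pos m ℤ.* e ≡ pos n ℤ.* e → pos m ≡ pos n
          cancel (inj₁ refl) = ℤₚ.*-cancelʳ-≡ (pos m) (pos n) 1ℤ
          cancel (inj₂ refl) = ℤₚ.*-cancelʳ-≡ (pos m) (pos n) (ℤ.- 1ℤ)

  -- The first occurrence of (n+1)e is preceded by ne.
  initial : ∀ l n w → length w ≤ l → multiple (suc n) ∉ w → multiple n ∉ w → Bad (multiple (suc n) ∷ w)
  -- The list starts with the largest point, so its last entries come first in the tableau. If
  -- (n+2)e is absent from w, then (n+1)e can be moved to the very beginning of the tableau, where
  -- only 0 is allowed. Otherwise the earliest (n+2)e has no (n+1)e before it, and the argument
  -- repeats one step further from 0.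
  initial l n w b p q with last-occurrence (multiple (suc n) ℤ.+ e) w
  ... | inj₁ r = alone w r q
    where
      alone : ∀ w → multiple (suc n) ℤ.+ e ∉ w → multiple n ∉ w → Bad (multiple (suc n) ∷ w)
      alone []      r q = first λ z → ℕₚ.1+n≢0 (multiple-injective {suc n} {0} z)
      alone (x ∷ w) r q = exchange [] (not-adjacent {multiple (suc n)} {x} (λ { refl → r (here refl) })
        (λ { refl → q (here (sym (±-cancel (multiple n)))) })) (later (alone w (r ∘ there) (q ∘ there)))
  initial zero    n w b p q | inj₂ ([] , u' , refl , r) with () ← b
  initial zero    n w b p q | inj₂ (_ ∷ _ , u' , refl , r) with () ← b
  initial (suc l) n w b p q | inj₂ (u , u' , refl , r) =
    later (later* u (initial l (suc n) u' (ℕₚ.≤-pred (ℕₚ.≤-trans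
      (subst (suc (length u') ≤_) (sym (Listₚ.length-++ u)) (ℕₚ.m≤n+m _ _)) b)) r (λ m → p (∈ₚ.∈-++⁺ʳ u (there m)))))

  module _ (n : ℕ) where

    private
      a = multiple (suc n)
      b = multiple n

      a≢b : a ≢ b
      a≢b q = ℕₚ.1+n≢n (multiple-injective {suc n} {n} q)

    -- Reading from the largest point down, every (n+1)e must meet an ne before the next (n+1)e, by
    -- `between`, and before the end, by `initial`. This matches the occurrences injectively.
    compare : ∀ w → Bad w ⊎ count a w ≤ count b w
    -- `u` is what has been read since an `a` that still waits for its `b`. The inequality is strict
    -- because one `b` in `w` pays for this pending `a`.
    compare-after : ∀ u w → a ∉ u → b ∉ u → Bad (a ∷ u ++ w) ⊎ count a w < count b w

    compare [] = inj₂ z≤n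
    compare (x ∷ w) with x ℤₚ.≟ a
    ... | no _ with compare w
    ...   | inj₁ B = inj₁ (later B)
    ...   | inj₂ l = inj₂ (ℕₚ.≤-trans l (count-mono b x w))
    compare (x ∷ w) | yes refl with compare-after [] w (λ ()) (λ ())
    ...   | inj₁ B = inj₁ B
    ...   | inj₂ l = inj₂ (subst (suc (count a w) ≤_) (sym (count-no w a≢b)) l)

    compare-after u [] p q = inj₁ (subst (λ v → Bad (a ∷ v)) (sym (Listₚ.++-identityʳ u)) (initial (length u) n u ℕₚ.≤-refl p q))
    compare-after u (x ∷ w) p q with x ℤₚ.≟ a
    ... | yes refl = inj₁ (between (length u) a u ℕₚ.≤-refl p (q ∘ subst (_∈ u) (±-cancel b)))
    ... | no x≢a = go (x ℤₚ.≟ b)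
      where
        snoc : ∀ {y} → y ∉ u → y ≢ x → y ∉ u ++ x ∷ []
        snoc r s m with ∈ₚ.∈-++⁻ u m
        ... | inj₁ m' = r m'
        ... | inj₂ (here refl) = s refl
        go : Dec (x ≡ b) → Bad (a ∷ u ++ x ∷ w) ⊎ count a w < count b (x ∷ w)
        go (yes x≡b) with compare w
        ... | inj₁ B = inj₁ (later (later* u (later B)))
        ... | inj₂ l = inj₂ (subst (suc (count a w) ≤_) (sym (count-yes w x≡b)) (s≤s l))
        go (no x≢b) with compare-after (u ++ x ∷ []) w (snoc p (x≢a ∘ sym)) (snoc q (x≢b ∘ sym))
        ... | inj₁ B = inj₁ (subst (λ v → Bad (a ∷ v)) (Listₚ.++-assoc u (x ∷ []) w) B)
        ... | inj₂ l = inj₂ (subst (suc (count a w) ≤_) (sym (count-no w x≢b)) l)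

  total : ℕ → List ℤ → ℕ
  total zero    w = 0
  total (suc k) w = count (multiple k) w + total k w

  total-∷ : ∀ k x w → total k (x ∷ w) ≤ suc (total k w)
                    × ((∀ {j} → j < k → x ≢ multiple j) → total k (x ∷ w) ≡ total k w)
  total-∷ zero    x w = z≤n , λ _ → refl
  total-∷ (suc k) x w with total-∷ k x w | x ℤₚ.≟ multiple k
  ... | l , f | yes refl = ℕₚ.≤-reflexive (cong (λ z → suc (count (multiple k) w + z)) (f λ j<k q → ℕₚ.<-irrefl (sym (multiple-injective {k} q)) j<k))
                         , λ n → ⊥-elim (n ℕₚ.≤-refl refl)
  ... | l , f | no _ = ℕₚ.≤-trans (ℕₚ.+-monoʳ-≤ (count (multiple k) w) l) (ℕₚ.≤-reflexive (ℕₚ.+-suc _ _))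
                     , λ n → cong (count (multiple k) w +_) (f (λ j<k → n (ℕₚ.m≤n⇒m≤1+n j<k)))

  total-length : ∀ k w → total k w ≤ length w
  total-length zero    []      = z≤n
  total-length (suc k) []      = total-length k []
  total-length k       (x ∷ w) = ℕₚ.≤-trans (proj₁ (total-∷ k x w)) (s≤s (total-length k w))

  compare-total : ∀ k w → Bad w ⊎ suc k * count (multiple k) w ≤ total (suc k) w
  compare-total zero    w = inj₂ ℕₚ.≤-refl
  compare-total (suc k) w with compare k w | compare-total k w
  ... | inj₁ B | _      = inj₁ B
  ... | inj₂ _ | inj₁ B = inj₁ B
  ... | inj₂ l | inj₂ m = inj₂ (ℕₚ.+-monoʳ-≤ (count (multiple (suc k)) w) (ℕₚ.≤-trans (ℕₚ.*-monoʳ-≤ (suc k) l) m))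

  -- If ke occurs c times, the k + 1 values 0, e, ..., ke occur at least c times each, so (k + 1)c
  -- is at most the length n. For c ≥ 1 this leaves kc ≤ n - 1; for c = 0 the bound is trivial.
  content-bound : ∀ k w → Bad w ⊎ k * count (pos k ℤ.* e) w ≤ length w ∸ 1
  content-bound k w with compare-total k w
  ... | inj₁ B = inj₁ B
  ... | inj₂ l = inj₂ (subst (λ z → k * count z w ≤ length w ∸ 1) (multiple-* k)
                   (conclude (count (multiple k) w) (ℕₚ.≤-trans l (total-length (suc k) w))))
    where
      conclude : ∀ c → suc k * c ≤ length w → k * c ≤ length w ∸ 1
      conclude zero    b = ℕₚ.≤-trans (ℕₚ.≤-reflexive (ℕₚ.*-zeroʳ k)) z≤n
      conclude (suc c) b = ℕₚ.≤-trans (ℕₚ.m≤n+m (k * suc c) c) (ℕₚ.∸-monoˡ-≤ 1 b)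

-- Exponential polynomials

pow : ℚ → ℕ → ℚ
pow c zero    = 1ℚ
pow c (suc n) = c *ℚ pow c n

binom : ℕ → ℕ → ℚ
binom b       zero    = 1ℚ
binom zero    (suc i) = 0ℚ
binom (suc b) (suc i) = binom b i +ℚ binom b (suc i)

-- Complete homogeneous symmetric polynomial of degree b in the entries of cs.
hom : ℕ → List ℤ → ℚ
hom zero    cs       = 1ℚ
hom (suc b) []       = 0ℚ
hom (suc b) (c ∷ cs) = ι c *ℚ hom b (c ∷ cs) +ℚ hom (suc b) cs

expBinom : ℤ → ℕ → ℕ → ℚ
expBinom c i b = binom b i *ℚ pow (ι c) b

-- `m c` is a strict bound on the degree of the polynomial multiplying c^b. Binomials replace powers
-- of b because the step from b to b + 1 adds just binom(b, i) to binom(b, i+1), so first-order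
-- recurrences can be solved term by term.
data ExpPoly (m : ℤ → ℕ) : (ℕ → ℚ) → Set where
  nil   : ExpPoly m (λ _ → 0ℚ)
  basis : ∀ c i → c ≢ 0ℤ → i < m c → ExpPoly m (expBinom c i)
  comb  : ∀ α β {f g} → ExpPoly m f → ExpPoly m g → ExpPoly m (λ b → α *ℚ f b +ℚ β *ℚ g b)
  equiv : ∀ {f g} → f ≗ g → ExpPoly m f → ExpPoly m g

ExpPoly-subspace : ∀ m → Subspace (ExpPoly m)
ExpPoly-subspace m = record { E-resp = equiv ; E-lin = comb }

ExpPoly-mono : ∀ {m m'} → (∀ c → m c ≤ m' c) → ∀ {f} → ExpPoly m f → ExpPoly m' f
ExpPoly-mono le nil               = nil
ExpPoly-mono le (basis c i ne lt) = basis c i ne (ℕₚ.≤-trans lt (le c))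
ExpPoly-mono le (comb α β p q)    = comb α β (ExpPoly-mono le p) (ExpPoly-mono le q)
ExpPoly-mono le (equiv e p)       = equiv e (ExpPoly-mono le p)

ι≢0 : ∀ {c} → c ≢ 0ℤ → ι c ≢ 0ℚ
ι≢0 ne e = ne (ι-injective (trans e (sym (ι-fromℕ 0))))

module _ {m m' : ℤ → ℕ} (le : ∀ c → m c ≤ m' c) {c : ℤ} (c≢0 : c ≢ 0ℤ) (lt : m c < m' c) where

  Solution : (ℕ → ℚ) → Set
  Solution v = ∃[ z ] (ExpPoly m' z × (∀ b → z (suc b) ≡ ι c *ℚ z b +ℚ v b))

  -- The resonant case: the solution c^(b-1)·binom(b, i+1) has degree one higher, which is why
  -- `m' c` must exceed `m c`.
  solve-same : ∀ i → i < m c → Solution (expBinom c i)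
  solve-same i i<m with r , cr ← *-inverse (ι c) (ι≢0 c≢0) =
    (λ b → r *ℚ expBinom c (suc i) b) ,
    Subspace.E-scale (ExpPoly-subspace m') r (basis c (suc i) c≢0 (ℕₚ.≤-trans (s≤s i<m) lt)) ,
    λ b → trans (ring (ι c) r (binom b i) (binom b (suc i)) (pow (ι c) b))
            (trans (cong (λ z → ι c *ℚ (r *ℚ expBinom c (suc i) b) +ℚ z *ℚ expBinom c i b) cr)
                   (ring' (ι c *ℚ (r *ℚ expBinom c (suc i) b)) (expBinom c i b)))
    where
      ring : ∀ c r x y p → r *ℚ ((x +ℚ y) *ℚ (c *ℚ p)) ≡ c *ℚ (r *ℚ (y *ℚ p)) +ℚ (c *ℚ r) *ℚ (x *ℚ p)
      ring = solve-∀ ℚ-ring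
      ring' : ∀ x y → x +ℚ 1ℚ *ℚ y ≡ x +ℚ y
      ring' = solve-∀ ℚ-ring

  -- Without resonance the degree does not grow. Applied to e^b·binom(b, i+1), shift minus c gives e
  -- - c times the same function plus e times the one for i, and the latter is removed by induction
  -- on i.
  solve-other : ∀ e → e ≢ 0ℤ → e ≢ c → ∀ i → i < m e → Solution (expBinom e i)
  solve-other e e≢0 e≢c i i<m = from-inverse (*-inverse (ι e -ℚ ι c) (λ z → e≢c (ι-injective (x-y≡0⇒x≡y _ _ z)))) i i<m
    where
      from-inverse : ∃[ r ] (ι e -ℚ ι c) *ℚ r ≡ 1ℚ → ∀ i → i < m e → Solution (expBinom e i)
      from-inverse (r , er) zero i<m =
        (λ b → r *ℚ expBinom e 0 b) , Subspace.E-scale (ExpPoly-subspace m') r (basis e 0 e≢0 (ℕₚ.≤-trans i<m (le e))) ,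
        λ b → trans (ring (ι e) (ι c) r (pow (ι e) b))
          (cong (λ z → ι c *ℚ (r *ℚ expBinom e 0 b) +ℚ z *ℚ pow (ι e) b) er)
        where ring : ∀ e c r p → r *ℚ (1ℚ *ℚ (e *ℚ p)) ≡ c *ℚ (r *ℚ (1ℚ *ℚ p)) +ℚ ((e -ℚ c) *ℚ r) *ℚ p
              ring = solve-∀ ℚ-ring
      from-inverse (r , er) (suc i) i<m with z , Ez , zeq ← from-inverse (r , er) i (ℕₚ.<-trans ℕₚ.≤-refl i<m) =
        (λ b → r *ℚ (1ℚ *ℚ expBinom e (suc i) b +ℚ (ℚ.- ι e) *ℚ z b)) ,
        Subspace.E-scale (ExpPoly-subspace m') r (comb 1ℚ (ℚ.- ι e) (basis e (suc i) e≢0 (ℕₚ.≤-trans i<m (le e))) Ez) ,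
        λ b → trans (cong (λ z → r *ℚ (1ℚ *ℚ expBinom e (suc i) (suc b) +ℚ (ℚ.- ι e) *ℚ z)) (zeq b))
          (trans (ring (ι e) (ι c) r (pow (ι e) b) (binom b i) (binom b (suc i)) (z b))
            (trans (cong (λ y → ι c *ℚ (r *ℚ (1ℚ *ℚ expBinom e (suc i) b +ℚ (ℚ.- ι e) *ℚ z b)) +ℚ y *ℚ expBinom e (suc i) b) er)
                   (ring' (ι c *ℚ (r *ℚ (1ℚ *ℚ expBinom e (suc i) b +ℚ (ℚ.- ι e) *ℚ z b))) (expBinom e (suc i) b))))
        where ring : ∀ e c r p x y z → r *ℚ (1ℚ *ℚ ((x +ℚ y) *ℚ (e *ℚ p)) +ℚ (ℚ.- e) *ℚ (c *ℚ z +ℚ x *ℚ p))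
                   ≡ c *ℚ (r *ℚ (1ℚ *ℚ (y *ℚ p) +ℚ (ℚ.- e) *ℚ z)) +ℚ ((e -ℚ c) *ℚ r) *ℚ (y *ℚ p)
              ring = solve-∀ ℚ-ring
              ring' : ∀ x y → x +ℚ 1ℚ *ℚ y ≡ x +ℚ y
              ring' = solve-∀ ℚ-ring

  solve : ∀ {v} → ExpPoly m v → Solution v
  solve nil = (λ _ → 0ℚ) , nil , λ b → ring (ι c)
    where ring : ∀ c → 0ℚ ≡ c *ℚ 0ℚ +ℚ 0ℚ
          ring = solve-∀ ℚ-ring
  solve (basis e i e≢0 i<m) with e ℤₚ.≟ c
  ... | yes refl = solve-same i i<m
  ... | no e≢c   = solve-other e e≢0 e≢c i i<m
  solve (comb α β {f} {g} p q) with z , Ez , zeq ← solve p | y , Ey , yeq ← solve q =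
    (λ b → α *ℚ z b +ℚ β *ℚ y b) , comb α β Ez Ey ,
    λ b → trans (cong₂ (λ s t → α *ℚ s +ℚ β *ℚ t) (zeq b) (yeq b)) (ring α β (ι c) (z b) (y b) (f b) (g b))
    where ring : ∀ α β c z y f g → α *ℚ (c *ℚ z +ℚ f) +ℚ β *ℚ (c *ℚ y +ℚ g) ≡ c *ℚ (α *ℚ z +ℚ β *ℚ y) +ℚ (α *ℚ f +ℚ β *ℚ g)
          ring = solve-∀ ℚ-ring
  solve (equiv e p) with z , Ez , zeq ← solve p = z , Ez , λ b → trans (zeq b) (cong (ι c *ℚ z b +ℚ_) (e b))

  -- If z(b+1) = c z(b) + v(b), then w = v + c z satisfies w(b+1) = c w(b) + v(b+1).
  recurrence : ∀ {u v} → ExpPoly m v → (∀ b → u (suc b) ≡ ι c *ℚ u b +ℚ v (suc b)) → ExpPoly m' u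
  recurrence {u} {v} Ev ueq = conclude (solve Ev)
    where
      conclude : Solution v → ExpPoly m' u
      conclude (z , Ez , zeq) = equiv sum (comb 1ℚ (u 0 -ℚ w 0) (comb 1ℚ (ι c) (ExpPoly-mono le Ev) Ez)
        (basis c 0 c≢0 (ℕₚ.≤-trans (s≤s z≤n) lt)))
        where
          w = λ b → 1ℚ *ℚ v b +ℚ ι c *ℚ z b
          difference : ∀ b → u b -ℚ w b ≡ (u 0 -ℚ w 0) *ℚ pow (ι c) b
          difference zero    = sym (ℚₚ.*-identityʳ _)
          difference (suc b) = trans (cong₂ (λ p q → p -ℚ (1ℚ *ℚ v (suc b) +ℚ ι c *ℚ q)) (ueq b) (zeq b))
            (trans (ring (ι c) (u b) (v (suc b)) (z b) (v b)) (trans (cong (ι c *ℚ_) (difference b))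
              (ring' (ι c) (u 0 -ℚ w 0) (pow (ι c) b))))
            where ring : ∀ c u v' z v → (c *ℚ u +ℚ v') -ℚ (1ℚ *ℚ v' +ℚ c *ℚ (c *ℚ z +ℚ v)) ≡ c *ℚ (u -ℚ (1ℚ *ℚ v +ℚ c *ℚ z))
                  ring = solve-∀ ℚ-ring
                  ring' : ∀ c x p → c *ℚ (x *ℚ p) ≡ x *ℚ (c *ℚ p)
                  ring' = solve-∀ ℚ-ring
          sum : ∀ b → 1ℚ *ℚ w b +ℚ (u 0 -ℚ w 0) *ℚ expBinom c 0 b ≡ u b
          sum b = trans (cong (1ℚ *ℚ w b +ℚ_) (trans (ring' (u 0 -ℚ w 0) (pow (ι c) b)) (sym (difference b)))) (ring (w b) (u b))
            where ring : ∀ w u → 1ℚ *ℚ w +ℚ (u -ℚ w) ≡ u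
                  ring = solve-∀ ℚ-ring
                  ring' : ∀ x p → x *ℚ (1ℚ *ℚ p) ≡ x *ℚ p
                  ring' = solve-∀ ℚ-ring

-- Adjoining c means solving u(b+1) = c u(b) + v(b+1), which raises the degree allowed at c by one.
-- Adjoining 0 changes nothing in positive degrees, hence the shift to degree b + 1.
hom-expPoly : ∀ cs → ExpPoly (λ a → count a cs) (λ b → hom (suc b) cs)
hom-expPoly [] = nil
hom-expPoly (c ∷ cs) with c ℤₚ.≟ 0ℤ
... | yes refl = equiv (λ b → sym (trans (cong (λ z → z *ℚ hom b (0ℤ ∷ cs) +ℚ hom (suc b) cs) (ι-fromℕ 0))
                                   (ring (hom b (0ℤ ∷ cs)) (hom (suc b) cs))))
                   (ExpPoly-mono (λ a → count-mono a 0ℤ cs) (hom-expPoly cs))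
  where ring : ∀ x y → 0ℚ *ℚ x +ℚ y ≡ y
        ring = solve-∀ ℚ-ring
... | no c≢0 = recurrence (λ a → count-mono a c cs) c≢0 (ℕₚ.≤-reflexive (sym (count-yes cs refl)))
                 (hom-expPoly cs) (λ b → refl)

ι-suc : ∀ n → ι (pos (suc n)) ≡ ι (pos n) +ℚ 1ℚ
ι-suc n = trans (cong ι (trans (cong pos (ℕₚ.+-comm 1 n)) (ℤₚ.pos-+ n 1))) (trans (ι-+ (pos n) 1ℤ) (cong (ι (pos n) +ℚ_) (ι-fromℕ 1)))

binom-absorb : ∀ b i → ι (pos (suc i)) *ℚ binom b (suc i) ≡ (ι (pos b) -ℚ ι (pos i)) *ℚ binom b i
binom-absorb zero zero = trans (ℚₚ.*-zeroʳ (ι (pos 1))) (sym (trans (cong (_*ℚ 1ℚ) (x-x≡0 (ι (pos 0)))) (ℚₚ.*-zeroˡ 1ℚ)))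
binom-absorb zero (suc i) = trans (ℚₚ.*-zeroʳ (ι (pos (suc (suc i))))) (sym (ℚₚ.*-zeroʳ (ι (pos 0) -ℚ ι (pos (suc i)))))
binom-absorb (suc b) zero = trans (ring (ι (pos 1)) (binom b 1)) (trans (cong (ι (pos 1) *ℚ 1ℚ +ℚ_) (binom-absorb b 0))
    (trans (ring' (ι (pos 1)) (ι (pos b)) (ι (pos 0))) (cong (λ z → (z -ℚ ι (pos 0)) *ℚ 1ℚ)
      (trans (cong (ι (pos b) +ℚ_) (ι-fromℕ 1)) (sym (ι-suc b))))))
  where ring : ∀ x y → x *ℚ (1ℚ +ℚ y) ≡ x *ℚ 1ℚ +ℚ x *ℚ y
        ring = solve-∀ ℚ-ring
        ring' : ∀ x y z → x *ℚ 1ℚ +ℚ (y -ℚ z) *ℚ 1ℚ ≡ ((y +ℚ x) -ℚ z) *ℚ 1ℚ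
        ring' = solve-∀ ℚ-ring
binom-absorb (suc b) (suc i) = begin
  I″ *ℚ (x +ℚ y)                               ≡⟨ ring I″ x y ⟩
  I″ *ℚ x +ℚ I″ *ℚ y                           ≡⟨ cong₂ (λ p q → p *ℚ x +ℚ q) (ι-suc (suc i)) (binom-absorb b (suc i)) ⟩
  (I′ +ℚ 1ℚ) *ℚ x +ℚ (B -ℚ I′) *ℚ x            ≡⟨ ring′ I′ B x ⟩
  I′ *ℚ x +ℚ ((B +ℚ 1ℚ) -ℚ I′) *ℚ x            ≡⟨ cong₂ (λ p q → p +ℚ (q -ℚ I′) *ℚ x) (binom-absorb b i) (sym (ι-suc b)) ⟩
  (B -ℚ I) *ℚ w +ℚ (B′ -ℚ I′) *ℚ x             ≡⟨ cong (λ z → z *ℚ w +ℚ (B′ -ℚ I′) *ℚ x) (trans (ring‴ B I) (sym (cong₂ _-ℚ_ (ι-suc b) (ι-suc i)))) ⟩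
  (B′ -ℚ I′) *ℚ w +ℚ (B′ -ℚ I′) *ℚ x           ≡⟨ ring (B′ -ℚ I′) w x ⟨
  (B′ -ℚ I′) *ℚ (w +ℚ x)                       ∎
  where
    open ≡-Reasoning
    B = ι (pos b)
    B′ = ι (pos (suc b))
    I = ι (pos i)
    I′ = ι (pos (suc i))
    I″ = ι (pos (suc (suc i)))
    w = binom b i
    x = binom b (suc i)
    y = binom b (suc (suc i))
    ring : ∀ c x y → c *ℚ (x +ℚ y) ≡ c *ℚ x +ℚ c *ℚ y
    ring = solve-∀ ℚ-ring
    ring′ : ∀ i b x → (i +ℚ 1ℚ) *ℚ x +ℚ (b -ℚ i) *ℚ x ≡ i *ℚ x +ℚ ((b +ℚ 1ℚ) -ℚ i) *ℚ x
    ring′ = solve-∀ ℚ-ring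
    ring‴ : ∀ b i → b -ℚ i ≡ (b +ℚ 1ℚ) -ℚ (i +ℚ 1ℚ)
    ring‴ = solve-∀ ℚ-ring

-- By (i+1) binom(b,i+1) = ((b+1) − (i+1)) binom(b,i).
module _ {Φ : (ℕ → ℚ) → Set} (sub : Subspace Φ) (c : ℚ) (M : ℕ)
         (powers : ∀ j → j < M → Φ (λ b → pow (ι (pos (suc b))) j *ℚ pow c b)) where
  open Subspace sub

  power-binom : ∀ i j → i + j < M → Φ (λ b → pow (ι (pos (suc b))) j *ℚ (binom b i *ℚ pow c b))
  power-binom zero j lt = E-resp (λ b → cong (pow (ι (pos (suc b))) j *ℚ_) (sym (ℚₚ.*-identityˡ (pow c b)))) (powers j lt)
  power-binom (suc i) j lt = conclude (*-inverse I (ι≢0 {pos (suc i)} (λ ())))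
    where
      I = ι (pos (suc i))
      conclude : ∃[ r ] I *ℚ r ≡ 1ℚ → Φ (λ b → pow (ι (pos (suc b))) j *ℚ (binom b (suc i) *ℚ pow c b))
      conclude (r , Ir) = E-resp (λ b → trans
          (ring r (ι (pos (suc b))) I (pow (ι (pos (suc b))) j) (binom b i) (pow c b))
          (trans (cong (λ z → r *ℚ (pow (ι (pos (suc b))) j *ℚ (z *ℚ pow c b))) (sym (absorb b)))
            (trans (ring' r I (pow (ι (pos (suc b))) j) (binom b (suc i)) (pow c b))
              (trans (cong (_*ℚ (pow (ι (pos (suc b))) j *ℚ (binom b (suc i) *ℚ pow c b))) Ir) (ℚₚ.*-identityˡ _)))))
        (E-lin r (ℚ.- (r *ℚ I)) (power-binom i (suc j) (subst (_< M) (sym (ℕₚ.+-suc i j)) lt)) (power-binom i j (ℕₚ.<-trans ℕₚ.≤-refl lt)))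
        where
          absorb : ∀ b → I *ℚ binom b (suc i) ≡ (ι (pos (suc b)) -ℚ I) *ℚ binom b i
          absorb b = trans (binom-absorb b i) (cong (_*ℚ binom b i) (trans (ring″ (ι (pos b)) (ι (pos i))) (sym (cong₂ _-ℚ_ (ι-suc b) (ι-suc i)))))
            where ring″ : ∀ b i → b -ℚ i ≡ (b +ℚ 1ℚ) -ℚ (i +ℚ 1ℚ)
                  ring″ = solve-∀ ℚ-ring
          ring : ∀ r B I P x q → r *ℚ ((B *ℚ P) *ℚ (x *ℚ q)) +ℚ (ℚ.- (r *ℚ I)) *ℚ (P *ℚ (x *ℚ q)) ≡ r *ℚ (P *ℚ (((B -ℚ I) *ℚ x) *ℚ q))
          ring = solve-∀ ℚ-ring
          ring' : ∀ r I P x q → r *ℚ (P *ℚ ((I *ℚ x) *ℚ q)) ≡ (I *ℚ r) *ℚ (P *ℚ (x *ℚ q))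
          ring' = solve-∀ ℚ-ring

-- A change of basis from binomials in b to powers of b + 1, the variable in which the final formula
-- is written.
ExpPoly-elim : ∀ {Φ : (ℕ → ℚ) → Set} {m} → Subspace Φ → Φ (λ _ → 0ℚ) →
  (∀ c → c ≢ 0ℤ → ∀ j → j < m c → Φ (λ b → pow (ι (pos (suc b))) j *ℚ pow (ι c) b)) →
  ∀ {f} → ExpPoly m f → Φ f
ExpPoly-elim sub z p nil = z
ExpPoly-elim {m = m} sub z p (basis c i c≢0 lt) = Subspace.E-resp sub (λ b → ℚₚ.*-identityˡ (expBinom c i b))
  (power-binom sub (ι c) (m c) (p c c≢0) i 0 (subst (_< m c) (sym (ℕₚ.+-identityʳ i)) lt))
ExpPoly-elim sub z p (comb α β u v) = Subspace.E-lin sub α β (ExpPoly-elim sub z p u) (ExpPoly-elim sub z p v)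
ExpPoly-elim sub z p (equiv e u) = Subspace.E-resp sub e (ExpPoly-elim sub z p u)

-- The shape of the final formula

sumFrom-cong : ∀ a n {f g} → (∀ i → f i ≡ g i) → sumFrom a n f ≡ sumFrom a n g
sumFrom-cong a zero    e = refl
sumFrom-cong a (suc n) e = cong₂ _+ℚ_ (e a) (sumFrom-cong (suc a) n e)

sumFrom-lin : ∀ a n α β f g → sumFrom a n (λ i → α *ℚ f i +ℚ β *ℚ g i) ≡ α *ℚ sumFrom a n f +ℚ β *ℚ sumFrom a n g
sumFrom-lin a zero    α β f g = ring α β
  where ring : ∀ α β → 0ℚ ≡ α *ℚ 0ℚ +ℚ β *ℚ 0ℚ
        ring = solve-∀ ℚ-ring
sumFrom-lin a (suc n) α β f g = trans (cong (α *ℚ f a +ℚ β *ℚ g a +ℚ_) (sumFrom-lin (suc a) n α β f g))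
                                      (ring α β (f a) (g a) (sumFrom (suc a) n f) (sumFrom (suc a) n g))
  where ring : ∀ α β x y z w → (α *ℚ x +ℚ β *ℚ y) +ℚ (α *ℚ z +ℚ β *ℚ w) ≡ α *ℚ (x +ℚ z) +ℚ β *ℚ (y +ℚ w)
        ring = solve-∀ ℚ-ring

sumFrom-zero : ∀ a n {f} → (∀ i → a ≤ i → f i ≡ 0ℚ) → sumFrom a n f ≡ 0ℚ
sumFrom-zero a zero    e = refl
sumFrom-zero a (suc n) e = cong₂ _+ℚ_ (e a ℕₚ.≤-refl) (sumFrom-zero (suc a) n (λ i l → e i (ℕₚ.<⇒≤ l)))

δ : ℕ → ℕ → ℚ
δ i j with i ℕ.≟ j
... | yes _ = 1ℚ
... | no _  = 0ℚ

δ-same : ∀ i → δ i i ≡ 1ℚ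
δ-same i with i ℕ.≟ i
... | yes _ = refl
... | no n  = ⊥-elim (n refl)

δ-distinct : ∀ {i j} → i ≢ j → δ i j ≡ 0ℚ
δ-distinct {i} {j} n with i ℕ.≟ j
... | yes e = ⊥-elim (n e)
... | no _  = refl

sumFrom-δ : ∀ a n k (f : ℕ → ℚ) → a ≤ k → k < a + n → sumFrom a n (λ i → δ i k *ℚ f i) ≡ f k
sumFrom-δ a zero    k f l u = ⊥-elim (ℕₚ.<-irrefl refl (ℕₚ.≤-trans (s≤s l) (subst (k <_) (ℕₚ.+-identityʳ a) u)))
sumFrom-δ a (suc n) k f l u = go (a ℕ.≟ k)
  where
    go : Dec (a ≡ k) → δ a k *ℚ f a +ℚ sumFrom (suc a) n (λ i → δ i k *ℚ f i) ≡ f k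
    go (yes refl) = trans (cong₂ _+ℚ_ (trans (cong (_*ℚ f a) (δ-same a)) (ℚₚ.*-identityˡ (f a)))
      (sumFrom-zero (suc a) n (λ i a<i → trans (cong (_*ℚ f i) (δ-distinct {i} {a} (λ { refl → ℕₚ.<-irrefl refl a<i }))) (ℚₚ.*-zeroˡ (f i)))))
      (ℚₚ.+-identityʳ (f a))
    go (no a≢k) = trans (cong₂ _+ℚ_ (trans (cong (_*ℚ f a) (δ-distinct a≢k)) (ℚₚ.*-zeroˡ (f a)))
      (sumFrom-δ (suc a) n k f (ℕₚ.≤∧≢⇒< l a≢k) (subst (k <_) (ℕₚ.+-suc a n) u)))
      (ℚₚ.+-identityˡ (f k))

ι-^ : ∀ m n → ι (pos (m ^ n)) ≡ pow (ι (pos m)) n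
ι-^ m zero    = ι-fromℕ 1
ι-^ m (suc n) = trans (cong ι (ℤₚ.pos-* m (m ^ n))) (trans (ι-* (pos m) (pos (m ^ n))) (cong (ι (pos m) *ℚ_) (ι-^ m n)))

-- A sequence f is indexed so that f b is the value at b + 1. The identity is only required for b + 1 of a fixed
-- parity: this merges the exponentials of k and of −k.
module NormalForm (n : ℕ) (ε : ℚ) where

  term : ℕ → ℕ → ℕ → ℚ
  term b k i = fromℕ (suc b ^ (i ∸ 1) * k ^ suc b)

  expansion : (ℕ → ℕ → ℚ) → ℕ → ℚ
  expansion C b = sumTo n (λ k → sumTo (floorDiv n k) (λ i → C k i *ℚ term b k i))

  Normal : (ℕ → ℚ) → Set
  Normal f = Σ[ C ∈ (ℕ → ℕ → ℚ) ] (∀ b → pow (ℚ.- 1ℚ) (suc b) ≡ ε → f b ≡ expansion C b)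

  expansion-lin : ∀ α β C D b → expansion (λ k i → α *ℚ C k i +ℚ β *ℚ D k i) b ≡ α *ℚ expansion C b +ℚ β *ℚ expansion D b
  expansion-lin α β C D b = trans
    (sumFrom-cong 1 n (λ k → trans (sumFrom-cong 1 (floorDiv n k) (λ i → ring α β (C k i) (D k i) (term b k i)))
      (sumFrom-lin 1 (floorDiv n k) α β (λ i → C k i *ℚ term b k i) (λ i → D k i *ℚ term b k i))))
    (sumFrom-lin 1 n α β (λ k → sumTo (floorDiv n k) (λ i → C k i *ℚ term b k i)) (λ k → sumTo (floorDiv n k) (λ i → D k i *ℚ term b k i)))
    where ring : ∀ α β c d t → (α *ℚ c +ℚ β *ℚ d) *ℚ t ≡ α *ℚ (c *ℚ t) +ℚ β *ℚ (d *ℚ t)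
          ring = solve-∀ ℚ-ring

  Normal-subspace : Subspace Normal
  Normal-subspace = record
    { E-resp = λ { e (C , p) → C , λ b s → trans (sym (e b)) (p b s) }
    ; E-lin  = λ { α β (C , p) (D , q) → (λ k i → α *ℚ C k i +ℚ β *ℚ D k i) ,
                   λ b s → trans (cong₂ (λ x y → α *ℚ x +ℚ β *ℚ y) (p b s) (q b s)) (sym (expansion-lin α β C D b)) }
    }
  open Subspace Normal-subspace

  Normal-zero : Normal (λ _ → 0ℚ)
  Normal-zero = (λ _ _ → 0ℚ) , λ b _ → sym (sumFrom-zero 1 n (λ k _ → sumFrom-zero 1 (floorDiv n k) (λ i _ → ℚₚ.*-zeroˡ (term b k i))))

  Normal-term : ∀ k j → 1 ≤ k → suc j * k ≤ n → Normal (λ b → term b k (suc j))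
  Normal-term k j 1≤k bound = (λ k' i → δ k' k *ℚ δ i (suc j)) , λ b _ → sym (begin
    expansion (λ k' i → δ k' k *ℚ δ i (suc j)) b
      ≡⟨ sumFrom-cong 1 n (λ k' → trans (sumFrom-cong 1 (floorDiv n k') (λ i → ring (δ k' k) (δ i (suc j)) (term b k' i)))
           (trans (sumFrom-lin 1 (floorDiv n k') (δ k' k) 0ℚ (λ i → δ i (suc j) *ℚ term b k' i) (λ i → δ i (suc j) *ℚ term b k' i))
             (sym (ring′ (δ k' k) (sumTo (floorDiv n k') (λ i → δ i (suc j) *ℚ term b k' i)))))) ⟩
    sumTo n (λ k' → δ k' k *ℚ sumTo (floorDiv n k') (λ i → δ i (suc j) *ℚ term b k' i))
      ≡⟨ sumFrom-δ 1 n k (λ k' → sumTo (floorDiv n k') (λ i → δ i (suc j) *ℚ term b k' i)) 1≤k (s≤s (ℕₚ.≤-trans (ℕₚ.m≤m+n k (j * k)) bound)) ⟩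
    sumTo (floorDiv n k) (λ i → δ i (suc j) *ℚ term b k i)
      ≡⟨ sumFrom-δ 1 (floorDiv n k) (suc j) (term b k) (s≤s z≤n) (s≤s (floor 1≤k bound)) ⟩
    term b k (suc j) ∎)
    where
      open ≡-Reasoning
      ring : ∀ x y t → (x *ℚ y) *ℚ t ≡ x *ℚ (y *ℚ t) +ℚ 0ℚ *ℚ (y *ℚ t)
      ring = solve-∀ ℚ-ring
      ring′ : ∀ x y → x *ℚ y ≡ x *ℚ y +ℚ 0ℚ *ℚ y
      ring′ = solve-∀ ℚ-ring
      floor : ∀ {k} → 1 ≤ k → suc j * k ≤ n → suc j ≤ floorDiv n k
      floor {suc k} _ b = subst (_≤ n DivMod./ suc k) (DivMod.m*n/n≡m (suc j) (suc k)) (DivMod./-monoˡ-≤ (suc k) b)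

  term-product : ∀ b k j → term b k (suc j) ≡ pow (ι (pos (suc b))) j *ℚ pow (ι (pos k)) (suc b)
  term-product b k j = trans (sym (ι-fromℕ (suc b ^ j * k ^ suc b))) (trans (cong ι (ℤₚ.pos-* (suc b ^ j) (k ^ suc b)))
    (trans (ι-* (pos (suc b ^ j)) (pos (k ^ suc b))) (cong₂ _*ℚ_ (ι-^ (suc b) j) (ι-^ k (suc b)))))

  pow-neg : ∀ c b → pow (ι (ℤ.- c)) b ≡ pow (ℚ.- 1ℚ) b *ℚ pow (ι c) b
  pow-neg c zero    = refl
  pow-neg c (suc b) = trans (cong₂ _*ℚ_ negated (pow-neg c b)) (ring (ι c) (pow (ℚ.- 1ℚ) b) (pow (ι c) b))
    where ring : ∀ c x y → (ℚ.- 1ℚ *ℚ c) *ℚ (x *ℚ y) ≡ (ℚ.- 1ℚ *ℚ x) *ℚ (c *ℚ y)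
          ring = solve-∀ ℚ-ring
          ring′ : ∀ z c → z ≡ (z +ℚ c) +ℚ (ℚ.- 1ℚ) *ℚ c
          ring′ = solve-∀ ℚ-ring
          negated : ι (ℤ.- c) ≡ (ℚ.- 1ℚ) *ℚ ι c
          negated = trans (ring′ (ι (ℤ.- c)) (ι c)) (trans (cong (_+ℚ (ℚ.- 1ℚ) *ℚ ι c)
            (trans (sym (ι-+ (ℤ.- c) c)) (trans (cong ι (ℤₚ.+-inverseˡ c)) (ι-fromℕ 0)))) (ℚₚ.+-identityˡ _))

  -- One factor c is supplied to pass from c^b to c^(b+1), and divided out again. For negative c the
  -- sign (-1)^(b+1) is the constant ε on the parity considered, so the term becomes one for the
  -- absolute value of c.
  Normal-power : ∀ c j → c ≢ 0ℤ → suc j * ℤ.∣ c ∣ ≤ n → Normal (λ b → pow (ι (pos (suc b))) j *ℚ pow (ι c) b)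
  Normal-power c j c≢0 bound = from-inverse (*-inverse (ι c) (ι≢0 c≢0))
    where
      sign : ∀ c → c ≢ 0ℤ → suc j * ℤ.∣ c ∣ ≤ n → Normal (λ b → pow (ι (pos (suc b))) j *ℚ pow (ι c) (suc b))
      sign (pos zero)    c≢0 l = ⊥-elim (c≢0 refl)
      sign (pos (suc k)) _ l = E-resp (λ b → term-product b (suc k) j) (Normal-term (suc k) j (s≤s z≤n) l)
      sign (-[1+ k ]) _ l = restrict (E-scale ε (Normal-term (suc k) j (s≤s z≤n) l))
        where
          K = ι (pos (suc k))
          ring : ∀ x e y → x *ℚ (e *ℚ y) ≡ e *ℚ (x *ℚ y)
          ring = solve-∀ ℚ-ring
          restrict : Normal (λ b → ε *ℚ term b (suc k) (suc j)) → Normal (λ b → pow (ι (pos (suc b))) j *ℚ pow (ι (-[1+ k ])) (suc b))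
          restrict (C , p) = C , λ b s → trans
            (cong (pow (ι (pos (suc b))) j *ℚ_) (trans (pow-neg (pos (suc k)) (suc b)) (cong (_*ℚ pow K (suc b)) s)))
            (trans (ring (pow (ι (pos (suc b))) j) ε (pow K (suc b)))
              (trans (cong (ε *ℚ_) (sym (term-product b (suc k) j))) (p b s)))
      from-inverse : ∃[ r ] ι c *ℚ r ≡ 1ℚ → Normal (λ b → pow (ι (pos (suc b))) j *ℚ pow (ι c) b)
      from-inverse (r , cr) = E-resp (λ b → trans (ring r (ι c) (pow (ι (pos (suc b))) j) (pow (ι c) b))
          (trans (cong (_*ℚ (pow (ι (pos (suc b))) j *ℚ pow (ι c) b)) cr) (ℚₚ.*-identityˡ _)))
        (E-scale r (sign c c≢0 bound))
        where ring : ∀ r c x y → r *ℚ (x *ℚ (c *ℚ y)) ≡ (c *ℚ r) *ℚ (x *ℚ y)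
              ring = solve-∀ ℚ-ring

  hom-normal : ∀ cs → (∀ c → c ≢ 0ℤ → ℤ.∣ c ∣ * count c cs ≤ n) → Normal (λ b → hom (suc b) cs)
  hom-normal cs bound = ExpPoly-elim Normal-subspace Normal-zero
    (λ c c≢0 j lt → Normal-power c j c≢0 (ℕₚ.≤-trans (ℕₚ.≤-trans (ℕₚ.*-monoˡ-≤ ℤ.∣ c ∣ lt)
      (ℕₚ.≤-reflexive (ℕₚ.*-comm (count c cs) ℤ.∣ c ∣))) (bound c c≢0)))
    (hom-expPoly cs)

-- The multiplicity bound across colour classes

count-++ : ∀ a xs ys → count a (xs ++ ys) ≡ count a xs + count a ys
count-++ a []       ys = refl
count-++ a (x ∷ xs) ys with x ℤₚ.≟ a
... | yes _ = cong suc (count-++ a xs ys)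
... | no _  = count-++ a xs ys

count-↭ : ∀ a {xs ys} → xs ↭ ys → count a xs ≡ count a ys
count-↭ a ↭.refl = refl
count-↭ a (↭.prep x p) with x ℤₚ.≟ a
... | yes _ = cong suc (count-↭ a p)
... | no _  = count-↭ a p
count-↭ a {_ ∷ _ ∷ xs} {_ ∷ _ ∷ ys} (↭.swap x y p) = trans (count-++ a (x ∷ y ∷ []) xs) (trans (cong₂ _+_ (flip (x ℤₚ.≟ a) (y ℤₚ.≟ a)) (count-↭ a p))
  (sym (count-++ a (y ∷ x ∷ []) ys)))
  where
    flip : Dec (x ≡ a) → Dec (y ≡ a) → count a (x ∷ y ∷ []) ≡ count a (y ∷ x ∷ [])
    flip (yes p) (yes q) = cong₂ (λ x y → count a (x ∷ y ∷ [])) (trans p (sym q)) (trans q (sym p))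
    flip (yes p) (no q)  = trans (trans (count-yes (y ∷ []) p) (cong suc (count-no [] q))) (sym (trans (count-no (x ∷ []) q) (count-yes [] p)))
    flip (no p)  (yes q) = trans (trans (count-no (y ∷ []) p) (count-yes [] q)) (sym (trans (count-yes (x ∷ []) q) (cong suc (count-no [] p))))
    flip (no p)  (no q)  = trans (trans (count-no (y ∷ []) p) (count-no [] q)) (sym (trans (count-no (x ∷ []) q) (count-no [] p)))
count-↭ a (↭.trans p q) = trans (count-↭ a p) (count-↭ a q)

𝟙 : {P : Set} → Dec P → ℚ
𝟙 D = if does D then 1ℚ else 0ℚ

𝟙-yes : {P : Set} (D : Dec P) → P → 𝟙 D ≡ 1ℚ
𝟙-yes (yes _) p = refl
𝟙-yes (no n)  p = ⊥-elim (n p)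

𝟙-no : {P : Set} (D : Dec P) → ¬ P → 𝟙 D ≡ 0ℚ
𝟙-no (yes p) n = ⊥-elim (n p)
𝟙-no (no _)  n = refl

𝟙-⇔ : {P Q : Set} (D : Dec P) (D' : Dec Q) → (P → Q) → (Q → P) → 𝟙 D ≡ 𝟙 D'
𝟙-⇔ (yes p) D' f g = sym (𝟙-yes D' (f p))
𝟙-⇔ (no n)  D' f g = sym (𝟙-no D' (n ∘ g))

𝟙-× : {P Q : Set} (D : Dec P) (D' : Dec Q) → 𝟙 (D ×-dec D') ≡ 𝟙 D *ℚ 𝟙 D'
𝟙-× (yes p) D' = sym (ℚₚ.*-identityˡ (𝟙 D'))
𝟙-× (no n)  D' = sym (ℚₚ.*-zeroˡ (𝟙 D'))

Σ-filter : {A : Set} {P : A → Set} (P? : Decidable P) (xs : List A) (h : A → ℚ) →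
           Σℚ (filter P? xs) h ≡ Σℚ xs (λ x → 𝟙 (P? x) *ℚ h x)
Σ-filter P? []       h = refl
Σ-filter P? (x ∷ xs) h = go (P? x) refl
  where
    go : (D : Dec _) → P? x ≡ D → Σℚ (filter P? (x ∷ xs)) h ≡ 𝟙 (P? x) *ℚ h x +ℚ Σℚ xs (λ x → 𝟙 (P? x) *ℚ h x)
    go (yes p) e = trans (cong (λ l → Σℚ l h) (Listₚ.filter-accept P? p))
      (cong₂ _+ℚ_ (sym (trans (cong (_*ℚ h x) (𝟙-yes (P? x) p)) (ℚₚ.*-identityˡ (h x)))) (Σ-filter P? xs h))
    go (no n) e = trans (cong (λ l → Σℚ l h) (Listₚ.filter-reject P? n)) (trans (Σ-filter P? xs h)
      (sym (trans (cong (_+ℚ Σℚ xs (λ x → 𝟙 (P? x) *ℚ h x)) (trans (cong (_*ℚ h x) (𝟙-no (P? x) n)) (ℚₚ.*-zeroˡ (h x)))) (ℚₚ.+-identityˡ _))))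

Σ-cartesianProductWith : {A B C : Set} (g : A → B → C) (xs : List A) (ys : List B) (h : C → ℚ) →
  Σℚ (Data.List.cartesianProductWith g xs ys) h ≡ Σℚ xs (λ x → Σℚ ys (λ y → h (g x y)))
Σ-cartesianProductWith g []       ys h = refl
Σ-cartesianProductWith g (x ∷ xs) ys h = trans (Σ-++ (map (g x) ys) _ h)
  (cong₂ _+ℚ_ (Σ-map (g x) ys h) (Σ-cartesianProductWith g xs ys h))

filter-split-↭ : {A : Set} {P : A → Set} (P? : Decidable P) (xs : List A) → xs ↭ filter P? xs ++ filter (¬? ∘ P?) xs
filter-split-↭ P? [] = ↭.refl
filter-split-↭ P? (x ∷ xs) with P? x
... | yes _ = ↭.prep x (filter-split-↭ P? xs)
... | no _  = ↭.trans (↭.prep x (filter-split-↭ P? xs)) (↭.↭-sym (↭ₚ.shift x (filter P? xs) (filter (¬? ∘ P?) xs)))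

filter-filter : {A : Set} {P Q : A → Set} (P? : Decidable P) (Q? : Decidable Q) → (∀ x → P x → Q x) →
                ∀ xs → filter P? (filter Q? xs) ≡ filter P? xs
filter-filter P? Q? sub [] = refl
filter-filter P? Q? sub (x ∷ xs) with Q? x
... | yes _ with P? x
...   | yes _ = cong (x ∷_) (filter-filter P? Q? sub xs)
...   | no _  = filter-filter P? Q? sub xs
filter-filter P? Q? sub (x ∷ xs) | no n = trans (filter-filter P? Q? sub xs) (sym (Listₚ.filter-reject P? (n ∘ sub x)))

AllPairs-reverse : {A : Set} {R : A → A → Set} (xs : List A) → AllPairs R xs → AllPairs (λ x y → R y x) (reverse xs)
AllPairs-reverse []       _        = []
AllPairs-reverse {R = R} (x ∷ xs) (px ∷ pxs) = subst (AllPairs (λ x y → R y x)) (sym (Listₚ.unfold-reverse x xs))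
  (AllPairsₚ.++⁺ (AllPairs-reverse xs pxs) ([] ∷ [])
    (All.tabulate (λ m → All.lookup px (↭ₚ.∈-resp-↭ (↭ₚ.↭-reverse xs) m) ∷ [])))

class : ∀ {d} → (Fin d → Fin d) → Fin d → List (Fin d) → List (Fin d)
class χ p = filter (λ x → χ x Finₚ.≟ p)

module _ {d : ℕ} (χ : Fin d → Fin d) (c : Fin d → ℤ) (k : ℕ) (a : ℤ) where

  Bounded : List (Fin d) → Set
  Bounded xs = k * count a (map c xs) ≤ length xs ∸ 1

  ∸1-superadditive : ∀ m n → (m ∸ 1) + (n ∸ 1) ≤ m + n ∸ 1
  ∸1-superadditive zero    n = ℕₚ.≤-refl
  ∸1-superadditive (suc m) n = ℕₚ.+-monoʳ-≤ m (ℕₚ.m∸n≤m n 1)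

  Bounded-++ : ∀ xs ys → Bounded xs → Bounded ys → Bounded (xs ++ ys)
  Bounded-++ xs ys p q = ℕₚ.≤-trans (ℕₚ.≤-reflexive (trans
      (cong (λ l → k * count a l) (Listₚ.map-++ c xs ys))
      (trans (cong (k *_) (count-++ a (map c xs) (map c ys))) (ℕₚ.*-distribˡ-+ k (count a (map c xs)) (count a (map c ys))))))
    (ℕₚ.≤-trans (ℕₚ.+-mono-≤ p q) (ℕₚ.≤-trans (∸1-superadditive (length xs) (length ys))
      (ℕₚ.≤-reflexive (cong (_∸ 1) (sym (Listₚ.length-++ xs))))))

  Bounded-↭ : ∀ {xs ys} → xs ↭ ys → Bounded xs → Bounded ys
  Bounded-↭ p b = ℕₚ.≤-trans (ℕₚ.≤-reflexive (cong (k *_) (sym (count-↭ a (↭ₚ.map⁺ c p)))))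
                     (ℕₚ.≤-trans b (ℕₚ.≤-reflexive (cong (_∸ 1) (↭ₚ.↭-length p))))

  -- Multiplicities add over the classes, while each class gives up one point in its bound; the sum
  -- is therefore at most the total length minus one.
  Bounded-classes : ∀ ps → Unique ps → ∀ xs → (∀ {x} → x ∈ xs → χ x ∈ ps) → (∀ {p} → p ∈ ps → Bounded (class χ p xs)) → Bounded xs
  Bounded-classes [] u [] cov b = ℕₚ.≤-reflexive (ℕₚ.*-zeroʳ k)
  Bounded-classes [] u (x ∷ xs) cov b with () ← cov (here refl)
  Bounded-classes (p ∷ ps) (p∉ ∷ u) xs cov b = Bounded-↭ (↭.↭-sym (filter-split-↭ (λ x → χ x Finₚ.≟ p) xs))
    (Bounded-++ (class χ p xs) rest (b (here refl)) (Bounded-classes ps u rest covers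
      (λ {q} m → subst Bounded (sym (filter-filter (λ x → χ x Finₚ.≟ q) (λ x → ¬? (χ x Finₚ.≟ p))
        (λ { x refl e → All.lookup p∉ m (sym e) }) xs)) (b (there m)))))
    where
      rest = filter (λ x → ¬? (χ x Finₚ.≟ p)) xs
      covers : ∀ {x} → x ∈ rest → χ x ∈ ps
      covers m with x∈ , ne ← ∈ₚ.∈-filter⁻ (λ x → ¬? (χ x Finₚ.≟ p)) {xs = xs} m with cov x∈
      ... | here e   = ⊥-elim (ne e)
      ... | there m' = m'

-- Monotone sequences and sums over colour-preserving ones

module Chains (d : ℕ) where

  descending : List (Fin d)
  descending = reverse (allFin d)

  descending-sorted : AllPairs (λ x y → y Fin.< x) descending
  descending-sorted = AllPairs-reverse (allFin d) (AllPairsₚ.tabulate⁺-< id)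

  ∈-descending : ∀ x → x ∈ descending
  ∈-descending x = ↭ₚ.∈-resp-↭ (↭.↭-sym (↭ₚ.↭-reverse (allFin d))) (∈ₚ.∈-allFin x)

  descending-unique : Unique descending
  descending-unique = AllPairs.map (λ { y<x refl → ℕₚ.<-irrefl refl y<x }) descending-sorted

  below : Fin d → List (Fin d)
  below k = filter (Finₚ._<? k) descending

  below-split : ∀ P {x D} → descending ≡ P ++ x ∷ D → below x ≡ D
  below-split P {x} {D} e = trans (cong (filter (Finₚ._<? x)) e) (go P (subst (AllPairs _) e descending-sorted))
    where
      go : ∀ P → AllPairs (λ x y → y Fin.< x) (P ++ x ∷ D) → filter (Finₚ._<? x) (P ++ x ∷ D) ≡ D
      go [] (lt ∷ _) = trans (Listₚ.filter-reject (Finₚ._<? x) (ℕₚ.<-irrefl refl)) (Listₚ.filter-all (Finₚ._<? x) lt)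
      go (y ∷ P) (lt ∷ s) = trans (Listₚ.filter-reject (Finₚ._<? x) (ℕₚ.<-asym (All.lookup lt (∈ₚ.∈-++⁺ʳ P (here refl))))) (go P s)

  below-< : ∀ {a k} → a ∈ below k → a Fin.< k
  below-< {a} {k} m = proj₂ (∈ₚ.∈-filter⁻ (Finₚ._<? k) {xs = descending} m)

  <-below : ∀ {a k} → a Fin.< k → a ∈ below k
  <-below {a} {k} lt = ∈ₚ.∈-filter⁺ (Finₚ._<? k) (∈-descending a) lt

  -- Sequences of b transpositions (a,k), a < k, whose larger entries k lie in ks and occur in the order of ks.
  monos : ∀ b → List (Fin d) → List (Vec (Fin d × Fin d) b)
  monos zero    ks       = [] ∷ []
  monos (suc b) []       = []
  monos (suc b) (k ∷ ks) = Data.List.cartesianProductWith (λ a ts → (a , k) ∷ ts) (below k) (monos b (k ∷ ks)) ++ monos (suc b) ks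

  module Coloured (χ : Fin d → Fin d) (ε : ℚ) where
    open JucysMurphy d
    open NormalForm (d ∸ 1) ε

    same? : ∀ k → Decidable (λ a → χ a ≡ χ k)
    same? k a = χ a Finₚ.≟ χ k

    heads : Fin d → List (Fin d)
    heads k = filter (same? k) (below k)

    J : Fin d → Operator Word
    J k = JM k (heads k)

    heads-unique : ∀ k → Unique (heads k)
    heads-unique k = Uniqueₚ.filter⁺ (same? k) (Uniqueₚ.filter⁺ (Finₚ._<? k) descending-unique)

    ∈-heads⁻ : ∀ {a k} → a ∈ heads k → a Fin.< k × χ a ≡ χ k
    ∈-heads⁻ {a} {k} m with m' , e ← ∈ₚ.∈-filter⁻ (same? k) {xs = below k} m = below-< m' , e

    ∈-heads⁺ : ∀ {a k} → a Fin.< k → χ a ≡ χ k → a ∈ heads k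
    ∈-heads⁺ {a} {k} lt e = ∈ₚ.∈-filter⁺ (same? k) (<-below lt) e

    heads-∉ : ∀ k → Unique (k ∷ heads k)
    heads-∉ k = All.tabulate (λ m e → ℕₚ.<-irrefl (cong toℕ (sym e)) (proj₁ (∈-heads⁻ m))) ∷ heads-unique k

    -- A summand (a b) of `J b` joins two points of one colour, both below z. It therefore permutes
    -- `heads z`, whether or not that colour is the one of z.
    J-commute-< : ∀ {b z} → b Fin.< z → Commute (J z) (J b)
    J-commute-< {b} {z} b<z = JM-commute (heads-unique z) preserves
      where
        preserves : ∀ a → a ∈ heads b → Preserves (a , b) z (heads z)
        preserves a m = swap-other (λ { refl → ℕₚ.<-asym a<b b<z }) (λ { refl → ℕₚ.<-irrefl refl b<z }) ,
          λ {c} m' → swap-cases (λ x y → x ∈ heads z → y ∈ heads z)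
            (λ a∈ → ∈-heads⁺ b<z (trans (sym χab) (proj₂ (∈-heads⁻ a∈))))
            (λ b∈ → ∈-heads⁺ (ℕₚ.<-trans a<b b<z) (trans χab (proj₂ (∈-heads⁻ b∈)))) (λ _ _ → id) c m'
          where a<b = proj₁ (∈-heads⁻ m)
                χab = proj₂ (∈-heads⁻ m)

    J-commute : ∀ b z → Commute (J z) (J b)
    J-commute b z f w with ℕₚ.<-cmp (toℕ b) (toℕ z)
    ... | Relation.Binary.tri< lt _ _ = J-commute-< lt f w
    ... | Relation.Binary.tri≈ _ e _ with refl ← Finₚ.toℕ-injective e = refl
    ... | Relation.Binary.tri> _ _ gt = sym (J-commute-< gt f w)

    word₀ : Word
    word₀ = tabulate id

    -- This is h_b of the operators `J k`, applied to f and evaluated at the identity. It follows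
    -- the recursion of both `monos` and `hom`, and so links sums over sequences with eigenvalues.
    W : ℕ → List (Fin d) → (Word → ℚ) → ℚ
    W zero    ks       f = f word₀
    W (suc b) []       f = 0ℚ
    W (suc b) (k ∷ ks) f = W b (k ∷ ks) (J k ∙ f) +ℚ W (suc b) ks f

    W-resp : ∀ b ks {f g} → f ≗ g → W b ks f ≡ W b ks g
    W-resp zero    ks       e = e word₀
    W-resp (suc b) []       e = refl
    W-resp (suc b) (k ∷ ks) e = cong₂ _+ℚ_ (W-resp b (k ∷ ks) (resp (J k) e)) (W-resp (suc b) ks e)

    W-lin : ∀ b ks α β f g → W b ks (λ w → α *ℚ f w +ℚ β *ℚ g w) ≡ α *ℚ W b ks f +ℚ β *ℚ W b ks g
    W-lin zero    ks       α β f g = refl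
    W-lin (suc b) []       α β f g = ring α β
      where ring : ∀ α β → 0ℚ ≡ α *ℚ 0ℚ +ℚ β *ℚ 0ℚ
            ring = solve-∀ ℚ-ring
    W-lin (suc b) (k ∷ ks) α β f g = trans
      (cong₂ _+ℚ_ (trans (W-resp b (k ∷ ks) (lin (J k) α β f g)) (W-lin b (k ∷ ks) α β (J k ∙ f) (J k ∙ g))) (W-lin (suc b) ks α β f g))
      (ring α β (W b (k ∷ ks) (J k ∙ f)) (W b (k ∷ ks) (J k ∙ g)) (W (suc b) ks f) (W (suc b) ks g))
      where ring : ∀ α β x y z w → (α *ℚ x +ℚ β *ℚ y) +ℚ (α *ℚ z +ℚ β *ℚ w) ≡ α *ℚ (x +ℚ z) +ℚ β *ℚ (y +ℚ w)
            ring = solve-∀ ℚ-ring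

    W-scale : ∀ b ks α f → W b ks (λ w → α *ℚ f w) ≡ α *ℚ W b ks f
    W-scale b ks α f = trans (W-resp b ks (λ w → ring α (f w))) (trans (W-lin b ks α 0ℚ f f) (sym (ring α (W b ks f))))
      where ring : ∀ α x → α *ℚ x ≡ α *ℚ x +ℚ 0ℚ *ℚ x
            ring = solve-∀ ℚ-ring

    W-eigen : ∀ b ks (c : Fin d → ℤ) f → (∀ k → Eigen (J k) (ι (c k)) f) → W b ks f ≡ f word₀ *ℚ hom b (map c ks)
    W-eigen zero    ks       c f e = sym (ℚₚ.*-identityʳ (f word₀))
    W-eigen (suc b) []       c f e = sym (ℚₚ.*-zeroʳ (f word₀))
    W-eigen (suc b) (k ∷ ks) c f e = trans
      (cong₂ _+ℚ_ (trans (W-resp b (k ∷ ks) (e k)) (trans (W-scale b (k ∷ ks) (ι (c k)) f)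
        (cong (ι (c k) *ℚ_) (W-eigen b (k ∷ ks) c f e)))) (W-eigen (suc b) ks c f e))
      (ring (ι (c k)) (f word₀) (hom b (map c (k ∷ ks))) (hom (suc b) (map c ks)))
      where ring : ∀ c x y z → c *ℚ (x *ℚ y) +ℚ x *ℚ z ≡ x *ℚ (c *ℚ y +ℚ z)
            ring = solve-∀ ℚ-ring

    respects : ∀ {b} → Vec (Fin d × Fin d) b → ℚ
    respects []             = 1ℚ
    respects ((a , k) ∷ ts) = 𝟙 (same? k a) *ℚ respects ts

    word : ∀ {b} → Vec (Fin d × Fin d) b → Word
    word ts = tabulate (prodT ts)

    -- The first transposition (a, k) is the outermost factor of the product, so summing over its a
    -- replaces f by `J k ∙ f` at the product of the rest.
    W-sum : ∀ b ks f → Σℚ (monos b ks) (λ ts → respects ts *ℚ f (word ts)) ≡ W b ks f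
    W-sum zero    ks       f = trans (ℚₚ.+-identityʳ (1ℚ *ℚ f word₀)) (ℚₚ.*-identityˡ (f word₀))
    W-sum (suc b) []       f = refl
    W-sum (suc b) (k ∷ ks) f = trans
      (Σ-++ (Data.List.cartesianProductWith (λ a ts → (a , k) ∷ ts) (below k) (monos b (k ∷ ks))) (monos (suc b) ks) h)
      (cong₂ _+ℚ_ (trans first-part (W-sum b (k ∷ ks) (J k ∙ f))) (W-sum (suc b) ks f))
      where
        open ≡-Reasoning
        h : Vec (Fin d × Fin d) (suc b) → ℚ
        h ts = respects ts *ℚ f (word ts)
        ring : ∀ x y z → (x *ℚ y) *ℚ z ≡ y *ℚ (x *ℚ z)
        ring = solve-∀ ℚ-ring
        word-∷ : ∀ a (ts : Vec (Fin d × Fin d) b) → word ((a , k) ∷ ts) ≡ swapW (a , k) (word ts)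
        word-∷ a ts = Vecₚ.tabulate-∘ (swap (a , k)) (prodT ts)
        first-part : Σℚ (Data.List.cartesianProductWith (λ a ts → (a , k) ∷ ts) (below k) (monos b (k ∷ ks))) h
                   ≡ Σℚ (monos b (k ∷ ks)) (λ ts → respects ts *ℚ (J k ∙ f) (word ts))
        first-part = begin
          _ ≡⟨ Σ-cartesianProductWith (λ a ts → (a , k) ∷ ts) (below k) (monos b (k ∷ ks)) h ⟩
          Σℚ (below k) (λ a → Σℚ (monos b (k ∷ ks)) (λ ts → h ((a , k) ∷ ts))) ≡⟨ Σ-comm (below k) (monos b (k ∷ ks)) (λ a ts → h ((a , k) ∷ ts)) ⟩
          Σℚ (monos b (k ∷ ks)) (λ ts → Σℚ (below k) (λ a → h ((a , k) ∷ ts))) ≡⟨ Σ-cong (monos b (k ∷ ks)) (λ ts →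
              trans (Σ-cong (below k) (λ a → trans (ring (𝟙 (same? k a)) (respects ts) (f (word ((a , k) ∷ ts))))
                  (cong (λ w → respects ts *ℚ (𝟙 (same? k a) *ℚ f w)) (word-∷ a ts))))
                (trans (Σ-* (below k) (respects ts) (λ a → 𝟙 (same? k a) *ℚ f (swapW (a , k) (word ts))))
                  (cong (respects ts *ℚ_) (sym (Σ-filter (same? k) (below k) (λ a → f (swapW (a , k) (word ts)))))))) ⟩
          Σℚ (monos b (k ∷ ks)) (λ ts → respects ts *ℚ (J k ∙ f) (word ts)) ∎

    chain-joint : ∀ p (c : Fin d → ℤ) f → (∀ k → Eigen (J k) (ι (c k)) f) →
      ∀ P D → descending ≡ P ++ D → Joint (class χ p D) (map c (class χ p D)) f
    chain-joint p c f e P []      eq = tt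
    chain-joint p c f e P (x ∷ D) eq with χ x Finₚ.≟ p
    ... | yes refl = subst (λ L → Eigen (JM x L) (ι (c x)) f) (cong (filter (same? x)) (below-split P eq)) (e x) ,
                     chain-joint p c f e (P ++ x ∷ []) D (trans eq (sym (Listₚ.++-assoc P (x ∷ []) D)))
    ... | no _ = chain-joint p c f e (P ++ x ∷ []) D (trans eq (sym (Listₚ.++-assoc P (x ∷ []) D)))

    content-bound-ℤ : ∀ a w → ¬ Bad w → ℤ.∣ a ∣ * count a w ≤ length w ∸ 1
    content-bound-ℤ (pos k) w nb with content-bound (inj₁ refl) k w
    ... | inj₁ B = ⊥-elim (nb B)
    ... | inj₂ l = subst (λ z → k * count z w ≤ length w ∸ 1) (ℤₚ.*-identityʳ (pos k)) l
    content-bound-ℤ (-[1+ k ]) w nb with content-bound (inj₂ refl) (suc k) w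
    ... | inj₁ B = ⊥-elim (nb B)
    ... | inj₂ l = subst (λ z → suc k * count z w ≤ length w ∸ 1) (trans (ℤₚ.*-comm (pos (suc k)) (ℤ.- 1ℤ)) (ℤₚ.-1*i≡-i (pos (suc k)))) l

    joint-bound : ∀ (c : Fin d → ℤ) f → (∀ k → Eigen (J k) (ι (c k)) f) → ¬ Vanishes f →
                  ∀ a → ℤ.∣ a ∣ * count a (map c (allFin d)) ≤ d ∸ 1
    joint-bound c f e nv a = subst (λ n → ℤ.∣ a ∣ * count a (map c (allFin d)) ≤ n ∸ 1) {length (allFin d)} {d} (Listₚ.length-tabulate {n = d} id)
      (Bounded-↭ χ c ℤ.∣ a ∣ a (↭ₚ.↭-reverse (allFin d))
        (Bounded-classes χ c ℤ.∣ a ∣ a (allFin d) (Uniqueₚ.allFin⁺ d) descending (λ _ → ∈ₚ.∈-allFin _) (λ {p} _ →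
          subst (λ n → ℤ.∣ a ∣ * count a (map c (class χ p descending)) ≤ n ∸ 1) (Listₚ.length-map c (class χ p descending))
            (content-bound-ℤ a (map c (class χ p descending)) (λ B → nv (OkounkovVershik.bad-vanishes d B (class χ p descending) f
              (Uniqueₚ.filter⁺ (λ x → χ x Finₚ.≟ p) descending-unique) (chain-joint p c f e [] descending refl)))))))

    vanishes? : ∀ f → Dec (Vanishes f)
    vanishes? f = map′ (λ a w → All.lookup a (words-complete w)) (λ z → All.tabulate (λ {w} _ → z w))
                       (All.all? (λ w → f w ℚₚ.≟ 0ℚ) words)

    Good : (Word → ℚ) → Set
    Good f = Normal (λ b → W (suc b) (allFin d) f)

    Good-+ : ∀ {f g} → Good f → Good g → Good (λ w → f w +ℚ g w)
    Good-+ {f} {g} p q = Subspace.E-resp Normal-subspace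
      (λ b → sym (trans (W-resp (suc b) (allFin d) (λ w → ring (f w) (g w))) (W-lin (suc b) (allFin d) 1ℚ 1ℚ f g)))
      (Subspace.E-lin Normal-subspace 1ℚ 1ℚ p q)
      where ring : ∀ a b → a +ℚ b ≡ 1ℚ *ℚ a +ℚ 1ℚ *ℚ b
            ring = solve-∀ ℚ-ring

    Good-resp : ∀ {f g} → f ≗ g → Good f → Good g
    Good-resp e = Subspace.E-resp Normal-subspace (λ b → W-resp (suc b) (allFin d) e)

    Good-vanishing : ∀ {f} → Vanishes f → Good f
    Good-vanishing {f} z = Subspace.E-resp Normal-subspace (λ b → sym (trans
      (W-resp (suc b) (allFin d) (λ w → trans (z w) (sym (ℚₚ.*-zeroˡ (f w)))))
      (trans (W-scale (suc b) (allFin d) 0ℚ f) (ℚₚ.*-zeroˡ (W (suc b) (allFin d) f))))) Normal-zero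

    Good-joint : ∀ (c : Fin d → ℤ) f → (∀ k → Eigen (J k) (ι (c k)) f) → Good f
    Good-joint c f e = go (vanishes? f)
      where
        go : Dec (Vanishes f) → Good f
        -- The zero vector is an eigenvector for any numbers whatsoever, so the bound on contents is
        -- available only for nonzero f.
        go (yes z) = Good-vanishing z
        go (no nz) = Subspace.E-resp Normal-subspace (λ b → sym (W-eigen (suc b) (allFin d) c f e))
          (Subspace.E-scale Normal-subspace (f word₀) (hom-normal (map c (allFin d)) (λ a _ → joint-bound c f e nz a)))

    -- The operators are diagonalised one at a time. `E` carries the eigenvalue conditions imposed
    -- so far; it stays invariant because the operators commute, and each further splitting takes
    -- place inside it.
    simultaneous : ∀ ks {E} → Subspace E → (∀ k {f} → E f → E (J k ∙ f)) →
      (∀ f → E f → (∀ k → k ∈ ks → ∃[ c ] Eigen (J k) (ι c) f) → Good f) → ∀ f → E f → Good f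
    simultaneous [] sub inv base f Ef = base f Ef (λ k ())
    simultaneous (k ∷ ks) {E} sub inv base f Ef =
      sum (Decomposes-killed sub (J k) (JM-symmetric k (heads k)) (inv k) f Ef (JM-decomposes k (heads k) (heads-∉ k) f))
      where
        ring : ∀ p q → q +ℚ (p -ℚ q) ≡ p
        ring = solve-∀ ℚ-ring
        component : ∀ c v → E v → Eigen (J k) (ι c) v → Good v
        component c v Ev Jv = simultaneous ks {λ f → E f × Eigen (J k) (ι c) f}
          (record { E-resp = λ { e (p , q) → Subspace.E-resp sub e p , Subspace.E-resp (Eigen-subspace (J k) (ι c)) e q }
                  ; E-lin  = λ { α β (p , q) (p' , q') → Subspace.E-lin sub α β p p' , Subspace.E-lin (Eigen-subspace (J k) (ι c)) α β q q' } })
          (λ { j (p , q) → inv j p , Eigen-commute {S = J j} {T = J k} (ι c) (J-commute j k) q })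
          (λ { f (p , q) rest → base f p (λ { _ (here refl) → c , q ; j (there m) → rest j m }) })
          v (Ev , Jv)
        sum : ∀ {f} → Decomposes E (J k) f → Good f
        sum (none z) = Good-vanishing z
        sum {f} (more c v Ev Jv D) = Good-resp (λ w → ring (f w) (v w)) (Good-+ (component c v Ev Jv) (sum D))

    coloured-normal : ∀ f → Normal (λ b → Σℚ (monos (suc b) (allFin d)) (λ ts → respects ts *ℚ f (word ts)))
    coloured-normal f = Subspace.E-resp Normal-subspace (λ b → sym (W-sum (suc b) (allFin d) f))
      (simultaneous (allFin d) Everything-subspace (λ _ _ → tt)
        (λ f _ e → Good-joint (λ k → proj₁ (e k (∈ₚ.∈-allFin k))) f (λ k → proj₂ (e k (∈ₚ.∈-allFin k)))) f tt)

-- Components and the inversion from colourings to connected sequences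

Σ-δ : {A : Set} (_≟_ : (x y : A) → Dec (x ≡ y)) {xs : List A} → Unique xs → ∀ {a} → a ∈ xs → ∀ (h : A → ℚ) →
      Σℚ xs (λ x → 𝟙 (a ≟ x) *ℚ h x) ≡ h a
Σ-δ _≟_ {x ∷ xs} (x∉ ∷ u) {a} (here refl) h = trans (cong₂ _+ℚ_
  (trans (cong (_*ℚ h a) (𝟙-yes (a ≟ a) refl)) (ℚₚ.*-identityˡ (h a)))
  (Σ-zero xs (λ y m → trans (cong (_*ℚ h y) (𝟙-no (a ≟ y) (All.lookup x∉ m))) (ℚₚ.*-zeroˡ (h y))))) (ℚₚ.+-identityʳ (h a))
Σ-δ _≟_ {x ∷ xs} (x∉ ∷ u) {a} (there m) h = trans (cong₂ _+ℚ_
  (trans (cong (_*ℚ h x) (𝟙-no (a ≟ x) (λ { refl → All.lookup x∉ m refl }))) (ℚₚ.*-zeroˡ (h x))) (Σ-δ _≟_ u m h)) (ℚₚ.+-identityˡ (h a))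

vec-ext : {A : Set} {n : ℕ} {v w : Vec A n} → (∀ i → lookup v i ≡ lookup w i) → v ≡ w
vec-ext {v = v} {w} e = trans (sym (Vecₚ.tabulate∘lookup v)) (trans (Vecₚ.tabulate-cong e) (Vecₚ.tabulate∘lookup w))

-- The components of the graph on Fin d whose edges are the given transpositions: every point is sent to the
-- least point of its component.
module Components (d : ℕ) where

  Edges : ℕ → Set
  Edges b = Vec (Fin d × Fin d) b

  replace : Fin d → Fin d → Fin d → Fin d
  replace p q x with x Finₚ.≟ p
  ... | yes _ = q
  ... | no _  = x

  replace-same : ∀ p q → replace p q p ≡ q
  replace-same p q with p Finₚ.≟ p
  ... | yes _ = refl
  ... | no n  = ⊥-elim (n refl)

  replace-target : ∀ p q → replace p q q ≡ q
  replace-target p q with q Finₚ.≟ p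
  ... | yes _ = refl
  ... | no _  = refl

  replace-cases : ∀ p q x → replace p q x ≡ x ⊎ (x ≡ p × replace p q x ≡ q)
  replace-cases p q x with x Finₚ.≟ p
  ... | yes e = inj₂ (e , refl)
  ... | no _  = inj₁ refl

  join : Fin d → Fin d → Fin d → Fin d
  join p q with toℕ p ℕ.≤? toℕ q
  ... | yes _ = replace q p
  ... | no _  = replace p q

  join-identifies : ∀ p q → join p q p ≡ join p q q
  join-identifies p q with toℕ p ℕ.≤? toℕ q
  ... | yes _ = trans (replace-target q p) (sym (replace-same q p))
  ... | no _  = trans (replace-same p q) (sym (replace-target p q))

  join-cases : ∀ p q x → join p q x ≡ x ⊎ (x ≡ p × join p q x ≡ q) ⊎ (x ≡ q × join p q x ≡ p)
  join-cases p q x with toℕ p ℕ.≤? toℕ q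
  join-cases p q x | yes _ with replace-cases q p x
  ... | inj₁ e = inj₁ e
  ... | inj₂ e = inj₂ (inj₂ e)
  join-cases p q x | no _ with replace-cases p q x
  ... | inj₁ e = inj₁ e
  ... | inj₂ e = inj₂ (inj₁ e)

  join-≤ : ∀ p q x → join p q x Fin.≤ x
  join-≤ p q x with toℕ p ℕ.≤? toℕ q
  join-≤ p q x | yes p≤q with replace-cases q p x
  ... | inj₁ e = ℕₚ.≤-reflexive (cong toℕ e)
  ... | inj₂ (refl , e) = subst (Fin._≤ x) (sym e) p≤q
  join-≤ p q x | no p≰q with replace-cases p q x
  ... | inj₁ e = ℕₚ.≤-reflexive (cong toℕ e)
  ... | inj₂ (refl , e) = subst (Fin._≤ x) (sym e) (ℕₚ.<⇒≤ (ℕₚ.≰⇒> p≰q))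

  comp : ∀ {b} → Edges b → Vec (Fin d) d
  comp []             = tabulate id
  comp ((a , k) ∷ ts) = Vec.map (join (lookup (comp ts) a) (lookup (comp ts) k)) (comp ts)

  comp-∷ : ∀ {b} a k (ts : Edges b) x →
    lookup (comp ((a , k) ∷ ts)) x ≡ join (lookup (comp ts) a) (lookup (comp ts) k) (lookup (comp ts) x)
  comp-∷ a k ts x = Vecₚ.lookup-map x _ (comp ts)

  Monochromatic : ∀ {b} → (Fin d → Fin d) → Edges b → Set
  Monochromatic χ = VecAll.All (λ t → χ (proj₁ t) ≡ χ (proj₂ t))

  comp-monochromatic : ∀ {b} (ts : Edges b) → Monochromatic (lookup (comp ts)) ts
  comp-monochromatic []             = VecAll.[]
  comp-monochromatic ((a , k) ∷ ts) =
    trans (comp-∷ a k ts a) (trans (join-identifies (lookup (comp ts) a) (lookup (comp ts) k)) (sym (comp-∷ a k ts k))) VecAll.∷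
    VecAll.map (λ {t} e → trans (comp-∷ a k ts (proj₁ t)) (trans (cong (join (lookup (comp ts) a) (lookup (comp ts) k)) e) (sym (comp-∷ a k ts (proj₂ t)))))
               (comp-monochromatic ts)

  -- Labels arise only by merging along edges, so they stay within any equivalence relation
  -- containing the edges. It is applied to equality of colours and to mutual reachability.
  comp-related : (R : Fin d → Fin d → Set) → (∀ {x} → R x x) → (∀ {x y} → R x y → R y x) →
    (∀ {x y z} → R x y → R y z → R x z) →
    ∀ {b} (ts : Edges b) → VecAll.All (λ t → R (proj₁ t) (proj₂ t)) ts → ∀ x → R x (lookup (comp ts) x)
  comp-related R r s t [] VecAll.[] x = subst (R x) (sym (Vecₚ.lookup∘tabulate id x)) r
  comp-related R r s t ((a , k) ∷ ts) (ak VecAll.∷ all) x =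
    subst (R x) (sym (comp-∷ a k ts x)) (go (join-cases (lookup (comp ts) a) (lookup (comp ts) k) (lookup (comp ts) x)))
    where
      IH : ∀ x → R x (lookup (comp ts) x)
      IH = comp-related R r s t ts all
      π = lookup (comp ts)
      go : join (π a) (π k) (π x) ≡ π x ⊎ (π x ≡ π a × join (π a) (π k) (π x) ≡ π k) ⊎ (π x ≡ π k × join (π a) (π k) (π x) ≡ π a) →
           R x (join (π a) (π k) (π x))
      go (inj₁ e) = subst (R x) (sym e) (IH x)
      go (inj₂ (inj₁ (e , e'))) = subst (R x) (sym e') (t (IH x) (t (subst (R (π x)) e r) (t (s (IH a)) (t ak (IH k)))))
      go (inj₂ (inj₂ (e , e'))) = subst (R x) (sym e') (t (IH x) (t (subst (R (π x)) e r) (t (s (IH k)) (t (s ak) (IH a)))))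

  Deflationary : Vec (Fin d) d → Set
  Deflationary π = ∀ i → lookup π i Fin.≤ i

  comp-deflationary : ∀ {b} (ts : Edges b) → Deflationary (comp ts)
  comp-deflationary []             i = ℕₚ.≤-reflexive (cong toℕ (Vecₚ.lookup∘tabulate id i))
  comp-deflationary ((a , k) ∷ ts) i = subst (Fin._≤ i) (sym (comp-∷ a k ts i))
    (ℕₚ.≤-trans (join-≤ (lookup (comp ts) a) (lookup (comp ts) k) (lookup (comp ts) i)) (comp-deflationary ts i))

  _≟W_ : (v w : Vec (Fin d) d) → Dec (v ≡ w)
  _≟W_ = Vecₚ.≡-dec Finₚ._≟_

  -- For a component map π this says that the colouring v is constant on components. For v = π it is
  -- idempotence.
  Compatible : (v π : Vec (Fin d) d) → Set
  Compatible v π = ∀ i → lookup v (lookup π i) ≡ lookup v i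

  compatible? : ∀ v π → Dec (Compatible v π)
  compatible? v π = Finₚ.all? (λ i → lookup v (lookup π i) Finₚ.≟ lookup v i)

  compatible-comp : ∀ v {b} (ts : Edges b) → Monochromatic (lookup v) ts → Compatible v (comp ts)
  compatible-comp v ts m i = sym (comp-related (λ x y → lookup v x ≡ lookup v y) refl sym trans ts m i)

  comp-compatible : ∀ v {b} (ts : Edges b) → Compatible v (comp ts) → Monochromatic (lookup v) ts
  comp-compatible v ts c = VecAll.map (λ {t} e → trans (sym (c (proj₁ t))) (trans (cong (lookup v) e) (c (proj₂ t)))) (comp-monochromatic ts)

  weight : ∀ {n} → Vec (Fin d) n → ℕ
  weight []      = 0
  weight (x ∷ v) = toℕ x + weight v

  weight-mono : ∀ {n} (v w : Vec (Fin d) n) → (∀ i → lookup v i Fin.≤ lookup w i) → weight v ≤ weight w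
  weight-mono []      []      le = z≤n
  weight-mono (x ∷ v) (y ∷ w) le = ℕₚ.+-mono-≤ (le Fin.zero) (weight-mono v w (le ∘ Fin.suc))

  weight-strict : ∀ {n} (v w : Vec (Fin d) n) → (∀ i → lookup v i Fin.≤ lookup w i) → v ≢ w → weight v < weight w
  weight-strict []      []      le ne = ⊥-elim (ne refl)
  weight-strict (x ∷ v) (y ∷ w) le ne with x Finₚ.≟ y
  ... | yes refl = ℕₚ.+-monoʳ-< (toℕ x) (weight-strict v w (le ∘ Fin.suc) (λ { refl → ne refl }))
  ... | no x≢y = ℕₚ.+-mono-<-≤ (ℕₚ.≤∧≢⇒< (le Fin.zero) (x≢y ∘ Finₚ.toℕ-injective)) (weight-mono v w (le ∘ Fin.suc))

  weight-bound : ∀ {n} (v : Vec (Fin d) n) → weight v ≤ n * d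
  weight-bound []      = z≤n
  weight-bound (x ∷ v) = ℕₚ.+-mono-≤ (ℕₚ.<⇒≤ (Finₚ.toℕ<n x)) (weight-bound v)

  module Counts (ε : ℚ) (f : Vec (Fin d) d → ℚ) where
    open Chains d
    open JucysMurphy d
    open NormalForm (d ∸ 1) ε
    open Coloured using (respects; coloured-normal; same?)

    wordOf : ∀ {b} → Edges b → Word
    wordOf ts = tabulate (prodT ts)

    exact : Word → ℕ → ℚ
    exact π b = Σℚ (monos (suc b) (allFin d)) (λ ts → 𝟙 (comp ts ≟W π) *ℚ f (wordOf ts))

    coloured : Word → ℕ → ℚ
    coloured v b = Σℚ (monos (suc b) (allFin d)) (λ ts → respects (lookup v) ε ts *ℚ f (wordOf ts))

    respects-𝟙 : ∀ χ {b} (ts : Edges b) (D : Dec (Monochromatic χ ts)) → respects χ ε ts ≡ 𝟙 D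
    respects-𝟙 χ []             D = sym (𝟙-yes D VecAll.[])
    respects-𝟙 χ ((a , k) ∷ ts) D = trans (cong (𝟙 (same? χ ε k a) *ℚ_) (respects-𝟙 χ ts D'))
      (trans (sym (𝟙-× (same? χ ε k a) D')) (𝟙-⇔ (same? χ ε k a ×-dec D') D (λ { (p , q) → p VecAll.∷ q }) (λ { (p VecAll.∷ q) → p , q })))
      where D' = VecAll.all? (λ t → χ (proj₁ t) Finₚ.≟ χ (proj₂ t)) ts

    respects-compatible : ∀ v {b} (ts : Edges b) → respects (lookup v) ε ts ≡ 𝟙 (compatible? v (comp ts))
    respects-compatible v ts = trans (respects-𝟙 (lookup v) ts D)
      (𝟙-⇔ D (compatible? v (comp ts)) (compatible-comp v ts) (comp-compatible v ts))
      where D = VecAll.all? (λ t → lookup v (proj₁ t) Finₚ.≟ lookup v (proj₂ t)) ts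

    -- The sequences are grouped by their component map, which alone decides whether the colouring v
    -- is respected.
    coloured-exact : ∀ v b → coloured v b ≡ Σℚ words (λ π → 𝟙 (compatible? v π) *ℚ exact π b)
    coloured-exact v b = trans (Σ-cong ms expand)
      (trans (Σ-comm ms words _) (Σ-cong words (λ π → Σ-* ms (𝟙 (compatible? v π)) (λ ts → 𝟙 (comp ts ≟W π) *ℚ f (wordOf ts)))))
      where
        ms = monos (suc b) (allFin d)
        ring : ∀ x y z → x *ℚ (y *ℚ z) ≡ y *ℚ (x *ℚ z)
        ring = solve-∀ ℚ-ring
        expand : ∀ ts → respects (lookup v) ε ts *ℚ f (wordOf ts) ≡
                 Σℚ words (λ π → 𝟙 (compatible? v π) *ℚ (𝟙 (comp ts ≟W π) *ℚ f (wordOf ts)))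
        expand ts = trans (cong (_*ℚ f (wordOf ts)) (respects-compatible v ts))
          (trans (sym (Σ-δ _≟W_ words-unique (words-complete (comp ts)) (λ π → 𝟙 (compatible? v π) *ℚ f (wordOf ts))))
            (Σ-cong words (λ π → ring (𝟙 (comp ts ≟W π)) (𝟙 (compatible? v π)) (f (wordOf ts)))))

    exact-zero : ∀ π → (∀ {b} (ts : Edges b) → comp ts ≢ π) → ∀ b → exact π b ≡ 0ℚ
    exact-zero π n b = Σ-zero (monos (suc b) (allFin d)) (λ ts _ → trans
      (cong (_*ℚ f (wordOf ts)) (𝟙-no (comp ts ≟W π) (n ts))) (ℚₚ.*-zeroˡ (f (wordOf ts))))

    Normal-≗0 : ∀ {s} → (∀ b → s b ≡ 0ℚ) → Normal s
    Normal-≗0 e = Subspace.E-resp Normal-subspace (λ b → sym (e b)) Normal-zero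

    Normal-Σ : {A : Set} (xs : List A) (s : A → ℕ → ℚ) → (∀ x → Normal (s x)) → Normal (λ b → Σℚ xs (λ x → s x b))
    Normal-Σ []       s n = Normal-zero
    Normal-Σ (x ∷ xs) s n = Subspace.E-resp Normal-subspace (λ b → ring (s x b) (Σℚ xs (λ x → s x b)))
      (Subspace.E-lin Normal-subspace 1ℚ 1ℚ (n x) (Normal-Σ xs s n))
      where ring : ∀ x y → 1ℚ *ℚ x +ℚ 1ℚ *ℚ y ≡ x +ℚ y
            ring = solve-∀ ℚ-ring

    deflationary? : ∀ π → Dec (Deflationary π)
    deflationary? π = Finₚ.all? (λ i → toℕ (lookup π i) ℕ.≤? toℕ i)

    other : Word → Word → ℕ → ℚ
    other π ρ b = (1ℚ -ℚ 𝟙 (π ≟W ρ)) *ℚ (𝟙 (compatible? π ρ) *ℚ exact ρ b)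

    exact-other : ∀ π → Compatible π π → ∀ b → exact π b ≡ coloured π b -ℚ Σℚ words (λ ρ → other π ρ b)
    exact-other π c b = sym (begin
      coloured π b -ℚ Σℚ words (λ ρ → other π ρ b)      ≡⟨ cong (_-ℚ Σℚ words (λ ρ → other π ρ b)) (trans (coloured-exact π b)
            (trans (Σ-cong words (λ ρ → ring (𝟙 (π ≟W ρ)) (t ρ))) (Σ-+ words (λ ρ → 𝟙 (π ≟W ρ) *ℚ t ρ) (λ ρ → other π ρ b)))) ⟩
      (Σℚ words (λ ρ → 𝟙 (π ≟W ρ) *ℚ t ρ) +ℚ Σℚ words (λ ρ → other π ρ b)) -ℚ Σℚ words (λ ρ → other π ρ b) ≡⟨ ring′ _ (Σℚ words (λ ρ → other π ρ b)) ⟩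
      Σℚ words (λ ρ → 𝟙 (π ≟W ρ) *ℚ t ρ)                ≡⟨ Σ-δ _≟W_ words-unique (words-complete π) t ⟩
      𝟙 (compatible? π π) *ℚ exact π b                  ≡⟨ cong (_*ℚ exact π b) (𝟙-yes (compatible? π π) c) ⟩
      1ℚ *ℚ exact π b                                   ≡⟨ ℚₚ.*-identityˡ (exact π b) ⟩
      exact π b                                         ∎)
      where
        open ≡-Reasoning
        t : Word → ℚ
        t ρ = 𝟙 (compatible? π ρ) *ℚ exact ρ b
        ring : ∀ x y → y ≡ x *ℚ y +ℚ (1ℚ -ℚ x) *ℚ y
        ring = solve-∀ ℚ-ring
        ring′ : ∀ x y → (x +ℚ y) -ℚ y ≡ x
        ring′ = solve-∀ ℚ-ring

    -- Compatibility of π with a deflationary ρ implies π ≤ ρ pointwise, so the system expressing the coloured sums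
    -- through the exact ones is triangular.
    exact-normal : ∀ n π → d * d ≤ weight π + n → Normal (exact π)
    exact-normal n π bound = go (deflationary? π) (compatible? π π)
      where
        term-normal : Deflationary π → ∀ ρ → Dec (π ≡ ρ) → Dec (Compatible π ρ) → Dec (Deflationary ρ) → Normal (other π ρ)
        term-normal def ρ (yes e) _ _ = Normal-≗0 (λ b → trans (cong (λ z → (1ℚ -ℚ z) *ℚ (𝟙 (compatible? π ρ) *ℚ exact ρ b)) (𝟙-yes (π ≟W ρ) e)) (ring (𝟙 (compatible? π ρ) *ℚ exact ρ b)))
          where ring : ∀ x → (1ℚ -ℚ 1ℚ) *ℚ x ≡ 0ℚ
                ring = solve-∀ ℚ-ring
        term-normal def ρ (no _) (no nc) _ = Normal-≗0 (λ b → trans (cong (λ z → (1ℚ -ℚ 𝟙 (π ≟W ρ)) *ℚ (z *ℚ exact ρ b)) (𝟙-no (compatible? π ρ) nc))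
            (ring (1ℚ -ℚ 𝟙 (π ≟W ρ)) (exact ρ b)))
          where ring : ∀ x y → x *ℚ (0ℚ *ℚ y) ≡ 0ℚ
                ring = solve-∀ ℚ-ring
        term-normal def ρ (no _) (yes _) (no nd) = Normal-≗0 (λ b → trans (cong (λ z → (1ℚ -ℚ 𝟙 (π ≟W ρ)) *ℚ (𝟙 (compatible? π ρ) *ℚ z))
            (exact-zero ρ (λ ts e → nd (subst Deflationary e (comp-deflationary ts))) b)) (ring (1ℚ -ℚ 𝟙 (π ≟W ρ)) (𝟙 (compatible? π ρ))))
          where ring : ∀ x y → x *ℚ (y *ℚ 0ℚ) ≡ 0ℚ
                ring = solve-∀ ℚ-ring
        term-normal def ρ (no ne) (yes c) (yes _) = Subspace.E-scale Normal-subspace (1ℚ -ℚ 𝟙 (π ≟W ρ))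
          (Subspace.E-scale Normal-subspace (𝟙 (compatible? π ρ)) (heavier n bound
            (weight-strict π ρ (λ i → subst (Fin._≤ lookup ρ i) (c i) (def (lookup ρ i))) ne)))
          where
            -- The fuel n bounds how far the weight can still rise, as no weight exceeds d * d.
            heavier : ∀ n → d * d ≤ weight π + n → weight π < weight ρ → Normal (exact ρ)
            heavier zero    b lt = ⊥-elim (ℕₚ.<-irrefl refl (ℕₚ.≤-trans lt (ℕₚ.≤-trans (weight-bound ρ) (ℕₚ.≤-trans b (ℕₚ.≤-reflexive (ℕₚ.+-identityʳ (weight π)))))))
            heavier (suc n) b lt = exact-normal n ρ (ℕₚ.≤-trans b (ℕₚ.≤-trans (ℕₚ.≤-reflexive (ℕₚ.+-suc (weight π) n)) (ℕₚ.+-monoˡ-≤ n lt)))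
        go : Dec (Deflationary π) → Dec (Compatible π π) → Normal (exact π)
        go (no nd) _ = Normal-≗0 (exact-zero π (λ ts e → nd (subst Deflationary e (comp-deflationary ts))))
        go (yes _) (no nc) = Normal-≗0 (exact-zero π (λ { ts refl → nc (compatible-comp (comp ts) ts (comp-monochromatic ts)) }))
        go (yes def) (yes c) = Subspace.E-resp Normal-subspace (λ b → sym (exact-other π c b))
          (Subspace.E-sub Normal-subspace (coloured-normal (lookup π) ε f)
            (Normal-Σ words (other π) (λ ρ → term-normal def ρ (π ≟W ρ) (compatible? π ρ) (deflationary? ρ))))

-- From weighted sums to the number of tuples

permutation? : ∀ (xs ys : List ℕ) → Dec (xs ↭ ys)
permutation? [] []       = yes ↭.refl
permutation? [] (y ∷ ys) = no (λ p → ↭ₚ.¬x∷xs↭[] (↭.↭-sym p))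
permutation? (x ∷ xs) ys with DecMembership._∈?_ ℕ._≟_ x ys
... | no n = no (λ p → n (↭ₚ.∈-resp-↭ p (here refl)))
... | yes m with as , bs , refl ← ∈ₚ.∈-∃++ m with permutation? xs (as ++ bs)
...   | yes p = yes (↭.trans (↭.prep x p) (↭.↭-sym (↭ₚ.shift x as bs)))
...   | no n  = no (λ p → n (↭ₚ.drop-mid [] as p))

ι-length-filter : {A : Set} {P : A → Set} (P? : Decidable P) (xs : List A) →
                  ι (pos (length (filter P? xs))) ≡ Σℚ xs (λ x → 𝟙 (P? x))
ι-length-filter P? xs = trans (ι-length (filter P? xs)) (trans (Σ-filter P? xs (λ _ → 1ℚ)) (Σ-cong xs (λ x → ℚₚ.*-identityʳ (𝟙 (P? x)))))
  where
    ι-length : ∀ xs → ι (pos (length xs)) ≡ Σℚ xs (λ _ → 1ℚ)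
    ι-length []       = ι-fromℕ 0
    ι-length (x ∷ xs) = trans (ι-suc (length xs)) (trans (cong (_+ℚ 1ℚ) (ι-length xs)) (ℚₚ.+-comm (Σℚ xs (λ _ → 1ℚ)) 1ℚ))

module MonotoneSequences (d : ℕ) where
  open Chains d

  Ascending : List (Fin d) → Set
  Ascending = AllPairs Fin._<_

  _≼_ : Fin d × Fin d → Fin d × Fin d → Set
  s ≼ t = toℕ (proj₂ s) ≤ toℕ (proj₂ t)

  monos-sound : ∀ b {ks} → Ascending ks → ∀ {ts} → ts ∈ monos b ks →
    VecAll.All (λ t → proj₁ t Fin.< proj₂ t) ts × AllPairs _≼_ (Vec.toList ts) × VecAll.All (λ t → proj₂ t ∈ ks) ts
  monos-sound zero    asc (here refl) = VecAll.[] , [] , VecAll.[]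
  monos-sound (suc b) {[]} asc ()
  monos-sound (suc b) {k ∷ ks} (k< ∷ asc) m with ∈ₚ.∈-++⁻ (Data.List.cartesianProductWith (λ a ts → (a , k) ∷ ts) (below k) (monos b (k ∷ ks))) m
  ... | inj₂ m' with p , q , r ← monos-sound (suc b) asc m' = p , q , VecAll.map there r
  ... | inj₁ m' with a , ts , a∈ , ts∈ , refl ← ∈ₚ.∈-cartesianProductWith⁻ (λ a ts → (a , k) ∷ ts) (below k) (monos b (k ∷ ks)) m'
      with p , q , r ← monos-sound b (k< ∷ asc) ts∈ =
        (below-< a∈ VecAll.∷ p) , (VecAllₚ.toList⁺ (VecAll.map (λ {t} → least {t}) r) ∷ q) , (here refl VecAll.∷ r)
    where
      least : ∀ {t : Fin d × Fin d} → proj₂ t ∈ k ∷ ks → (a , k) ≼ t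
      least (here refl) = ℕₚ.≤-refl
      least (there m)   = ℕₚ.<⇒≤ (All.lookup k< m)

  monos-complete : ∀ b {ks} → Ascending ks → ∀ (ts : Vec (Fin d × Fin d) b) →
    VecAll.All (λ t → proj₁ t Fin.< proj₂ t) ts → AllPairs _≼_ (Vec.toList ts) → VecAll.All (λ t → proj₂ t ∈ ks) ts → ts ∈ monos b ks
  monos-complete zero asc [] p q r = here refl
  monos-complete (suc b) {[]} asc (t ∷ ts) p q (() VecAll.∷ r)
  monos-complete (suc b) {k ∷ ks} asc ((a , .k) ∷ ts) (lt VecAll.∷ p) (le ∷ q) (here refl VecAll.∷ r) =
    ∈ₚ.∈-++⁺ˡ (∈ₚ.∈-cartesianProductWith⁺ (λ a ts → (a , k) ∷ ts) (<-below lt) (monos-complete b asc ts p q r))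
  monos-complete (suc b) {k ∷ ks} (k< ∷ asc) ((a , k') ∷ ts) (lt VecAll.∷ p) (le ∷ q) (there m VecAll.∷ r) =
    ∈ₚ.∈-++⁺ʳ (Data.List.cartesianProductWith (λ a ts → (a , k) ∷ ts) (below k) (monos b (k ∷ ks)))
      (monos-complete (suc b) asc ((a , k') ∷ ts) (lt VecAll.∷ p) (le ∷ q) (m VecAll.∷ VecAll.map (λ {t} → strict {t}) (VecAll.zip (VecAllₚ.toList⁻ le , r))))
    where
      strict : ∀ {t : Fin d × Fin d} → (a , k') ≼ t × proj₂ t ∈ k ∷ ks → proj₂ t ∈ ks
      strict (l , here refl) = ⊥-elim (ℕₚ.<-irrefl refl (ℕₚ.≤-trans (All.lookup k< m) l))
      strict (l , there m')  = m'

  monos-unique : ∀ b {ks} → Ascending ks → Unique (monos b ks)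
  monos-unique zero    asc = [] ∷ []
  monos-unique (suc b) {[]} asc = []
  monos-unique (suc b) {k ∷ ks} (k< ∷ asc) = Uniqueₚ.++⁺
    (Uniqueₚ.cartesianProductWith⁺ (λ a ts → (a , k) ∷ ts) (λ { refl → refl , refl })
      (Uniqueₚ.filter⁺ (Finₚ._<? k) descending-unique) (monos-unique b (k< ∷ asc)))
    (monos-unique (suc b) asc)
    λ { (m , m') → disjoint (∈ₚ.∈-cartesianProductWith⁻ (λ a ts → (a , k) ∷ ts) (below k) (monos b (k ∷ ks)) m) (monos-sound (suc b) asc m') }
    where
      disjoint : ∀ {ts : Vec (Fin d × Fin d) (suc b)} → ∃[ a ] ∃[ us ] (a ∈ below k × us ∈ monos b (k ∷ ks) × ts ≡ (a , k) ∷ us) →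
        VecAll.All (λ t → proj₁ t Fin.< proj₂ t) ts × AllPairs _≼_ (Vec.toList ts) × VecAll.All (λ t → proj₂ t ∈ ks) ts → ⊥
      disjoint (a , us , _ , _ , refl) (_ , _ , m VecAll.∷ _) = ℕₚ.<-irrefl refl (All.lookup k< m)

  allFin-ascending : Ascending (allFin d)
  allFin-ascending = AllPairsₚ.tabulate⁺-< id

module Counting (n : ℕ) (μ : List ℕ) where
  private d = suc n
  open JucysMurphy d using (Word; words; words-complete; words-unique)
  open Chains d
  open Components d
  open MonotoneSequences d

  zeros : Word
  zeros = Vec.replicate d Fin.zero

  Inverse : Word → Word → Set
  Inverse σ w = ∀ x → lookup σ (lookup w x) ≡ x

  inverse? : ∀ σ w → Dec (Inverse σ w)
  inverse? σ w = Finₚ.all? (λ x → lookup σ (lookup w x) Finₚ.≟ x)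

  inClass? : ∀ (f : Fin d → Fin d) → Dec (InClass f μ)
  inClass? f = map′ (λ i {x} {y} → i x y) (λ i x y → i {x} {y})
    (Finₚ.all? (λ x → Finₚ.all? (λ y → (f x Finₚ.≟ f y) →-dec (x Finₚ.≟ y)))) ×-dec permutation? (cycleLengths f) μ

  -- Transitivity speaks of all words in the generators; given the other conditions it amounts to
  -- all points having component label 0, which is decidable.
  Connected : ∀ {b} → Word × Edges b → Set
  Connected (σ , ts) = InClass (lookup σ) μ × Inverse σ (tabulate (prodT ts)) × comp ts ≡ zeros

  connected? : ∀ {b} → Decidable (Connected {b})
  connected? (σ , ts) = inClass? (lookup σ) ×-dec (inverse? σ (tabulate (prodT ts)) ×-dec (comp ts ≟W zeros))

  -- The weight of a product w of transpositions: 1 if w has an inverse of cycle type μ and 0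
  -- otherwise, since a left inverse of w is unique.
  completions : Word → ℚ
  completions w = Σℚ words (λ σ → 𝟙 (inClass? (lookup σ)) *ℚ 𝟙 (inverse? σ w))

  tuples : ∀ b → List (Word × Edges b)
  tuples b = filter connected? (cartesianProduct words (monos b (allFin d)))

  connectedSum : ℕ → ℚ
  connectedSum b = Σℚ (monos b (allFin d)) (λ ts → 𝟙 (comp ts ≟W zeros) *ℚ completions (tabulate (prodT ts)))

  ι-tuples : ∀ b → ι (pos (length (tuples b))) ≡ connectedSum b
  ι-tuples b = begin
    ι (pos (length (tuples b)))                              ≡⟨ ι-length-filter connected? (cartesianProduct words ms) ⟩
    Σℚ (cartesianProduct words ms) (λ x → 𝟙 (connected? x))  ≡⟨ Σ-cartesianProductWith _,_ words ms (λ x → 𝟙 (connected? x)) ⟩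
    Σℚ words (λ σ → Σℚ ms (λ ts → 𝟙 (connected? (σ , ts))))  ≡⟨ Σ-comm words ms (λ σ ts → 𝟙 (connected? (σ , ts))) ⟩
    Σℚ ms (λ ts → Σℚ words (λ σ → 𝟙 (connected? (σ , ts))))  ≡⟨ Σ-cong ms (λ ts → trans (Σ-cong words (λ σ → split σ ts))
                                                                 (Σ-* words (𝟙 (comp ts ≟W zeros)) (λ σ → 𝟙 (inClass? (lookup σ)) *ℚ 𝟙 (inverse? σ (tabulate (prodT ts)))))) ⟩
    connectedSum b                                           ∎
    where
      open ≡-Reasoning
      ms = monos b (allFin d)
      ring : ∀ x y z → x *ℚ (y *ℚ z) ≡ z *ℚ (x *ℚ y)
      ring = solve-∀ ℚ-ring
      split : ∀ σ (ts : Edges b) → 𝟙 (connected? (σ , ts)) ≡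
              𝟙 (comp ts ≟W zeros) *ℚ (𝟙 (inClass? (lookup σ)) *ℚ 𝟙 (inverse? σ (tabulate (prodT ts))))
      split σ ts = trans (𝟙-× (inClass? (lookup σ)) (inverse? σ (tabulate (prodT ts)) ×-dec (comp ts ≟W zeros)))
        (trans (cong (𝟙 (inClass? (lookup σ)) *ℚ_) (𝟙-× (inverse? σ (tabulate (prodT ts))) (comp ts ≟W zeros)))
          (ring (𝟙 (inClass? (lookup σ))) (𝟙 (inverse? σ (tabulate (prodT ts)))) (𝟙 (comp ts ≟W zeros))))

  module _ {b : ℕ} (σ : Word) (ts : Edges b) where

    private π = lookup (comp ts)

    act-++ : ∀ w w' x → act σ ts (w ++ w') x ≡ act σ ts w' (act σ ts w x)
    act-++ []      w' x = refl
    act-++ (i ∷ w) w' x = act-++ w w' (gen σ ts i x)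

    transitive : comp ts ≡ zeros → Transitive σ ts
    transitive e x y = proj₁ (R-trans (reach x) (R-sym (reach y)))
      where
        -- Reachability is recorded in both directions because the words contain no inverses; a
        -- transposition supplies both at once.
        R : Fin d → Fin d → Set
        R x y = (∃[ w ] act σ ts w x ≡ y) × (∃[ w ] act σ ts w y ≡ x)
        R-sym : ∀ {x y} → R x y → R y x
        R-sym (p , q) = q , p
        R-trans : ∀ {x y z} → R x y → R y z → R x z
        R-trans ((w , p) , (w' , p')) ((u , q) , (u' , q')) =
          (w ++ u , trans (act-++ w u _) (trans (cong (act σ ts u) p) q)) ,
          (u' ++ w' , trans (act-++ u' w' _) (trans (cong (act σ ts w') q') p'))
        edge : ∀ i → R (proj₁ (lookup ts i)) (proj₂ (lookup ts i))
        edge i = (Fin.suc i ∷ [] , swap-left (proj₁ (lookup ts i)) (proj₂ (lookup ts i))) ,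
                 (Fin.suc i ∷ [] , swap-right (proj₁ (lookup ts i)) (proj₂ (lookup ts i)))
        reach : ∀ x → R x Fin.zero
        reach x = subst (R x) (trans (cong (λ v → lookup v x) e) (Vecₚ.lookup-replicate x Fin.zero))
          (comp-related R (([] , refl) , ([] , refl)) R-sym R-trans ts (VecAllₚ.lookup⁻ edge) x)

    prodT-invariant : ∀ {b} (us : Edges b) (χ : Fin d → Fin d) → Monochromatic χ us → ∀ x → χ (prodT us x) ≡ χ x
    prodT-invariant []             χ m x = refl
    prodT-invariant ((a , k) ∷ us) χ (e VecAll.∷ m) x =
      trans (swap-cases (λ y y' → χ y' ≡ χ y) (sym e) e (λ _ _ → refl) (prodT us x)) (prodT-invariant us χ m x)

    -- The product of the transpositions preserves every component, hence so does its inverse σ. An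
    -- orbit thus lies in one component, and the one containing 0 has label 0.
    connected : Injective _≡_ _≡_ (lookup σ) → (∀ x → lookup σ (prodT ts x) ≡ x) → Transitive σ ts → comp ts ≡ zeros
    connected inj inv trn = vec-ext (λ x → trans (constant x) (sym (Vecₚ.lookup-replicate x Fin.zero)))
      where
        gen-invariant : ∀ i x → π (gen σ ts i x) ≡ π x
        gen-invariant Fin.zero    x = sym (trans (cong π (sym (inj (inv (lookup σ x)))))
          (prodT-invariant ts π (comp-monochromatic ts) (lookup σ x)))
        gen-invariant (Fin.suc i) x = swap-cases (λ y y' → π y' ≡ π y) (sym e) e (λ _ _ → refl) x
          where e = VecAllₚ.lookup⁺ (comp-monochromatic ts) i
        act-invariant : ∀ w x → π (act σ ts w x) ≡ π x
        act-invariant []      x = refl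
        act-invariant (i ∷ w) x = trans (act-invariant w (gen σ ts i x)) (gen-invariant i x)
        constant : ∀ x → π x ≡ Fin.zero
        constant x = Finₚ.toℕ-injective (ℕₚ.n≤0⇒n≡0 (ℕₚ.≤-trans (ℕₚ.≤-reflexive (cong toℕ
          (trans (sym (act-invariant (proj₁ (trn x Fin.zero)) x)) (cong π (proj₂ (trn x Fin.zero))))))
          (comp-deflationary ts Fin.zero)))

  tuples-card : ∀ g → Card (IsMonotoneTuple d μ g) (length (tuples (bNum d μ g)))
  tuples-card g = tuples b , Uniqueₚ.filter⁺ connected? (Uniqueₚ.cartesianProduct⁺ words-unique (monos-unique b allFin-ascending)) ,
    (λ x → mk⇔ (sound x) (complete x)) , refl
    where
      b = bNum d μ g
      sound : ∀ x → x ∈ tuples b → IsMonotoneTuple d μ g x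
      sound (σ , ts) m with m' , cls , inv , con ← ∈ₚ.∈-filter⁻ connected? {xs = cartesianProduct words (monos b (allFin d))} m
        with _ , ts∈ ← ∈ₚ.∈-cartesianProduct⁻ words (monos b (allFin d)) m'
        with lt , srt , _ ← monos-sound b allFin-ascending ts∈ =
          cls , lt , (λ x → trans (cong (lookup σ) (sym (Vecₚ.lookup∘tabulate (prodT ts) x))) (inv x)) ,
          transitive σ ts con , Linkedₚ.AllPairs⇒Linked srt
      complete : ∀ x → IsMonotoneTuple d μ g x → x ∈ tuples b
      complete (σ , ts) (cls , lt , inv , trn , srt) = ∈ₚ.∈-filter⁺ connected?
        (∈ₚ.∈-cartesianProduct⁺ (words-complete σ) (monos-complete b allFin-ascending ts lt
          (Linkedₚ.Linked⇒AllPairs ℕₚ.≤-trans srt) (VecAllₚ.lookup⁻ (λ i → ∈ₚ.∈-allFin (proj₂ (lookup ts i))))))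
        (cls , (λ x → trans (cong (lookup σ) (Vecₚ.lookup∘tabulate (prodT ts) x)) (inv x)) , connected σ ts (proj₁ cls) inv trn)

  connectedSum-normal : ∀ ε → NormalForm.Normal n ε (λ b → connectedSum (suc b))
  connectedSum-normal ε = Counts.exact-normal ε completions (d * d) zeros (ℕₚ.m≤n+m (d * d) (weight zeros))

-- Assembling the formula over all genera

pow-even : ∀ g n → pow (ℚ.- 1ℚ) (2 * g + n) ≡ pow (ℚ.- 1ℚ) n
pow-even zero    n = refl
pow-even (suc g) n = trans (cong (λ k → pow (ℚ.- 1ℚ) (k + n)) (ℕₚ.*-suc 2 g))
  (trans (ring (pow (ℚ.- 1ℚ) (2 * g + n))) (pow-even g n))
  where ring : ∀ x → (ℚ.- 1ℚ) *ℚ ((ℚ.- 1ℚ) *ℚ x) ≡ x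
        ring = solve-∀ ℚ-ring

-- Writing the degree as d + 2 and the length as l + 1 makes the truncated subtraction exact and b
-- positive, so sequences indexed from b = 1 on cover every genus.
bNum-suc : ∀ d l g → 2 * g + suc (suc d) + suc l ∸ 2 ≡ suc (2 * g + (d + l))
bNum-suc d l g = trans (cong (_∸ 2) (trans (ℕₚ.+-assoc (2 * g) (suc (suc d)) (suc l))
    (trans (cong (2 * g +_) (cong (λ k → suc (suc k)) (ℕₚ.+-suc d l)))
      (trans (ℕₚ.+-suc (2 * g) (suc (suc (d + l)))) (cong suc (trans (ℕₚ.+-suc (2 * g) (suc (d + l))) (cong suc (ℕₚ.+-suc (2 * g) (d + l))))))))) refl

theorem1p1 : (d : ℕ) → 2 ≤ d → (μ : List ℕ) → IsPartition d μ →
    Σ[ C ∈ (ℕ → ℕ → ℚ) ] ((g : ℕ) → Σ[ H ∈ ℚ ] (MonotoneHurwitz d μ g H ×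
    fromℕ (product μ) *ℚ H ≡
    sumTo (d ∸ 1) (λ k → sumTo (floorDiv (d ∸ 1) k) (λ i →
    C k i *ℚ fromℕ (bNum d μ g ^ (i ∸ 1) * k ^ bNum d μ g)))))
theorem1p1 (suc (suc d)) (s≤s (s≤s z≤n)) [] part with () ← IsPartition.sums part
theorem1p1 (suc (suc d)) (s≤s (s≤s z≤n)) μ@(_ ∷ ν) part = proj₁ normal , λ g →
  hurwitzFromCount (suc (suc d)) μ (length (tuples (bNum (suc (suc d)) μ g))) ,
  (length (tuples (bNum (suc (suc d)) μ g)) , tuples-card g , refl) ,
  trans (factor g) (subst Expansion (sym (bNum-suc d (length ν) g))
    (proj₂ normal (2 * g + (d + length ν)) (sign g)))
  where
    open Counting (suc d) μ
    A = ((pos (autSize (suc (suc d)) μ)) ℚ./ (suc (suc d) ℕ.!)) {{suc (suc d) ℕₚ.!≢0}}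
    K = fromℕ (product μ) *ℚ A
    -- The value of (-1)^b at genus 0, hence at every genus.
    ε = pow (ℚ.- 1ℚ) (suc (d + length ν))
    normal = Subspace.E-scale (NormalForm.Normal-subspace (suc d) ε) K (connectedSum-normal ε)
    Expansion : ℕ → Set
    Expansion b = K *ℚ connectedSum b ≡ sumTo (suc d) (λ k → sumTo (floorDiv (suc d) k) (λ i →
      proj₁ normal k i *ℚ fromℕ (b ^ (i ∸ 1) * k ^ b)))
    sign : ∀ g → pow (ℚ.- 1ℚ) (suc (2 * g + (d + length ν))) ≡ ε
    sign g = cong ((ℚ.- 1ℚ) *ℚ_) (pow-even g (d + length ν))
    factor : ∀ g → fromℕ (product μ) *ℚ hurwitzFromCount (suc (suc d)) μ (length (tuples (bNum (suc (suc d)) μ g)))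
                 ≡ K *ℚ connectedSum (bNum (suc (suc d)) μ g)
    factor g = trans (sym (ℚₚ.*-assoc (fromℕ (product μ)) A (fromℕ (length (tuples (bNum (suc (suc d)) μ g))))))
      (cong (K *ℚ_) (trans (sym (ι-fromℕ (length (tuples (bNum (suc (suc d)) μ g))))) (ι-tuples (bNum (suc (suc d)) μ g))))
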